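{- Let $L$ be a valid lattice and $K$ a Kasteleyn matrix for $\mathbb{T}_L$. Let $p_K(q_0,q_1)$ be the Laurent polynomial given by $\det(K)$. Then there is a choice of constants $s_{00},s_{01},s_{10},s_{11}\in\{\frac12,-\frac12\}$ such that the total number of tilings of $\mathbb{T}_L$ is $$s_{00}\,p_K(1,1)+s_{01}\,p_K(1,-1)+s_{10}\,p_K(-1,1)+s_{11}\,p_K(-1,-1).$$
   Context: Tilings: the unit square $[i,i+1]\times[j,j+1]$ ($i,j\in\mathbb{Z}$) is black if $i+j$ is even and white otherwise. A domino is the union of two unit squares sharing a side; a tiling of $\mathbb{Z}^2$ is a set of dominoes with pairwise disjoint interiors covering $\mathbb{R}^2$. A valid lattice is a subgroup $L\subset\mathbb{Z}^2$ generated by two linearly independent vectors, each of which has both coordinates even or both coordinates odd. A tiling of $\mathbb{T}_L=\mathbb{R}^2/L$ is identified with an $L$-periodic tiling of $\mathbb{Z}^2$. Kasteleyn matrix: let $x_0$ be the smallest positive integer with $v_0=(x_0,0)\in L$, $y_1$ the smallest positive integer such that $L$ contains a vector with second coordinate $y_1$, and $v_1=(x_1,y_1)$ the unique such vector in $L$ with $0\le x_1<x_0$; $\{v_0,v_1\}$ generates $L$. The rectangle $D_L=[0,x_0]\times[0,y_1]$ is a fundamental domain with equally many black and white squares; enumerate its black squares $b_1,\dots,b_m$ and its white squares $w_1,\dots,w_m$ (arbitrarily). Let $G(\mathbb{Z}^2)$ be the graph whose vertices are the centers of unit squares, with edges joining centers of squares sharing a side (edges correspond to dominoes). An edge has sign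 $-1$ if it is horizontal with black left endpoint and white right endpoint, and $+1$ otherwise. Let $u(0)$ be the straight lattice path from $(0,0)$ to $v_0$ and $u(1)$ the lattice path $(0,0)\to(0,y_1)\to(x_1,y_1)$. Each $L$-orbit $[e]_L$ of edges of $G(\mathbb{Z}^2)$ has weight: its sign, multiplied for each $k\in\{0,1\}$ by $q_k$ (resp. $q_k^{ -1}$) if some edge in $[e]_L$ crosses $u(k)$ with its black endpoint to the left (resp. right) of the oriented path $u(k)$, and by $1$ if no edge of $[e]_L$ crosses $u(k)$. The entry $K(i,j)$ is the sum of the weights of the $L$-orbits of edges joining an $L$-translate of $b_i$ to an $L$-translate of $w_j$ (0 if there are none). -}

module Defs where

open import Algebra.Bundles.Raw using (RawRing)
import Algebra.Definitions.RawMonoid as RawMonoidDefinitions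
import Algebra.Definitions.RawSemiring as RawSemiringDefinitions
open import Data.Bool.Base using (Bool; T; if_then_else_)
open import Data.Fin.Base using (Fin; zero; suc; toℕ; punchIn)
open import Data.Integer.Base as ℤ using (ℤ; +_; -[1+_]; 0ℤ; 1ℤ; -1ℤ)
import Data.Integer.Properties as ℤ
open import Data.Integer.Divisibility.Signed using (_∣_; _∣?_; divides)
open import Data.Integer.Tactic.RingSolver using (solve-∀)
open import Data.List.Base using (List; []; _∷_; _++_; map; foldr; upTo; cartesianProductWith)
open import Data.List.Relation.Unary.All using (All)
open import Data.List.Relation.Unary.AllPairs using (AllPairs)
open import Data.List.Relation.Unary.Any using (Any; any?)
open import Data.Nat.Base as ℕ using (ℕ; zero; suc)
open import Data.Product using (Σ; _×_; _,_; proj₁; proj₂; ∃; ∃₂)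
open import Data.Rational.Base as ℚ using (ℚ; 0ℚ; 1/_)
open import Data.Sum.Base using (_⊎_)
open import Function.Bundles using (Inverse)
open import Function.Definitions using (Injective)
open import Level using (0ℓ)
open import Relation.Binary.Bundles using (Setoid)
open import Relation.Binary.Definitions using (DecidableEquality)
open import Relation.Binary.PropositionalEquality
  using (_≡_; _≢_; refl; sym; trans; cong; cong₂; subst; setoid)
open import Relation.Nullary using (¬_; Dec; yes; no; does; _×-dec_; ¬?)
open import Relation.Nullary.Decidable using (map′)

ℤ² : Set
ℤ² = ℤ × ℤ

infixl 6 _⊕_ _⊖_
infixr 7 _•_

_⊕_ : ℤ² → ℤ² → ℤ²
(a , b) ⊕ (c , d) = a ℤ.+ c , b ℤ.+ d

_⊖_ : ℤ² → ℤ² → ℤ²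
(a , b) ⊖ (c , d) = a ℤ.- c , b ℤ.- d

_•_ : ℤ → ℤ² → ℤ²
k • (a , b) = k ℤ.* a , k ℤ.* b

0⃗ : ℤ²
0⃗ = 0ℤ , 0ℤ

Even : ℤ → Set
Even i = + 2 ∣ i

even? : ∀ i → Dec (Even i)
even? i = + 2 ∣? i

SameParity : ℤ² → Set
SameParity (a , b) = (Even a × Even b) ⊎ (¬ Even a × ¬ Even b)

LinearlyIndependent : ℤ² → ℤ² → Set
LinearlyIndependent g h = ∀ m n → m • g ⊕ n • h ≡ 0⃗ → m ≡ 0ℤ × n ≡ 0ℤ

record ValidLattice : Set where
  field
    g h         : ℤ²
    independent : LinearlyIndependent g h
    parity-g    : SameParity g
    parity-h    : SameParity h

infix 4 _∈_ _∈?_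

_∈_ : ℤ² → ValidLattice → Set
v ∈ L = ∃₂ λ m n → v ≡ m • g ⊕ n • h
  where open ValidLattice L

independent⇒det≢0 : ∀ g h → LinearlyIndependent g h →
  proj₁ g ℤ.* proj₂ h ℤ.- proj₂ g ℤ.* proj₁ h ≢ 0ℤ
independent⇒det≢0 (a , b) (c , d) ind D≡0 = 1≢0 (proj₁ (ind 1ℤ 0ℤ (cong₂ _,_ e₅ e₆)))
  where
  1≢0 : 1ℤ ≢ 0ℤ
  1≢0 ()
  r₁ : ∀ a b c d → d ℤ.* a ℤ.+ (ℤ.- b) ℤ.* c ≡ a ℤ.* d ℤ.- b ℤ.* c
  r₁ = solve-∀
  r₂ : ∀ b d → d ℤ.* b ℤ.+ (ℤ.- b) ℤ.* d ≡ 0ℤ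
  r₂ = solve-∀
  r₃ : ∀ a b c d → (ℤ.- c) ℤ.* b ℤ.+ a ℤ.* d ≡ a ℤ.* d ℤ.- b ℤ.* c
  r₃ = solve-∀
  r₄ : ∀ a c → (ℤ.- c) ℤ.* a ℤ.+ a ℤ.* c ≡ 0ℤ
  r₄ = solve-∀
  r₅ : ∀ a c → 1ℤ ℤ.* a ℤ.+ 0ℤ ℤ.* c ≡ a
  r₅ = solve-∀
  a≡0 : a ≡ 0ℤ
  a≡0 = proj₂ (ind (ℤ.- c) a (cong₂ _,_ (r₄ a c) (trans (r₃ a b c d) D≡0)))
  b≡0 : b ≡ 0ℤ
  b≡0 = trans (sym (ℤ.neg-involutive b))
    (cong ℤ.-_ (proj₂ (ind d (ℤ.- b) (cong₂ _,_ (trans (r₁ a b c d) D≡0) (r₂ b d)))))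
  e₅ : 1ℤ ℤ.* a ℤ.+ 0ℤ ℤ.* c ≡ 0ℤ
  e₅ = trans (r₅ a c) a≡0
  e₆ : 1ℤ ℤ.* b ℤ.+ 0ℤ ℤ.* d ≡ 0ℤ
  e₆ = trans (r₅ b d) b≡0

-- By Cramer's rule, the coordinates of v in the basis g, h are the two
-- quotients by the determinant D.
_∈?_ : ∀ v L → Dec (v ∈ L)
(x , y) ∈? L = map′ to from ((D ∣? x ℤ.* d ℤ.- y ℤ.* c) ×-dec (D ∣? a ℤ.* y ℤ.- b ℤ.* x))
  where
  open ValidLattice L
  a = proj₁ g
  b = proj₂ g
  c = proj₁ h
  d = proj₂ h
  D = a ℤ.* d ℤ.- b ℤ.* c
  instance
    D-nonZero : ℤ.NonZero D
    D-nonZero = ℤ.≢-nonZero (independent⇒det≢0 g h independent)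
  r₁ : ∀ a b c d x y → (a ℤ.* d ℤ.- b ℤ.* c) ℤ.* x
     ≡ a ℤ.* (x ℤ.* d ℤ.- y ℤ.* c) ℤ.+ c ℤ.* (a ℤ.* y ℤ.- b ℤ.* x)
  r₁ = solve-∀
  r₂ : ∀ a b c d x y → (a ℤ.* d ℤ.- b ℤ.* c) ℤ.* y
     ≡ b ℤ.* (x ℤ.* d ℤ.- y ℤ.* c) ℤ.+ d ℤ.* (a ℤ.* y ℤ.- b ℤ.* x)
  r₂ = solve-∀
  r₃ : ∀ a c m n D → a ℤ.* (m ℤ.* D) ℤ.+ c ℤ.* (n ℤ.* D) ≡ D ℤ.* (m ℤ.* a ℤ.+ n ℤ.* c)
  r₃ = solve-∀
  r₄ : ∀ a b c d m n → (m ℤ.* a ℤ.+ n ℤ.* c) ℤ.* d ℤ.- (m ℤ.* b ℤ.+ n ℤ.* d) ℤ.* c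
     ≡ m ℤ.* (a ℤ.* d ℤ.- b ℤ.* c)
  r₄ = solve-∀
  r₅ : ∀ a b c d m n → a ℤ.* (m ℤ.* b ℤ.+ n ℤ.* d) ℤ.- b ℤ.* (m ℤ.* a ℤ.+ n ℤ.* c)
     ≡ n ℤ.* (a ℤ.* d ℤ.- b ℤ.* c)
  r₅ = solve-∀
  to : D ∣ x ℤ.* d ℤ.- y ℤ.* c × D ∣ a ℤ.* y ℤ.- b ℤ.* x → (x , y) ∈ L
  to (divides m p , divides n q) = m , n , cong₂ _,_
    (ℤ.*-cancelˡ-≡ D _ _ (trans (r₁ a b c d x y)
      (trans (cong₂ (λ s t → a ℤ.* s ℤ.+ c ℤ.* t) p q) (r₃ a c m n D))))
    (ℤ.*-cancelˡ-≡ D _ _ (trans (r₂ a b c d x y)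
      (trans (cong₂ (λ s t → b ℤ.* s ℤ.+ d ℤ.* t) p q) (r₃ b d m n D))))
  from : (x , y) ∈ L → D ∣ x ℤ.* d ℤ.- y ℤ.* c × D ∣ a ℤ.* y ℤ.- b ℤ.* x
  from (m , n , refl) = divides m (r₄ a b c d m n) , divides n (r₅ a b c d m n)

-- (i , j) stands for [i, i+1] × [j, j+1].
Square : Set
Square = ℤ²

Black White : Square → Set
Black (i , j) = Even (i ℤ.+ j)
White s = ¬ Black s

black? : ∀ s → Dec (Black s)
black? (i , j) = even? (i ℤ.+ j)

data Orientation : Set where
  horizontal vertical : Orientation

_≟ᵒ_ : DecidableEquality Orientation
horizontal ≟ᵒ horizontal = yes refl
horizontal ≟ᵒ vertical   = no λ ()
vertical   ≟ᵒ horizontal = no λ ()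
vertical   ≟ᵒ vertical   = yes refl

unit : Orientation → ℤ²
unit horizontal = 1ℤ , 0ℤ
unit vertical   = 0ℤ , 1ℤ

-- A domino, equivalently an edge of the graph G(ℤ²), is given by its
-- left (if horizontal) or lower (if vertical) square.
record Domino : Set where
  constructor domino
  field
    orientation : Orientation
    first       : Square

  second : Square
  second = first ⊕ unit orientation

open Domino public

Edge : Set
Edge = Domino

infix 4 _∈ᵈ_

_∈ᵈ_ : Square → Domino → Set
s ∈ᵈ d = s ≡ first d ⊎ s ≡ second d

shift : ℤ² → Domino → Domino
shift v (domino o s) = domino o (s ⊕ v)

-- The dominoes cover ℝ² iff every unit square lies in one of them, and
-- two dominoes have disjoint interiors iff they share no unit square.
record Tiling : Set where
  field
    contains : Domino → Bool
    covering : ∀ s → ∃ λ d → T (contains d) × s ∈ᵈ d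
    disjoint : ∀ d d′ → T (contains d) → T (contains d′) →
               d ≢ d′ → ¬ (∃ λ s → s ∈ᵈ d × s ∈ᵈ d′)

open Tiling public using (contains)

Periodic : ValidLattice → Tiling → Set
Periodic L t = ∀ v → v ∈ L → ∀ d → contains t (shift v d) ≡ contains t d

-- Two tilings are equal when they contain the same dominoes.
TorusTilings : ValidLattice → Setoid 0ℓ 0ℓ
TorusTilings L = record
  { Carrier       = Σ Tiling (Periodic L)
  ; _≈_           = λ (t , _) (t′ , _) → ∀ d → contains t d ≡ contains t′ d
  ; isEquivalence = record
    { refl  = λ _ → refl
    ; sym   = λ p d → sym (p d)
    ; trans = λ p q d → trans (p d) (q d)
    }
  }

NumberOfTilings : ValidLattice → ℕ → Set
NumberOfTilings L N = Inverse (setoid (Fin N)) (TorusTilings L)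

record Monomial : Set where
  constructor monomial
  field
    coeff       : ℤ
    deg₀ deg₁   : ℤ

open Monomial public

-- A Laurent polynomial is a formal sum of monomials, in which like terms
-- need not be collected; equality is equality of all coefficients.
Laurent : Set
Laurent = List Monomial

coefficient : Laurent → ℤ → ℤ → ℤ
coefficient p a b = foldr (λ t c → (if does (deg₀ t ℤ.≟ a) then
                                     if does (deg₁ t ℤ.≟ b) then coeff t else 0ℤ
                                     else 0ℤ) ℤ.+ c) 0ℤ p

_*ᵐ_ : Monomial → Monomial → Monomial
monomial c a b *ᵐ monomial c′ a′ b′ = monomial (c ℤ.* c′) (a ℤ.+ a′) (b ℤ.+ b′)

-ᵐ_ : Monomial → Monomial
-ᵐ monomial c a b = monomial (ℤ.- c) a b

laurentRawRing : RawRing 0ℓ 0ℓ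
laurentRawRing = record
  { Carrier = Laurent
  ; _≈_     = λ p q → ∀ a b → coefficient p a b ≡ coefficient q a b
  ; _+_     = _++_
  ; _*_     = cartesianProductWith _*ᵐ_
  ; -_      = map -ᵐ_
  ; 0#      = []
  ; 1#      = monomial 1ℤ 0ℤ 0ℤ ∷ []
  }

open RawSemiringDefinitions ℚ.+-*-rawSemiring using (_^_)

_^ᶻ_ : (q : ℚ) .{{_ : ℚ.NonZero q}} → ℤ → ℚ
q ^ᶻ (+ n)    = q ^ n
q ^ᶻ -[1+ n ] = (1/ q) ^ suc n

evaluate : Laurent → (q₀ q₁ : ℚ) .{{_ : ℚ.NonZero q₀}} .{{_ : ℚ.NonZero q₁}} → ℚ
evaluate p q₀ q₁ =
  foldr (λ t r → (coeff t ℚ./ 1) ℚ.* (q₀ ^ᶻ deg₀ t) ℚ.* (q₁ ^ᶻ deg₁ t) ℚ.+ r) 0ℚ p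

module _ {c ℓ} (R : RawRing c ℓ) where
  open RawRing R
  open RawMonoidDefinitions +-rawMonoid using (sum)
  open RawSemiringDefinitions rawSemiring renaming (_^_ to _^ᴿ_) using ()

  -- Laplace expansion along the first row.
  det : ∀ {n} → (Fin n → Fin n → Carrier) → Carrier
  det {zero}  M = 1#
  det {suc n} M = sum λ j →
    ((- 1#) ^ᴿ toℕ j) * (M zero j * det λ i k → M (suc i) (punchIn j k))

-- Existence of x with (x , y₁) ∈ L is witnessed by v₁-∈.
record LatticeBasis (L : ValidLattice) : Set where
  field
    x₀ y₁ x₁ : ℕ

  v₀ : ℤ²
  v₀ = + x₀ , 0ℤ

  v₁ : ℤ²
  v₁ = + x₁ , + y₁

  field
    x₀-positive : 0 ℕ.< x₀
    v₀-∈        : v₀ ∈ L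
    x₀-least    : ∀ x → 0 ℕ.< x → (+ x , 0ℤ) ∈ L → x₀ ℕ.≤ x
    y₁-positive : 0 ℕ.< y₁
    v₁-∈        : v₁ ∈ L
    y₁-least    : ∀ y → 0 ℕ.< y → (∃ λ x → (x , + y) ∈ L) → y₁ ℕ.≤ y
    x₁<x₀       : x₁ ℕ.< x₀

-- The argument is the start of the step; its end is one unit east or north.
data Step : Set where
  east north : ℤ² → Step

-- An east step has the square (i , j) on its left and (i , j - 1) on its
-- right; a north step has (i - 1 , j) on its left and (i , j) on its right.
-- The crossed edge joins these two squares.
crossed : Step → Edge
crossed (east  (i , j)) = domino vertical   (i , j ℤ.- 1ℤ)
crossed (north (i , j)) = domino horizontal (i ℤ.- 1ℤ , j)

leftSquare : Step → Square
leftSquare (east  (i , j)) = i , j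
leftSquare (north (i , j)) = i ℤ.- 1ℤ , j

module _ {L : ValidLattice} where

  infix 4 _∼_ _∼?_

  _∼_ : Edge → Edge → Set
  e ∼ e′ = ∃ λ v → v ∈ L × e′ ≡ shift v e

  _∼?_ : ∀ e e′ → Dec (e ∼ e′)
  domino o s@(a , b) ∼? domino o′ s′@(a′ , b′) =
    map′ to from ((o ≟ᵒ o′) ×-dec (s′ ⊖ s ∈? L))
    where
    r₁ : ∀ a b → b ≡ a ℤ.+ (b ℤ.- a)
    r₁ = solve-∀
    r₂ : ∀ a b → b ≡ (a ℤ.+ b) ℤ.- a
    r₂ = solve-∀
    to : o ≡ o′ × (s′ ⊖ s) ∈ L → domino o s ∼ domino o′ s′
    to (refl , v∈L) = s′ ⊖ s , v∈L , cong (domino o) (cong₂ _,_ (r₁ a a′) (r₁ b b′))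
    from : domino o s ∼ domino o′ s′ → o ≡ o′ × (s′ ⊖ s) ∈ L
    from ((x , y) , v∈L , refl) =
      refl , subst (_∈ L) (cong₂ _,_ (r₂ a x) (r₂ b y)) v∈L

  CrossesBlackLeft CrossesBlackRight : List Step → Edge → Set
  CrossesBlackLeft  u e = Any (λ σ → e ∼ crossed σ × Black (leftSquare σ)) u
  CrossesBlackRight u e = Any (λ σ → e ∼ crossed σ × White (leftSquare σ)) u

  crossesBlackLeft? : ∀ u e → Dec (CrossesBlackLeft u e)
  crossesBlackLeft? u e = any? (λ σ → (e ∼? crossed σ) ×-dec black? (leftSquare σ)) u

  crossesBlackRight? : ∀ u e → Dec (CrossesBlackRight u e)
  crossesBlackRight? u e = any? (λ σ → (e ∼? crossed σ) ×-dec ¬? (black? (leftSquare σ))) u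

  -- The exponent of q_k in the weight of the orbit of e, for u = u(k).  At most
  -- one edge of an orbit crosses u(k), so the order of the tests is immaterial.
  exponent : List Step → Edge → ℤ
  exponent u e =
    if does (crossesBlackLeft?  u e) then 1ℤ else
    if does (crossesBlackRight? u e) then -1ℤ else 0ℤ

  edgeSign : Edge → ℤ
  edgeSign (domino horizontal s) = if does (black? s) then -1ℤ else 1ℤ
  edgeSign (domino vertical   s) = 1ℤ

  module _ (B : LatticeBasis L) where
    open LatticeBasis B

    u₀ u₁ : List Step
    u₀ = map (λ i → east (+ i , 0ℤ)) (upTo x₀)
    u₁ = map (λ j → north (0ℤ , + j)) (upTo y₁) ++ map (λ i → east (+ i , + y₁)) (upTo x₁)

    weight : Edge → Laurent
    weight e = monomial (edgeSign e) (exponent u₀ e) (exponent u₁ e) ∷ []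

    InRectangle : Square → Set
    InRectangle (i , j) = (0ℤ ℤ.≤ i × i ℤ.< + x₀) × (0ℤ ℤ.≤ j × j ℤ.< + y₁)

  _≈ₛ_ : Square → Square → Set
  s ≈ₛ s′ = ∃ λ v → v ∈ L × s′ ≡ s ⊕ v

  JoinsTranslates : Square → Square → Edge → Set
  JoinsTranslates s s′ e = (s ≈ₛ first e × s′ ≈ₛ second e) ⊎ (s ≈ₛ second e × s′ ≈ₛ first e)

  -- A list containing exactly one edge from each L-orbit of edges satisfying P.
  record OrbitRepresentatives (P : Edge → Set) : Set where
    field
      edges    : List Edge
      sound    : All P edges
      complete : ∀ e → P e → Any (_∼ e) edges
      distinct : AllPairs (λ e e′ → ¬ (e ∼ e′)) edges

record Enumeration (P : Square → Set) (m : ℕ) : Set where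
  field
    at         : Fin m → Square
    sound      : ∀ k → P (at k)
    complete   : ∀ s → P s → ∃ λ k → at k ≡ s
    injective  : Injective _≡_ _≡_ at

record KasteleynMatrix (L : ValidLattice) : Set where
  field
    basis   : LatticeBasis L
    size    : ℕ
    blacks  : Enumeration (λ s → InRectangle basis s × Black s) size
    whites  : Enumeration (λ s → InRectangle basis s × White s) size

  b : Fin size → Square
  b = Enumeration.at blacks

  w : Fin size → Square
  w = Enumeration.at whites

  field
    orbits : ∀ i j → OrbitRepresentatives {L} (JoinsTranslates {L} (b i) (w j))

  entry : Fin size → Fin size → Laurent
  entry i j = foldr _+_ 0# (map (weight basis) (OrbitRepresentatives.edges (orbits i j)))
    where open RawRing laurentRawRing using (_+_; 0#)

  polynomial : Laurent
  polynomial = det laurentRawRing entry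

{-# OPTIONS --safe #-}

-- Squares are reduced to the fundamental rectangle, with x₀ columns and y₁ rows, and
-- sums are taken modulo 2. In the row-major order, the sign of the permutation attached
-- to a tiling differs by a constant from the parity of the number of crossings of its
-- dominoes, seen as chords between their two cells. Horizontal dominoes contribute
-- nothing: an unwrapped one joins consecutive cells, and a wrapped one spans a row, where
-- it meets evenly many ends of the other dominoes. For two vertical dominoes the crossing
-- is read off their rows and columns. With a₀ and a₁ the parities of the exponents of q₀
-- and q₁, the sign of a tiling comes out as a₀ a₁ + a₁ + c a₀ + ε, where ε and c are
-- independent of the tiling, and the four signed evaluations isolate the number of terms
-- because ½ Σ (-1)^(xy + xα + yβ) = (-1)^(αβ), the sum being over x, y ∈ {0, 1}.
module Submission where

open import Defs
open import Data.Integer.Base using (+_)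
open import Data.Nat.Base using (ℕ)
open import Data.Product using (Σ-syntax; _×_)
open import Data.Rational.Base using (ℚ; ½; 1ℚ; _+_; _*_; -_; _/_)
open import Data.Sum.Base using (_⊎_)
open import Relation.Binary.PropositionalEquality using (_≡_)

open import Algebra.Bundles using (AbelianGroup; CommutativeRing)
open import Algebra.Bundles.Raw using (RawRing)
import Algebra.Definitions.RawSemiring as RawSemiringDefinitions
open import Data.Bool.Base using (Bool; true; false; not; T; if_then_else_)
  renaming (_xor_ to infixl 6 _∔_; _∧_ to infixl 7 _·_)
open import Data.Bool.Properties
  using (xor-∧-commutativeRing; T-≡; xor-identityʳ; ∧-zeroʳ; ∧-identityʳ; ¬-not)
open import Algebra.Properties.Semiring.Sum (CommutativeRing.semiring xor-∧-commutativeRing)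
  using (sum; sum-syntax; sum-cong-≗; sum-replicate-zero; sum-remove; ∑-distrib-+; ∑-comm;
         *-distribˡ-sum; *-distribʳ-sum)
open import Data.Fin.Base using (Fin; zero; suc; toℕ; punchIn; punchOut)
import Data.Fin.Properties as Fin
open import Data.Integer.Base as ℤ using (ℤ; -[1+_]; 0ℤ; 1ℤ; -1ℤ; ∣_∣)
import Data.Integer.Properties as ℤ
import Data.Integer.DivMod as ℤ
open import Algebra.Properties.Group (AbelianGroup.group ℤ.+-0-abelianGroup)
  using (∙-cancelˡ)
open import Data.Integer.Divisibility.Signed using (divides; ∣ᵤ⇒∣)
open import Data.Integer.Tactic.RingSolver using (solve-∀)
open import Data.List.Base
  using (List; []; _∷_; _++_; map; foldr; length; lookup; upTo; cartesianProductWith)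
import Data.List.Properties as List
open import Data.List.Membership.Propositional using (find) renaming (_∈_ to _∈ˡ_)
open import Data.List.Membership.Propositional.Properties
  using (∈-++⁺ˡ; ∈-++⁺ʳ; ∈-++⁻; ∈-cartesianProductWith⁺; ∈-cartesianProductWith⁻; ∈-lookup)
open import Data.List.Relation.Unary.All as All using (All; []; _∷_)
import Data.List.Relation.Unary.All.Properties as All
open import Data.List.Relation.Unary.AllPairs as AllPairs using (AllPairs; []; _∷_)
open import Data.List.Relation.Unary.Any as Any using (Any; here; there; index)
import Data.List.Relation.Unary.Any.Properties as Any
open import Data.List.Relation.Unary.Unique.Propositional using (Unique)
import Data.List.Relation.Unary.Unique.Propositional.Properties as Unique
open import Data.Nat.Base as ℕ using (zero; suc; _<ᵇ_; _≡ᵇ_)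
import Data.Nat.Coprimality as Coprime
import Data.Nat.Divisibility as ℕ
import Data.Nat.Properties as ℕ
open import Data.Product using (Σ; _,_; proj₁; proj₂; ∃)
import Data.Product.Properties as Product
open import Data.Rational.Base as ℚ using (0ℚ; mkℚ)
import Data.Rational.Properties as ℚ
open import Data.Rational.Solver using (module +-*-Solver)
open import Data.Sum.Base using (inj₁; inj₂)
open import Data.Vec.Base as Vec using (Vec; []; _∷_)
import Data.Vec.Functional as Vector
import Data.Vec.Properties as Vec
open import Function.Base using (_∘_; case_of_; id)
open import Function.Bundles using (Equivalence)
open import Relation.Binary.Definitions using (DecidableEquality; tri<; tri≈; tri>)
open import Relation.Binary.PropositionalEquality
  using (_≢_; refl; sym; trans; cong; cong₂; subst; subst₂; ≢-sym; module ≡-Reasoning)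
open import Relation.Nullary using (¬_; Dec; yes; no; does; contradiction; _×-dec_)
open import Relation.Nullary.Decidable
  using (toWitness; fromWitness; map′; decidable-stable; ⌊_⌋)

-- Each tiling receives its sign separately, from the order of the cells; no two tilings are
-- compared, and no moves between tilings enter. The obstacle is that crossings are counted over
-- unordered pairs, where nothing factorises. So the crossing bit of a pair is written, up to a
-- constant, as `g i k ∔ g k i`: modulo 2 its sum over pairs is the full double sum of `g` minus the
-- diagonal, and double sums split into products of single counts. The product a₀ a₁ arises there.
-- Its factor a₀ is the parity `risers`, the same for all rows because a row has evenly many cells;
-- the other factor comes partly from pairs in the top row, rotated by x, and partly from counting
-- the cells that precede a given one, with a correction for wrapped dominoes. The order within each
-- vertical domino is kept as an unevaluated sum, which cancels in the end; this spares a case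
-- distinction for rectangles with one row. The determinant stays an uncollected list with one
-- monomial per tiling, so cancellation plays no part until the signs are known.

BoolFun : ℕ → Set
BoolFun zero    = Bool
BoolFun (suc n) = Bool → BoolFun n

agree : ∀ n → BoolFun n → BoolFun n → Bool
agree zero    a b = not (a ∔ b)
agree (suc n) f g = agree n (f true) (g true) · agree n (f false) (g false)

Agree : ∀ n → BoolFun n → BoolFun n → Set
Agree zero    a b = a ≡ b
Agree (suc n) f g = ∀ x → Agree n (f x) (g x)

T-·ˡ : ∀ a {b} → T (a · b) → T a
T-·ˡ true  _ = _

T-·ʳ : ∀ a {b} → T (a · b) → T b
T-·ʳ true  p = p

-- Decides a propositional tautology by evaluating all 2ⁿ valuations.
tautology : ∀ n (f g : BoolFun n) {_ : T (agree n f g)} → Agree n f g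
tautology zero    true  true        = refl
tautology zero    false false       = refl
tautology (suc n) f g {p} true      = tautology n (f true) (g true) {T-·ˡ _ p}
tautology (suc n) f g {p} false     = tautology n (f false) (g false) {T-·ʳ (agree n (f true) (g true)) p}

-- Sums of bits over unordered pairs.

odd : ℕ → Bool
odd zero    = false
odd (suc n) = not (odd n)

pairSum : ∀ n → (Fin n → Fin n → Bool) → Bool
pairSum zero    g = false
pairSum (suc n) g = ∑[ k < n ] g zero (suc k) ∔ pairSum n (λ i k → g (suc i) (suc k))

-- Equal indices never meet in the sum. The restriction to distinct ones matters because relations
-- such as `θ-flip` fail on the diagonal.
pairSum-cong : ∀ n {g h : Fin n → Fin n → Bool} → (∀ i k → i ≢ k → g i k ≡ h i k) →
               pairSum n g ≡ pairSum n h
pairSum-cong zero    g≗h = refl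
pairSum-cong (suc n) g≗h = cong₂ _∔_ (sum-cong-≗ λ k → g≗h zero (suc k) λ ())
  (pairSum-cong n λ i k i≢k → g≗h (suc i) (suc k) (i≢k ∘ Fin.suc-injective))

pairSum-∔ : ∀ n (g h : Fin n → Fin n → Bool) →
            pairSum n (λ i k → g i k ∔ h i k) ≡ pairSum n g ∔ pairSum n h
pairSum-∔ zero    g h = refl
pairSum-∔ (suc n) g h = trans
  (cong₂ _∔_ (∑-distrib-+ (λ k → g zero (suc k)) (λ k → h zero (suc k))) (pairSum-∔ n (λ i k → g (suc i) (suc k)) (λ i k → h (suc i) (suc k))))
  (tautology 4 (λ a b c d → (a ∔ b) ∔ (c ∔ d)) (λ a b c d → (a ∔ c) ∔ (b ∔ d))
    (∑[ k < n ] g zero (suc k)) (∑[ k < n ] h zero (suc k)) _ _)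

-- The left side meets every ordered pair of distinct indices once, so only the diagonal is missing
-- from the double sum. This is the passage from unordered pairs to double sums, which factorise.
pairSum-symmetrise : ∀ n (g : Fin n → Fin n → Bool) →
  pairSum n (λ i k → g i k ∔ g k i) ≡ ∑[ i < n ] (∑[ k < n ] g i k) ∔ ∑[ i < n ] g i i
pairSum-symmetrise zero    g = refl
pairSum-symmetrise (suc n) g = begin
  ∑[ k < n ] (g zero (suc k) ∔ g (suc k) zero) ∔ pairSum n (λ i k → g (suc i) (suc k) ∔ g (suc k) (suc i))
    ≡⟨ cong₂ _∔_ (∑-distrib-+ (λ k → g zero (suc k)) (λ k → g (suc k) zero))
                 (pairSum-symmetrise n (λ i k → g (suc i) (suc k))) ⟩
  (row ∔ col) ∔ (rest ∔ diag)
    ≡⟨ tautology 5 (λ o r c d e → (r ∔ c) ∔ (d ∔ e)) (λ o r c d e → (o ∔ r ∔ (c ∔ d)) ∔ (o ∔ e)) (g zero zero) row col rest diag ⟩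
  (g zero zero ∔ row ∔ (col ∔ rest)) ∔ (g zero zero ∔ diag)
    ≡⟨ cong (λ t → (g zero zero ∔ row ∔ t) ∔ (g zero zero ∔ diag))
         (∑-distrib-+ (λ i → g (suc i) zero) (λ i → ∑[ k < n ] g (suc i) (suc k))) ⟨
  _ ∎
  where
  open ≡-Reasoning
  row  = ∑[ k < n ] g zero (suc k)
  col  = ∑[ i < n ] g (suc i) zero
  rest = ∑[ i < n ] (∑[ k < n ] g (suc i) (suc k))
  diag = ∑[ i < n ] g (suc i) (suc i)

-- For a symmetric `g` the order of the indices is immaterial, so any index can be split off in
-- place of the first one.
pairSum-remove : ∀ {n} (j : Fin (suc n)) (g : Fin (suc n) → Fin (suc n) → Bool) → (∀ i k → g i k ≡ g k i) →
  pairSum (suc n) g ≡ ∑[ k < n ] g j (punchIn j k) ∔ pairSum n (λ i k → g (punchIn j i) (punchIn j k))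
pairSum-remove zero            g g-sym = refl
pairSum-remove {suc n} (suc j) g g-sym = begin
  ∑[ k < suc n ] g zero (suc k) ∔ pairSum (suc n) (λ i k → g (suc i) (suc k))
    ≡⟨ cong₂ _∔_ (sum-remove {i = j} (λ k → g zero (suc k)))
                 (pairSum-remove j (λ i k → g (suc i) (suc k)) (λ i k → g-sym (suc i) (suc k))) ⟩
  (g zero (suc j) ∔ row) ∔ (row′ ∔ rest)
    ≡⟨ cong (λ t → (t ∔ row) ∔ (row′ ∔ rest)) (g-sym zero (suc j)) ⟩
  (g (suc j) zero ∔ row) ∔ (row′ ∔ rest)
    ≡⟨ tautology 4 (λ o r r′ s → (o ∔ r) ∔ (r′ ∔ s)) (λ o r r′ s → (o ∔ r′) ∔ (r ∔ s)) (g (suc j) zero) row row′ rest ⟩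
  (g (suc j) zero ∔ row′) ∔ (row ∔ rest) ∎
  where
  open ≡-Reasoning
  row  = ∑[ k < n ] g zero (suc (punchIn j k))
  row′ = ∑[ k < n ] g (suc j) (suc (punchIn j k))
  rest = pairSum n (λ i k → g (suc (punchIn j i)) (suc (punchIn j k)))

-- Permutations and their inversions.

-- A permutation given by its Lehmer code, which is how the Laplace expansion
-- along first rows enumerates permutations.
data Lehmer : ℕ → Set where
  []  : Lehmer zero
  _∷_ : ∀ {n} → Fin (suc n) → Lehmer n → Lehmer (suc n)

act : ∀ {n} → Lehmer n → Fin n → Fin n
act (j ∷ π) zero    = j
act (j ∷ π) (suc k) = punchIn j (act π k)

codeParity : ∀ {n} → Lehmer n → Bool
codeParity []      = false
codeParity (j ∷ π) = odd (toℕ j) ∔ codeParity π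

act-injective : ∀ {n} (π : Lehmer n) {i k} → act π i ≡ act π k → i ≡ k
act-injective (j ∷ π) {zero}  {zero}  _  = refl
act-injective (j ∷ π) {zero}  {suc k} eq = contradiction (sym eq) (Fin.punchInᵢ≢i j _)
act-injective (j ∷ π) {suc i} {zero}  eq = contradiction eq (Fin.punchInᵢ≢i j _)
act-injective (j ∷ π) {suc i} {suc k} eq = cong suc (act-injective π (Fin.punchIn-injective j _ _ eq))

act-faithful : ∀ {n} (π ρ : Lehmer n) → (∀ i → act π i ≡ act ρ i) → π ≡ ρ
act-faithful []      []      _ = refl
act-faithful (j ∷ π) (l ∷ ρ) π≗ρ with refl ← π≗ρ zero =
  cong (j ∷_) (act-faithful π ρ λ i → Fin.punchIn-injective j _ _ (π≗ρ (suc i)))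

encode : ∀ {n} (f : Fin n → Fin n) → (∀ {i k} → f i ≡ f k → i ≡ k) → ∃ λ π → ∀ i → act π i ≡ f i
encode {zero}  f inj = [] , λ ()
encode {suc n} f inj = (f zero ∷ proj₁ rec) , λ where
    zero    → refl
    (suc i) → trans (cong (punchIn (f zero)) (proj₂ rec i)) (Fin.punchIn-punchOut (f0≢ i))
  where
  f0≢ : ∀ i → f zero ≢ f (suc i)
  f0≢ i eq with () ← inj eq
  rec = encode (λ i → punchOut (f0≢ i))
    λ eq → Fin.suc-injective (inj (Fin.punchOut-injective (f0≢ _) (f0≢ _) eq))

act-surjective : ∀ {n} (π : Lehmer n) j → ∃ λ i → act π i ≡ j
act-surjective (l ∷ π) j with l Fin.≟ j
... | yes l≡j = zero , l≡j
... | no  l≢j = suc (proj₁ rec) , trans (cong (punchIn l) (proj₂ rec)) (Fin.punchIn-punchOut l≢j)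
  where rec = act-surjective π (punchOut l≢j)

∑-act : ∀ {n} (π : Lehmer n) (g : Fin n → Bool) → ∑[ i < n ] g (act π i) ≡ ∑[ i < n ] g i
∑-act []      g = refl
∑-act (j ∷ π) g = trans (cong (g j ∔_) (∑-act π (g ∘ punchIn j))) (sym (sum-remove {i = j} g))

pairSum-act : ∀ {n} (π : Lehmer n) (g : Fin n → Fin n → Bool) → (∀ i k → g i k ≡ g k i) →
              pairSum n (λ i k → g (act π i) (act π k)) ≡ pairSum n g
pairSum-act []      g g-sym = refl
pairSum-act (j ∷ π) g g-sym = trans
  (cong₂ _∔_ (∑-act π (λ k → g j (punchIn j k))) (pairSum-act π _ (λ i k → g-sym (punchIn j i) (punchIn j k))))
  (sym (pairSum-remove j g g-sym))

infix 4 _<?₂_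
_<?₂_ : ∀ {n} → Fin n → Fin n → Bool
i <?₂ k = toℕ i <ᵇ toℕ k

punchIn-<?₂ : ∀ {n} (j : Fin (suc n)) (i k : Fin n) → (punchIn j i <?₂ punchIn j k) ≡ (i <?₂ k)
punchIn-<?₂ zero    i       k       = refl
punchIn-<?₂ (suc j) zero    zero    = refl
punchIn-<?₂ (suc j) zero    (suc k) = refl
punchIn-<?₂ (suc j) (suc i) zero    = refl
punchIn-<?₂ (suc j) (suc i) (suc k) = punchIn-<?₂ j i k

∑-punchIn-< : ∀ {n} (j : Fin (suc n)) → ∑[ k < n ] (punchIn j k <?₂ j) ≡ odd (toℕ j)
∑-punchIn-< {n}     zero    = sum-replicate-zero n
∑-punchIn-< {suc n} (suc j) = cong not (∑-punchIn-< j)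

-- The first value j is followed by exactly j smaller values, and `punchIn j` keeps the order of the
-- others, so each entry of the code counts the inversions of its position.
codeParity-inversions : ∀ {n} (π : Lehmer n) → codeParity π ≡ pairSum n (λ i k → act π k <?₂ act π i)
codeParity-inversions []      = refl
codeParity-inversions (j ∷ π) = cong₂ _∔_
  (trans (sym (∑-punchIn-< j)) (sym (∑-act π (λ k → punchIn j k <?₂ j))))
  (trans (codeParity-inversions π) (pairSum-cong _ λ i k _ → sym (punchIn-<?₂ j (act π k) (act π i))))

-- Comparisons as bits, and counting modulo 2.

T⇒true : ∀ {b} → T b → b ≡ true
T⇒true = Equivalence.to T-≡

<ᵇ-true : ∀ {a b} → a ℕ.< b → (a <ᵇ b) ≡ true
<ᵇ-true a<b = T⇒true (ℕ.<⇒<ᵇ a<b)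

<ᵇ-false : ∀ {a b} → b ℕ.≤ a → (a <ᵇ b) ≡ false
<ᵇ-false {a} {b} b≤a = ¬-not λ eq → ℕ.≤⇒≯ b≤a (ℕ.<ᵇ⇒< a b (Equivalence.from T-≡ eq))

≡ᵇ-refl : ∀ a → (a ≡ᵇ a) ≡ true
≡ᵇ-refl a = T⇒true (ℕ.≡⇒≡ᵇ a a refl)

≡ᵇ-true : ∀ {a b} → a ≡ b → (a ≡ᵇ b) ≡ true
≡ᵇ-true {a} refl = ≡ᵇ-refl a

≡ᵇ-false : ∀ {a b} → a ≢ b → (a ≡ᵇ b) ≡ false
≡ᵇ-false {a} {b} a≢b = ¬-not λ eq → a≢b (ℕ.≡ᵇ⇒≡ a b (Equivalence.from T-≡ eq))

odd-+ : ∀ a b → odd (a ℕ.+ b) ≡ odd a ∔ odd b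
odd-+ zero    b = refl
odd-+ (suc a) b = trans (cong not (odd-+ a b)) (tautology 2 (λ p q → not (p ∔ q)) (λ p q → not p ∔ q) (odd a) (odd b))

∑-const : ∀ n b → ∑[ i < n ] b ≡ odd n · b
∑-const zero    b = refl
∑-const (suc n) b = trans (cong (b ∔_) (∑-const n b)) (tautology 2 (λ b o → b ∔ o · b) (λ b o → not o · b) b (odd n))

∑-<ᵇ : ∀ n a → a ℕ.≤ n → ∑[ k < n ] (toℕ k <ᵇ a) ≡ odd a
∑-<ᵇ n       zero    _           = sum-replicate-zero n
∑-<ᵇ (suc n) (suc a) (ℕ.s≤s a≤n) = cong not (∑-<ᵇ n a a≤n)

∑-≡ᵇ : ∀ {n a} (g : ℕ → Bool) → a ℕ.< n → ∑[ k < n ] ((a ≡ᵇ toℕ k) · g (toℕ k)) ≡ g a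
∑-≡ᵇ {suc n} {zero}  g _           = trans (cong (g zero ∔_) (sum-replicate-zero n)) (xor-identityʳ _)
∑-≡ᵇ {suc n} {suc a} g (ℕ.s≤s a<n) = ∑-≡ᵇ (g ∘ suc) a<n

∑-factorˡ : ∀ {n} b (g : Fin n → Bool) → ∑[ i < n ] (b · g i) ≡ b · (∑[ i < n ] g i)
∑-factorˡ b g = sym (*-distribˡ-sum b g)

∑-product : ∀ {m n} (f : Fin m → Bool) (g : Fin n → Bool) →
  ∑[ i < m ] (∑[ k < n ] (f i · g k)) ≡ (∑[ i < m ] f i) · (∑[ k < n ] g k)
∑-product f g = trans (sum-cong-≗ λ i → ∑-factorˡ (f i) g) (sym (*-distribʳ-sum (sum g) f))

-- The row-major order and how it changes along a domino.

Cell : Set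
Cell = ℕ × ℕ

column row : Cell → ℕ
column = proj₁
row    = proj₂

-- The strict row-major order as a bit. The two summands exclude each other, so the exclusive or
-- acts as a disjunction.
θ : Cell → Cell → Bool
θ (c , r) (c′ , r′) = (r <ᵇ r′) ∔ (r ≡ᵇ r′) · (c <ᵇ c′)

θ-row< : ∀ {p q} → row p ℕ.< row q → θ p q ≡ true
θ-row< lt rewrite <ᵇ-true lt | ≡ᵇ-false (ℕ.<⇒≢ lt) = refl

θ-row> : ∀ {p q} → row q ℕ.< row p → θ p q ≡ false
θ-row> gt rewrite <ᵇ-false (ℕ.<⇒≤ gt) | ≡ᵇ-false (ℕ.>⇒≢ gt) = refl

θ-row≡ : ∀ {c c′ r} → θ (c , r) (c′ , r) ≡ (c <ᵇ c′)
θ-row≡ {r = r} rewrite <ᵇ-false (ℕ.≤-refl {r}) | ≡ᵇ-refl r = refl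

θ-irrefl : ∀ p → θ p p ≡ false
θ-irrefl (c , r) = trans (θ-row≡ {c} {c} {r}) (<ᵇ-false (ℕ.≤-refl {c}))

<ᵇ-flip : ∀ {a b} → a ≢ b → (a <ᵇ b) ≡ not (b <ᵇ a)
<ᵇ-flip {a} {b} a≢b with ℕ.<-cmp a b
... | tri< a<b _ _ = trans (<ᵇ-true a<b) (sym (cong not (<ᵇ-false (ℕ.<⇒≤ a<b))))
... | tri≈ _ a≡b _ = contradiction a≡b a≢b
... | tri> _ _ b<a = trans (<ᵇ-false (ℕ.<⇒≤ b<a)) (sym (cong not (<ᵇ-true b<a)))

θ-flip : ∀ {p q} → p ≢ q → θ p q ≡ not (θ q p)
θ-flip {c , r} {c′ , r′} p≢q with ℕ.<-cmp r r′
... | tri< lt _ _ = trans (θ-row< {c , r} {c′ , r′} lt) (sym (cong not (θ-row> {c′ , r′} {c , r} lt)))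
... | tri> _ _ gt = trans (θ-row> {c , r} {c′ , r′} gt) (sym (cong not (θ-row< {c′ , r′} {c , r} gt)))
... | tri≈ _ refl _ = trans (θ-row≡ {c} {c′} {r})
  (trans (<ᵇ-flip {c} {c′} λ { refl → p≢q refl }) (sym (cong not (θ-row≡ {c′} {c} {r}))))

-- The cells of the fundamental rectangle, with W columns and R = suc R′ rows;
-- its top side is glued to its bottom side with a shift by x.
module Torus (W R′ x : ℕ) where

  R : ℕ
  R = suc R′

  InRect : Cell → Set
  InRect (c , r) = c ℕ.< W × r ℕ.< R

  -- Stepping up from the top row subtracts (x , R), and `top-left` adds W where the column would
  -- become negative. The equations are additive to avoid truncated subtraction.
  data Next : Bool → Cell → Cell → Set where
    right     : ∀ {c r} → suc c ℕ.< W → Next false (c , r) (suc c , r)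
    wrap      : ∀ {c r} → suc c ≡ W → Next false (c , r) (0 , r)
    up        : ∀ {c r} → suc r ℕ.< R → Next true (c , r) (c , suc r)
    top-left  : ∀ {c r c′} → suc r ≡ R → c ℕ.< x → c′ ℕ.+ x ≡ c ℕ.+ W → Next true (c , r) (c′ , 0)
    top-right : ∀ {c r c′} → suc r ≡ R → x ℕ.≤ c → c′ ℕ.+ x ≡ c → Next true (c , r) (c′ , 0)

  isTop isWrap isLeft : Cell → Bool
  isTop  (c , r) = suc r ≡ᵇ R
  isWrap (c , r) = suc c ≡ᵇ W
  isLeft (c , r) = c <ᵇ x

  next-row : ∀ {p q} → Next false p q → row q ≡ row p
  next-row (right _) = refl
  next-row (wrap _)  = refl

  -- Unwrapped, p and q are consecutive, so no third cell separates them. Wrapped, q is the first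
  -- and p the last cell of the row, so exactly the cells of that row other than q come after q but
  -- not after p. The case z = q is excluded because θ is strict.
  next-θ-horizontal : ∀ {p q} z → 0 ℕ.< W → column z ℕ.< W → q ≢ z → Next false p q →
    θ p z ∔ θ q z ≡ isWrap p · (row z ≡ᵇ row p)
  next-θ-horizontal {c , r} (c′ , r′) _ c′<W q≢z (right 1+c<W)
    rewrite ≡ᵇ-false (ℕ.<⇒≢ 1+c<W) with ℕ.<-cmp r r′
  ... | tri< lt _ _ rewrite θ-row< {c , r} {c′ , r′} lt | θ-row< {suc c , r} {c′ , r′} lt = refl
  ... | tri> _ _ gt rewrite θ-row> {c , r} {c′ , r′} gt | θ-row> {suc c , r} {c′ , r′} gt = refl
  ... | tri≈ _ refl _ rewrite θ-row≡ {c} {c′} {r} | θ-row≡ {suc c} {c′} {r} with ℕ.<-cmp (suc c) c′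
  ...   | tri< lt _ _ rewrite <ᵇ-true lt | <ᵇ-true (ℕ.<-trans (ℕ.n<1+n c) lt) = refl
  ...   | tri≈ _ refl _ = contradiction refl q≢z
  ...   | tri> _ _ gt rewrite <ᵇ-false (ℕ.<⇒≤ gt) | <ᵇ-false (ℕ.≤-pred gt) = refl
  next-θ-horizontal {c , r} (c′ , r′) 0<W c′<W q≢z (wrap refl)
    rewrite ≡ᵇ-refl (suc c) with ℕ.<-cmp r r′
  ... | tri< lt _ _ rewrite θ-row< {c , r} {c′ , r′} lt | θ-row< {0 , r} {c′ , r′} lt | ≡ᵇ-false (ℕ.>⇒≢ lt) = refl
  ... | tri> _ _ gt rewrite θ-row> {c , r} {c′ , r′} gt | θ-row> {0 , r} {c′ , r′} gt | ≡ᵇ-false (ℕ.<⇒≢ gt) = refl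
  ... | tri≈ _ refl _ rewrite θ-row≡ {c} {c′} {r} | θ-row≡ {0} {c′} {r} | ≡ᵇ-refl r
        | <ᵇ-false (ℕ.≤-pred c′<W) with c′
  ...   | zero  = contradiction refl q≢z
  ...   | suc _ = refl

  next-θ-self : ∀ {p q} → Next false p q → not (θ p q) ≡ isWrap p
  next-θ-self {c , r} (right lt) rewrite θ-row≡ {c} {suc c} {r} | <ᵇ-true (ℕ.n<1+n c) | ≡ᵇ-false (ℕ.<⇒≢ lt) = refl
  next-θ-self {c , r} (wrap eq)  rewrite θ-row≡ {c} {0} {r} | ≡ᵇ-true eq = refl

  leftTop : Cell → Bool
  leftTop p = isTop p · isLeft p

  -- Going up preserves the order of two cells, except that the top row moves below
  -- all others and is then rotated by x.
  next-θ-vertical : ∀ {p q p′ q′} → InRect p → InRect p′ → p ≢ p′ → Next true p q → Next true p′ q′ →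
    θ p p′ ∔ θ q q′ ≡ (isTop p ∔ leftTop p · isTop p′) ∔ (isTop p′ ∔ leftTop p′ · isTop p)
  next-θ-vertical {c , r} {_} {c′ , r′} _ _ _ (up lt) (up lt′)
    rewrite ≡ᵇ-false (ℕ.<⇒≢ lt) | ≡ᵇ-false (ℕ.<⇒≢ lt′) =
    tautology 1 (λ a → a ∔ a) (λ _ → false) (θ (c , r) (c′ , r′))
  next-θ-vertical {c , r} {_} {c′ , r′} {c″ , _} _ _ _ (up lt) (top-left refl a b)
    rewrite ≡ᵇ-false (ℕ.<⇒≢ lt) | ≡ᵇ-refl r′ | <ᵇ-true a | <ᵇ-true (ℕ.≤-pred lt) = refl
  next-θ-vertical {c , r} {_} {c′ , r′} _ _ _ (up lt) (top-right refl a b)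
    rewrite ≡ᵇ-false (ℕ.<⇒≢ lt) | ≡ᵇ-refl r′ | <ᵇ-false a | <ᵇ-true (ℕ.≤-pred lt) = refl
  next-θ-vertical {c , r} {_} {c′ , r′} _ _ _ (top-left refl a b) (up lt)
    rewrite ≡ᵇ-false (ℕ.<⇒≢ lt) | ≡ᵇ-refl r | <ᵇ-true a | <ᵇ-false (ℕ.<⇒≤ (ℕ.≤-pred lt))
          | ≡ᵇ-false (ℕ.>⇒≢ (ℕ.≤-pred lt)) = refl
  next-θ-vertical {c , r} {_} {c′ , r′} _ _ _ (top-right refl a b) (up lt)
    rewrite ≡ᵇ-false (ℕ.<⇒≢ lt) | ≡ᵇ-refl r | <ᵇ-false a | <ᵇ-false (ℕ.<⇒≤ (ℕ.≤-pred lt))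
          | ≡ᵇ-false (ℕ.>⇒≢ (ℕ.≤-pred lt)) = refl
  next-θ-vertical {c , r} {d , _} {c′ , r} {d′ , _} _ _ p≢p′ (top-left refl a b) (top-left refl a′ b′)
    rewrite ≡ᵇ-refl r | <ᵇ-true a | <ᵇ-true a′ | <ᵇ-false (ℕ.≤-refl {r}) with ℕ.<-cmp c c′
  ... | tri< lt _ _ rewrite <ᵇ-true lt | <ᵇ-true (ℕ.+-cancelʳ-< x d d′ (subst₂ ℕ._<_ (sym b) (sym b′) (ℕ.+-monoˡ-< W lt))) = refl
  ... | tri≈ _ refl _ = contradiction refl p≢p′
  ... | tri> _ _ gt rewrite <ᵇ-false (ℕ.<⇒≤ gt)
        | <ᵇ-false (ℕ.<⇒≤ (ℕ.+-cancelʳ-< x d′ d (subst₂ ℕ._<_ (sym b′) (sym b) (ℕ.+-monoˡ-< W gt)))) = refl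
  next-θ-vertical {c , r} {d , _} {c′ , r} {d′ , _} _ (c′<W , _) _ (top-left refl a b) (top-right refl a′ b′)
    rewrite ≡ᵇ-refl r | <ᵇ-true a | <ᵇ-false a′ | <ᵇ-false (ℕ.≤-refl {r}) | <ᵇ-true (ℕ.<-≤-trans a a′)
          | <ᵇ-false {d} {d′} (ℕ.<⇒≤ (ℕ.+-cancelʳ-< x d′ d
              (subst₂ ℕ._<_ (sym b′) (sym b) (ℕ.<-≤-trans c′<W (ℕ.m≤n+m W c))))) = refl
  next-θ-vertical {c , r} {d , _} {c′ , r} {d′ , _} (c<W , _) _ _ (top-right refl a b) (top-left refl a′ b′)
    rewrite ≡ᵇ-refl r | <ᵇ-false a | <ᵇ-true a′ | <ᵇ-false (ℕ.≤-refl {r}) | <ᵇ-false (ℕ.<⇒≤ (ℕ.<-≤-trans a′ a))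
          | <ᵇ-true {d} {d′} (ℕ.+-cancelʳ-< x d d′
              (subst₂ ℕ._<_ (sym b) (sym b′) (ℕ.<-≤-trans c<W (ℕ.m≤n+m W c′)))) = refl
  next-θ-vertical {c , r} {d , _} {c′ , r} {d′ , _} _ _ p≢p′ (top-right refl a b) (top-right refl a′ b′)
    rewrite ≡ᵇ-refl r | <ᵇ-false a | <ᵇ-false a′ | <ᵇ-false (ℕ.≤-refl {r}) with ℕ.<-cmp c c′
  ... | tri< lt _ _ rewrite <ᵇ-true lt | <ᵇ-true {d} {d′} (ℕ.+-cancelʳ-< x d d′ (subst₂ ℕ._<_ (sym b) (sym b′) lt)) = refl
  ... | tri≈ _ refl _ = contradiction refl p≢p′
  ... | tri> _ _ gt rewrite <ᵇ-false (ℕ.<⇒≤ gt)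
        | <ᵇ-false {d} {d′} (ℕ.<⇒≤ (ℕ.+-cancelʳ-< x d′ d (subst₂ ℕ._<_ (sym b′) (sym b) gt))) = refl

  -- At the top the column drops by x or grows by W - x, and W is even.
  next-column : ∀ {p q} → odd W ≡ false → Next true p q → odd (column q) ≡ odd (column p) ∔ isTop p · odd x
  next-column {p} _ (up lt) rewrite ≡ᵇ-false (ℕ.<⇒≢ lt) = sym (xor-identityʳ _)
  next-column {c , r} {d , _} W-even (top-left refl _ eq) rewrite ≡ᵇ-refl r =
    tautology′ (odd d) (odd x) (odd c) (trans (sym (odd-+ d x)) (trans (cong odd eq)
      (trans (odd-+ c W) (trans (cong (odd c ∔_) W-even) (xor-identityʳ _)))))
    where
    tautology′ : ∀ a b c → a ∔ b ≡ c → a ≡ c ∔ b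
    tautology′ a b _ refl = tautology 2 (λ a b → a) (λ a b → (a ∔ b) ∔ b) a b
  next-column {c , r} {d , _} _ (top-right refl _ refl) rewrite ≡ᵇ-refl r | odd-+ d x =
    tautology 2 (λ a b → a) (λ a b → (a ∔ b) ∔ b) (odd d) (odd x)

  -- The constant c of the sign: one, plus the number of rows of even index, plus x, modulo 2. It is
  -- what remains as the coefficient of `risers` once the column parities at the two ends of upright
  -- dominoes have cancelled.
  slope : Bool
  slope = not ((∑[ r < R ] not (odd (toℕ r))) ∔ odd x)

  -- The parity of the number of crossings in a cover by dominoes.

  -- The squares are paired into m dominoes, each consisting of a first and a second square,
  -- the one on the left or below in the plane.
  module Dominoes
    (W-even : odd W ≡ false) (0<W : 0 ℕ.< W)
    {m} (isUpright : Fin m → Bool) (first second : Fin m → Cell)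
    (next        : ∀ i → Next (isUpright i) (first i) (second i))
    (first-rect  : ∀ i → InRect (first i))
    (second-rect : ∀ i → InRect (second i))
    (first≢first   : ∀ {i k} → i ≢ k → first i ≢ first k)
    (second≢second : ∀ {i k} → i ≢ k → second i ≢ second k)
    (first≢second  : ∀ {i k} → i ≢ k → first i ≢ second k)
    (cover : ∀ (g : Cell → Bool) →
      ∑[ i < m ] (g (first i) ∔ g (second i)) ≡ ∑[ c < W ] (∑[ r < R ] g (toℕ c , toℕ r)))
    where

    open ≡-Reasoning

    isFlat : Fin m → Bool
    isFlat i = not (isUpright i)

    -- Counts the pairs of an end of i and a later end of k. Interlaced chords give 1 or 3 such
    -- pairs, all others 0, 2 or 4, so the bit tells whether the chords cross.
    crossing : Fin m → Fin m → Bool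
    crossing i k = (θ (first i) (first k) ∔ θ (second i) (second k))
                 ∔ (θ (first i) (second k) ∔ θ (second i) (first k))

    -- The parity of the number of vertical dominoes between two adjacent rows.
    risers : Bool
    risers = ∑[ i < m ] (isUpright i · isTop (first i))

    verticalFrom verticalTo : ℕ → Bool
    verticalFrom r = ∑[ i < m ] (isUpright i · (row (first i) ≡ᵇ r))
    verticalTo   r = ∑[ i < m ] (isUpright i · (row (second i) ≡ᵇ r))

    row-even : ∀ r → ∑[ i < m ] ((row (first i) ≡ᵇ r) ∔ (row (second i) ≡ᵇ r)) ≡ false
    row-even r = begin
      _                                                     ≡⟨ cover (λ p → row p ≡ᵇ r) ⟩
      ∑[ c < W ] (∑[ r′ < R ] (toℕ r′ ≡ᵇ r))                 ≡⟨ ∑-const W _ ⟩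
      odd W · (∑[ r′ < R ] (toℕ r′ ≡ᵇ r))                    ≡⟨ cong (_· (∑[ r′ < R ] (toℕ r′ ≡ᵇ r))) W-even ⟩
      false                                                 ∎

    -- A flat domino takes two cells of a single row, so the evenly many cells of row r leave evenly
    -- many ends of upright dominoes.
    verticalTo≡From : ∀ r → verticalTo r ≡ verticalFrom r
    verticalTo≡From r = from-sum (verticalTo r) (verticalFrom r) (begin
      verticalTo r ∔ verticalFrom r
        ≡⟨ ∑-distrib-+ (λ i → isUpright i · (row (second i) ≡ᵇ r)) (λ i → isUpright i · (row (first i) ≡ᵇ r)) ⟨
      ∑[ i < m ] (isUpright i · (row (second i) ≡ᵇ r) ∔ isUpright i · (row (first i) ≡ᵇ r))
        ≡⟨ sum-cong-≗ pointwise ⟩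
      ∑[ i < m ] ((row (first i) ≡ᵇ r) ∔ (row (second i) ≡ᵇ r))
        ≡⟨ row-even r ⟩
      false ∎)
      where
      from-sum : ∀ a b → a ∔ b ≡ false → a ≡ b
      from-sum true  true  _ = refl
      from-sum false false _ = refl
      pointwise : ∀ i → isUpright i · (row (second i) ≡ᵇ r) ∔ isUpright i · (row (first i) ≡ᵇ r)
                      ≡ (row (first i) ≡ᵇ r) ∔ (row (second i) ≡ᵇ r)
      pointwise i with isUpright i | next i
      ... | true  | _  = tautology 2 (λ a b → a ∔ b) (λ a b → b ∔ a) (row (second i) ≡ᵇ r) (row (first i) ≡ᵇ r)
      ... | false | nx rewrite next-row nx = sym (tautology 1 (λ a → a ∔ a) (λ _ → false) (row (first i) ≡ᵇ r))

    verticalTo-suc : ∀ r → suc r ℕ.< R → verticalTo (suc r) ≡ verticalFrom r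
    verticalTo-suc r 1+r<R = sum-cong-≗ pointwise
      where
      pointwise : ∀ i → isUpright i · (row (second i) ≡ᵇ suc r) ≡ isUpright i · (row (first i) ≡ᵇ r)
      pointwise i with isUpright i | first i | second i | next i
      ... | false | _ | _ | _    = refl
      ... | true  | _ | _ | up _ = refl
      ... | true  | _ | _ | top-left  refl _ _ = sym (≡ᵇ-false (ℕ.>⇒≢ (ℕ.≤-pred 1+r<R)))
      ... | true  | _ | _ | top-right refl _ _ = sym (≡ᵇ-false (ℕ.>⇒≢ (ℕ.≤-pred 1+r<R)))

    verticalFrom≡0 : ∀ r → r ℕ.< R → verticalFrom r ≡ verticalFrom 0
    verticalFrom≡0 zero    _     = refl
    verticalFrom≡0 (suc r) 1+r<R = trans (trans (sym (verticalTo≡From (suc r))) (verticalTo-suc r 1+r<R))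
      (verticalFrom≡0 r (ℕ.<-trans (ℕ.n<1+n r) 1+r<R))

    -- What leaves row r arrives in row r + 1, and arrivals and departures of a row agree modulo 2,
    -- so the parity is carried unchanged through all rows up to the top.
    verticalFrom≡risers : ∀ {r} → r ℕ.< R → verticalFrom r ≡ risers
    verticalFrom≡risers r<R = trans (verticalFrom≡0 _ r<R) (sym (verticalFrom≡0 R′ (ℕ.n<1+n R′)))

    verticalTo≡risers : ∀ {r} → r ℕ.< R → verticalTo r ≡ risers
    verticalTo≡risers r<R = trans (verticalTo≡From _) (verticalFrom≡risers r<R)

    ∑-vertical-row : ∀ (g : ℕ → Bool) →
      ∑[ i < m ] (isUpright i · g (row (first i))) ≡ risers · (∑[ r < R ] g (toℕ r))
    ∑-vertical-row g = begin
      ∑[ i < m ] (isUpright i · g (row (first i)))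
        ≡⟨ sum-cong-≗ (λ i → cong (isUpright i ·_) (sym (∑-≡ᵇ g (proj₂ (first-rect i))))) ⟩
      ∑[ i < m ] (isUpright i · (∑[ r < R ] ((row (first i) ≡ᵇ toℕ r) · g (toℕ r))))
        ≡⟨ sum-cong-≗ (λ i → sym (∑-factorˡ {R} (isUpright i) (λ r → (row (first i) ≡ᵇ toℕ r) · g (toℕ r)))) ⟩
      ∑[ i < m ] (∑[ r < R ] (isUpright i · ((row (first i) ≡ᵇ toℕ r) · g (toℕ r))))
        ≡⟨ ∑-comm {m} {R} (λ i r → isUpright i · ((row (first i) ≡ᵇ toℕ r) · g (toℕ r))) ⟩
      ∑[ r < R ] (∑[ i < m ] (isUpright i · ((row (first i) ≡ᵇ toℕ r) · g (toℕ r))))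
        ≡⟨ sum-cong-≗ {R} (λ r → trans
             (sum-cong-≗ λ i → tautology 3 (λ a b c → a · (b · c)) (λ a b c → (a · b) · c)
                (isUpright i) (row (first i) ≡ᵇ toℕ r) (g (toℕ r)))
             (sym (*-distribʳ-sum (g (toℕ r)) (λ i → isUpright i · (row (first i) ≡ᵇ toℕ r))))) ⟩
      ∑[ r < R ] (verticalFrom (toℕ r) · g (toℕ r))
        ≡⟨ sum-cong-≗ {R} (λ r → cong (_· g (toℕ r)) (verticalFrom≡risers (Fin.toℕ<n r))) ⟩
      ∑[ r < R ] (risers · g (toℕ r))
        ≡⟨ ∑-factorˡ {R} risers (λ r → g (toℕ r)) ⟩
      risers · (∑[ r < R ] g (toℕ r)) ∎

    horizontal-θ : ∀ {i} → isUpright i ≡ false → ∀ z → column z ℕ.< W → second i ≢ z →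
      θ (first i) z ∔ θ (second i) z ≡ isWrap (first i) · (row z ≡ᵇ row (first i))
    horizontal-θ {i} eq z z<W s≢z = next-θ-horizontal z 0<W z<W s≢z (subst (λ b → Next b _ _) eq (next i))

    -- A wrapped domino joins the two extremes of its row, so its chord separates the ends of k
    -- inside that row from those outside.
    wrapCrossing : Fin m → Fin m → Bool
    wrapCrossing i k = isWrap (first i) · ((row (first k) ≡ᵇ row (first i)) ∔ (row (second k) ≡ᵇ row (first i)))

    crossing-horizontal : ∀ {i k} → i ≢ k → isUpright i ≡ false → crossing i k ≡ wrapCrossing i k
    crossing-horizontal {i} {k} i≢k h = begin
      crossing i k
        ≡⟨ tautology 4 (λ a b c d → (a ∔ b) ∔ (c ∔ d)) (λ a b c d → (a ∔ d) ∔ (c ∔ b))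
             (θ (first i) (first k)) (θ (second i) (second k)) (θ (first i) (second k)) (θ (second i) (first k)) ⟩
      (θ (first i) (first k) ∔ θ (second i) (first k)) ∔ (θ (first i) (second k) ∔ θ (second i) (second k))
        ≡⟨ cong₂ _∔_ (horizontal-θ h (first k) (proj₁ (first-rect k)) (≢-sym (first≢second (≢-sym i≢k))))
                     (horizontal-θ h (second k) (proj₁ (second-rect k)) (second≢second i≢k)) ⟩
      isWrap (first i) · (row (first k) ≡ᵇ row (first i)) ∔ isWrap (first i) · (row (second k) ≡ᵇ row (first i))
        ≡⟨ tautology 3 (λ a b c → a · b ∔ a · c) (λ a b c → a · (b ∔ c)) (isWrap (first i))
             (row (first k) ≡ᵇ row (first i)) (row (second k) ≡ᵇ row (first i)) ⟩
      wrapCrossing i k ∎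

    wrapCrossing-horizontal : ∀ {i k} → isUpright k ≡ false → wrapCrossing i k ≡ false
    wrapCrossing-horizontal {i} {k} eq
      rewrite next-row (subst (λ b → Next b (first k) (second k)) eq (next k)) =
      tautology 2 (λ a b → a · (b ∔ b)) (λ _ _ → false) (isWrap (first i)) (row (first k) ≡ᵇ row (first i))

    crossing-sym : ∀ {i k} → i ≢ k → crossing i k ≡ crossing k i
    crossing-sym {i} {k} i≢k
      rewrite θ-flip (first≢first i≢k) | θ-flip (second≢second i≢k)
            | θ-flip (first≢second i≢k) | θ-flip (≢-sym (first≢second (≢-sym i≢k))) =
      tautology 4 (λ a b c d → (not a ∔ not b) ∔ (not c ∔ not d)) (λ a b c d → (a ∔ b) ∔ (d ∔ c))
        (θ (first k) (first i)) (θ (second k) (second i)) (θ (second k) (first i)) (θ (first k) (second i))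

    -- Asymmetric on purpose: the flat index comes first, so that pairs of unlike orientation take
    -- the form g i k + g k i required by `pairSum-symmetrise`.
    mixed : Fin m → Fin m → Bool
    mixed i k = (isFlat i · isUpright k) · wrapCrossing i k

    crossing-split : ∀ i k → i ≢ k →
      crossing i k ≡ (isUpright i · isUpright k) · crossing i k ∔ (mixed i k ∔ mixed k i)
    crossing-split i k i≢k with isUpright i in eqᵢ | isUpright k in eqₖ
    ... | true  | true  = sym (xor-identityʳ _)
    ... | true  | false = trans (crossing-sym i≢k) (crossing-horizontal (≢-sym i≢k) eqₖ)
    ... | false | true  = trans (crossing-horizontal i≢k eqᵢ) (sym (xor-identityʳ _))
    ... | false | false = trans (crossing-horizontal i≢k eqᵢ) (wrapCrossing-horizontal {i} eqₖ)

    -- In the row of a fixed flat domino, upright dominoes start and arrive equally often modulo 2.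
    -- The diagonal vanishes because no domino is both flat and upright.
    mixed-vanishes : pairSum m (λ i k → mixed i k ∔ mixed k i) ≡ false
    mixed-vanishes = trans (pairSum-symmetrise m mixed) (cong₂ _∔_
      (trans (sum-cong-≗ each) (sum-replicate-zero m))
      (trans (sum-cong-≗ λ i → tautology 2 (λ a b → (not a · a) · b) (λ _ _ → false) (isUpright i) (wrapCrossing i i))
             (sum-replicate-zero m)))
      where
      each : ∀ i → ∑[ k < m ] mixed i k ≡ false
      each i = begin
        ∑[ k < m ] mixed i k
          ≡⟨ sum-cong-≗ (λ k → tautology 5 (λ h v w a b → (h · v) · (w · (a ∔ b))) (λ h v w a b → (h · w) · (v · a ∔ v · b))
               (isFlat i) (isUpright k) (isWrap (first i))
               (row (first k) ≡ᵇ row (first i)) (row (second k) ≡ᵇ row (first i))) ⟩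
        ∑[ k < m ] (hw · (isUpright k · (row (first k) ≡ᵇ row (first i)) ∔ isUpright k · (row (second k) ≡ᵇ row (first i))))
          ≡⟨ ∑-factorˡ hw (λ k → isUpright k · (row (first k) ≡ᵇ row (first i)) ∔ isUpright k · (row (second k) ≡ᵇ row (first i))) ⟩
        hw · (∑[ k < m ] (isUpright k · (row (first k) ≡ᵇ row (first i)) ∔ isUpright k · (row (second k) ≡ᵇ row (first i))))
          ≡⟨ cong (hw ·_) (∑-distrib-+ (λ k → isUpright k · (row (first k) ≡ᵇ row (first i)))
                                        (λ k → isUpright k · (row (second k) ≡ᵇ row (first i)))) ⟩
        hw · (verticalFrom (row (first i)) ∔ verticalTo (row (first i)))
          ≡⟨ cong (λ t → hw · (verticalFrom (row (first i)) ∔ t)) (verticalTo≡From (row (first i))) ⟩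
        hw · (verticalFrom (row (first i)) ∔ verticalFrom (row (first i)))
          ≡⟨ tautology 2 (λ a b → a · (b ∔ b)) (λ _ _ → false) hw (verticalFrom (row (first i))) ⟩
        false ∎
        where hw = isFlat i · isWrap (first i)

    -- Half of the crossing of two upright dominoes. The bracket with `isTop` is half of the formula
    -- of `next-θ-vertical`; reversing the comparison of second i with first k turns the two
    -- remaining comparisons into mirror images of each other, at the cost of a constant 1.
    verticalPair : Fin m → Fin m → Bool
    verticalPair i k = (isUpright i · isUpright k) · ((isTop (first i) ∔ leftTop (first i) · isTop (first k)) ∔ θ (first i) (second k))

    crossing-vertical : ∀ i k → i ≢ k →
      (isUpright i · isUpright k) · crossing i k ≡ isUpright i · isUpright k ∔ (verticalPair i k ∔ verticalPair k i)
    crossing-vertical i k i≢k with isUpright i | next i | isUpright k | next k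
    ... | true  | nᵢ | true  | nₖ = begin
      crossing i k
        ≡⟨ cong₂ (λ s t → s ∔ (θ (first i) (second k) ∔ t))
             (next-θ-vertical (first-rect i) (first-rect k) (first≢first i≢k) nᵢ nₖ)
             (θ-flip (≢-sym (first≢second (≢-sym i≢k)))) ⟩
      (a ∔ b) ∔ (c ∔ not d)
        ≡⟨ tautology 4 (λ a b c d → (a ∔ b) ∔ (c ∔ not d)) (λ a b c d → true ∔ ((a ∔ c) ∔ (b ∔ d))) a b c d ⟩
      true ∔ ((a ∔ c) ∔ (b ∔ d)) ∎
      where
      a = isTop (first i) ∔ leftTop (first i) · isTop (first k)
      b = isTop (first k) ∔ leftTop (first k) · isTop (first i)
      c = θ (first i) (second k)
      d = θ (first k) (second i)
    ... | true  | _ | false | _ = refl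
    ... | false | _ | true  | _ = refl
    ... | false | _ | false | _ = refl

    -- Exactly r W + c cells precede (c , r), and W is even.
    rank-parity : ∀ {q} → InRect q → ∑[ i < m ] (θ (first i) q ∔ θ (second i) q) ≡ odd (column q)
    rank-parity {c , r} (c<W , r<R) = begin
      _ ≡⟨ cover (λ p → θ p (c , r)) ⟩
      ∑[ c′ < W ] (∑[ r′ < R ] θ (toℕ c′ , toℕ r′) (c , r))
        ≡⟨ sum-cong-≗ {W} (λ c′ → ∑-distrib-+ {R} (λ r′ → toℕ r′ <ᵇ r) (λ r′ → (toℕ r′ ≡ᵇ r) · (toℕ c′ <ᵇ c))) ⟩
      ∑[ c′ < W ] (below ∔ (∑[ r′ < R ] ((toℕ r′ ≡ᵇ r) · (toℕ c′ <ᵇ c))))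
        ≡⟨ sum-cong-≗ {W} (λ c′ → cong (below ∔_) (trans
             (sum-cong-≗ {R} λ r′ → cong (_· (toℕ c′ <ᵇ c)) (≡ᵇ-sym (toℕ r′) r))
             (∑-≡ᵇ {R} (λ _ → toℕ c′ <ᵇ c) r<R))) ⟩
      ∑[ c′ < W ] (below ∔ (toℕ c′ <ᵇ c))
        ≡⟨ ∑-distrib-+ {W} (λ _ → below) (λ c′ → toℕ c′ <ᵇ c) ⟩
      (∑[ c′ < W ] below) ∔ (∑[ c′ < W ] (toℕ c′ <ᵇ c))
        ≡⟨ cong₂ _∔_ (trans (∑-const W below) (cong (_· below) W-even)) (∑-<ᵇ W c (ℕ.<⇒≤ c<W)) ⟩
      odd c ∎
      where
      below = ∑[ r′ < R ] (toℕ r′ <ᵇ r)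
      ≡ᵇ-sym : ∀ a b → (a ≡ᵇ b) ≡ (b ≡ᵇ a)
      ≡ᵇ-sym zero    zero    = refl
      ≡ᵇ-sym zero    (suc b) = refl
      ≡ᵇ-sym (suc a) zero    = refl
      ≡ᵇ-sym (suc a) (suc b) = ≡ᵇ-sym a b

    wraps leftTops verticals : Bool
    wraps     = ∑[ i < m ] (isFlat i · isWrap (first i))
    leftTops  = ∑[ i < m ] (isUpright i · leftTop (first i))
    verticals = ∑[ i < m ] isUpright i

    verticalPairs : Bool
    verticalPairs = pairSum m (λ i k → isUpright i · isUpright k)

    -- Of two distinct second cells exactly one comes before the other, so the double sum collapses
    -- to the number of unordered pairs of upright dominoes.
    ∑-θ-second : ∑[ k < m ] (∑[ i < m ] ((isUpright i · isUpright k) · θ (second i) (second k))) ≡ verticalPairs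
    ∑-θ-second = begin
      ∑[ k < m ] (∑[ i < m ] g k i)
        ≡⟨ tautology 1 (λ a → a) (λ a → (a ∔ false) ∔ false) _ ⟩
      (∑[ k < m ] (∑[ i < m ] g k i) ∔ false) ∔ false
        ≡⟨ cong (λ t → (∑[ k < m ] (∑[ i < m ] g k i) ∔ t) ∔ false) (trans (sum-cong-≗ diagonal) (sum-replicate-zero m)) ⟨
      (∑[ k < m ] (∑[ i < m ] g k i) ∔ ∑[ i < m ] g i i) ∔ false
        ≡⟨ cong (_∔ false) (pairSum-symmetrise m g) ⟨
      pairSum m (λ i k → g i k ∔ g k i) ∔ false
        ≡⟨ xor-identityʳ _ ⟩
      pairSum m (λ i k → g i k ∔ g k i)
        ≡⟨ pairSum-cong m off-diagonal ⟩
      verticalPairs ∎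
      where
      g : Fin m → Fin m → Bool
      g k i = (isUpright i · isUpright k) · θ (second i) (second k)
      diagonal : ∀ i → g i i ≡ false
      diagonal i = trans (cong ((isUpright i · isUpright i) ·_) (θ-irrefl (second i))) (∧-zeroʳ _)
      off-diagonal : ∀ i k → i ≢ k → g i k ∔ g k i ≡ isUpright i · isUpright k
      off-diagonal i k i≢k rewrite θ-flip (second≢second i≢k) =
        tautology 3 (λ a b t → (b · a) · t ∔ (a · b) · not t) (λ a b _ → a · b)
          (isUpright i) (isUpright k) (θ (second k) (second i))

    ∑-wrap-row : ∑[ k < m ] (∑[ i < m ] (isUpright k · ((isFlat i · isWrap (first i)) · (row (second k) ≡ᵇ row (first i)))))
               ≡ wraps · risers
    ∑-wrap-row = begin
      _ ≡⟨ ∑-comm (λ k i → isUpright k · ((isFlat i · isWrap (first i)) · (row (second k) ≡ᵇ row (first i)))) ⟩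
      ∑[ i < m ] (∑[ k < m ] (isUpright k · ((isFlat i · isWrap (first i)) · (row (second k) ≡ᵇ row (first i)))))
        ≡⟨ sum-cong-≗ each ⟩
      ∑[ i < m ] ((isFlat i · isWrap (first i)) · risers)
        ≡⟨ *-distribʳ-sum risers (λ i → isFlat i · isWrap (first i)) ⟨
      wraps · risers ∎
      where
      each : ∀ i → ∑[ k < m ] (isUpright k · ((isFlat i · isWrap (first i)) · (row (second k) ≡ᵇ row (first i))))
                 ≡ (isFlat i · isWrap (first i)) · risers
      each i = begin
        _ ≡⟨ sum-cong-≗ (λ k → tautology 3 (λ v h r → v · (h · r)) (λ v h r → h · (v · r))
               (isUpright k) hw (row (second k) ≡ᵇ row (first i))) ⟩
        ∑[ k < m ] (hw · (isUpright k · (row (second k) ≡ᵇ row (first i))))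
          ≡⟨ ∑-factorˡ hw (λ k → isUpright k · (row (second k) ≡ᵇ row (first i))) ⟩
        hw · verticalTo (row (first i))
          ≡⟨ cong (hw ·_) (verticalTo≡risers (proj₂ (first-rect i))) ⟩
        hw · risers ∎
        where hw = isFlat i · isWrap (first i)

    -- Adding θ (second i) (second k) twice completes the share of domino i in the rank of second k.
    -- Over all dominoes i this rank has the parity of the column. The flat dominoes, which have to
    -- be taken out again, contribute only if they wrap around in the row of second k.
    ∑-θ-first-second : ∑[ i < m ] (∑[ k < m ] ((isUpright i · isUpright k) · θ (first i) (second k)))
      ≡ ∑[ k < m ] (isUpright k · odd (column (second k))) ∔ wraps · risers ∔ verticalPairs
    ∑-θ-first-second = begin
      _ ≡⟨ ∑-comm (λ i k → (isUpright i · isUpright k) · θ (first i) (second k)) ⟩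
      ∑[ k < m ] (∑[ i < m ] ((isUpright i · isUpright k) · θ (first i) (second k)))
        ≡⟨ sum-cong-≗ (λ k → begin
             ∑[ i < m ] ((isUpright i · isUpright k) · θ (first i) (second k))
               ≡⟨ sum-cong-≗ (λ i → pointwise i k) ⟩
             ∑[ i < m ] ((A k i ∔ B k i) ∔ C k i)
               ≡⟨ trans (∑-distrib-+ (λ i → A k i ∔ B k i) (C k)) (cong (_∔ sum (C k)) (∑-distrib-+ (A k) (B k))) ⟩
             (sum (A k) ∔ sum (B k)) ∔ sum (C k)
               ≡⟨ cong (λ t → (t ∔ sum (B k)) ∔ sum (C k))
                    (trans (∑-factorˡ (isUpright k) (λ i → θ (first i) (second k) ∔ θ (second i) (second k)))
                           (cong (isUpright k ·_) (rank-parity (second-rect k)))) ⟩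
             (isUpright k · odd (column (second k)) ∔ sum (B k)) ∔ sum (C k) ∎) ⟩
      ∑[ k < m ] ((isUpright k · odd (column (second k)) ∔ sum (B k)) ∔ sum (C k))
        ≡⟨ trans (∑-distrib-+ (λ k → isUpright k · odd (column (second k)) ∔ sum (B k)) (λ k → sum (C k)))
                 (cong (_∔ (∑[ k < m ] sum (C k))) (∑-distrib-+ (λ k → isUpright k · odd (column (second k))) (λ k → sum (B k)))) ⟩
      (∑[ k < m ] (isUpright k · odd (column (second k))) ∔ (∑[ k < m ] sum (B k))) ∔ (∑[ k < m ] sum (C k))
        ≡⟨ cong₂ (λ s t → (∑[ k < m ] (isUpright k · odd (column (second k))) ∔ s) ∔ t) ∑-wrap-row ∑-θ-second ⟩
      _ ∎
      where
      A B C : Fin m → Fin m → Bool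
      A k i = isUpright k · (θ (first i) (second k) ∔ θ (second i) (second k))
      B k i = isUpright k · ((isFlat i · isWrap (first i)) · (row (second k) ≡ᵇ row (first i)))
      C k i = (isUpright i · isUpright k) · θ (second i) (second k)
      pointwise : ∀ i k → (isUpright i · isUpright k) · θ (first i) (second k) ≡ (A k i ∔ B k i) ∔ C k i
      pointwise i k with isUpright i in eqᵢ | isUpright k in eqₖ
      ... | true  | false = refl
      ... | false | false = refl
      ... | true  | true  = tautology 2 (λ a b → a) (λ a b → ((a ∔ b) ∔ false) ∔ b)
                              (θ (first i) (second k)) (θ (second i) (second k))
      -- A flat i and an upright k are distinct, which is what `second≢second` asks for.
      ... | false | true  rewrite horizontal-θ eqᵢ (second k) (proj₁ (second-rect k)) (second≢second (λ { refl → case trans (sym eqᵢ) eqₖ of λ () })) =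
        sym (tautology 1 (λ a → (a ∔ a) ∔ false) (λ _ → false) (isWrap (first i) · (row (second k) ≡ᵇ row (first i))))

    -- The origin of a₀ a₁: `leftTops · risers` comes from pairs in the rotated top row,
    -- `wraps · risers` from the rank correction for wrapped dominoes.
    ∑-verticalPair : ∑[ i < m ] (∑[ k < m ] verticalPair i k)
      ≡ (risers · verticals ∔ leftTops · risers)
      ∔ (∑[ k < m ] (isUpright k · odd (column (second k))) ∔ wraps · risers ∔ verticalPairs)
    ∑-verticalPair = begin
      _ ≡⟨ sum-cong-≗ (λ i → trans
             (sum-cong-≗ λ k → tautology 6
               (λ v w t l u a → (v · w) · ((t ∔ l · u) ∔ a)) (λ v w t l u a → ((v · t) · w ∔ (v · l) · (w · u)) ∔ (v · w) · a)
               (isUpright i) (isUpright k) (isTop (first i)) (leftTop (first i)) (isTop (first k)) (θ (first i) (second k)))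
             (trans (∑-distrib-+ (λ k → A i k ∔ B i k) (C i)) (cong (_∔ sum (C i)) (∑-distrib-+ (A i) (B i))))) ⟩
      ∑[ i < m ] ((sum (A i) ∔ sum (B i)) ∔ sum (C i))
        ≡⟨ trans (∑-distrib-+ (λ i → sum (A i) ∔ sum (B i)) (λ i → sum (C i)))
                 (cong (_∔ (∑[ i < m ] sum (C i))) (∑-distrib-+ (λ i → sum (A i)) (λ i → sum (B i)))) ⟩
      ((∑[ i < m ] sum (A i)) ∔ (∑[ i < m ] sum (B i))) ∔ (∑[ i < m ] sum (C i))
        ≡⟨ cong₂ _∔_ (cong₂ _∔_ (∑-product (λ i → isUpright i · isTop (first i)) isUpright)
                                 (∑-product (λ i → isUpright i · leftTop (first i)) (λ k → isUpright k · isTop (first k))))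
                      ∑-θ-first-second ⟩
      _ ∎
      where
      A B C : Fin m → Fin m → Bool
      A i k = (isUpright i · isTop (first i)) · isUpright k
      B i k = (isUpright i · leftTop (first i)) · (isUpright k · isTop (first k))
      C i k = (isUpright i · isUpright k) · θ (first i) (second k)

    ∑-verticalPair-diagonal : ∑[ i < m ] verticalPair i i
      ≡ (risers ∔ leftTops) ∔ (∑[ i < m ] (isUpright i · θ (first i) (second i)))
    ∑-verticalPair-diagonal = begin
      _ ≡⟨ sum-cong-≗ (λ i → tautology 4
             (λ v t l a → (v · v) · ((t ∔ (t · l) · t) ∔ a)) (λ v t l a → (v · t ∔ v · (t · l)) ∔ v · a)
             (isUpright i) (isTop (first i)) (isLeft (first i)) (θ (first i) (second i))) ⟩
      ∑[ i < m ] ((A i ∔ B i) ∔ C i)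
        ≡⟨ trans (∑-distrib-+ (λ i → A i ∔ B i) C) (cong (_∔ sum C) (∑-distrib-+ A B)) ⟩
      _ ∎
      where
      A B C : Fin m → Bool
      A i = isUpright i · isTop (first i)
      B i = isUpright i · leftTop (first i)
      C i = isUpright i · θ (first i) (second i)

    crossings : Bool
    crossings = pairSum m crossing

    crossings-value : crossings
      ≡ (risers · verticals ∔ (leftTops ∔ wraps) · risers ∔ ∑[ k < m ] (isUpright k · odd (column (second k))))
      ∔ ((risers ∔ leftTops) ∔ (∑[ i < m ] (isUpright i · θ (first i) (second i))))
    crossings-value = begin
      pairSum m crossing
        ≡⟨ pairSum-cong m crossing-split ⟩
      pairSum m (λ i k → (isUpright i · isUpright k) · crossing i k ∔ (mixed i k ∔ mixed k i))
        ≡⟨ pairSum-∔ m (λ i k → (isUpright i · isUpright k) · crossing i k) (λ i k → mixed i k ∔ mixed k i) ⟩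
      pairSum m (λ i k → (isUpright i · isUpright k) · crossing i k) ∔ pairSum m (λ i k → mixed i k ∔ mixed k i)
        ≡⟨ cong₂ _∔_ (pairSum-cong m crossing-vertical) mixed-vanishes ⟩
      pairSum m (λ i k → isUpright i · isUpright k ∔ (verticalPair i k ∔ verticalPair k i)) ∔ false
        ≡⟨ cong (_∔ false) (pairSum-∔ m (λ i k → isUpright i · isUpright k) (λ i k → verticalPair i k ∔ verticalPair k i)) ⟩
      (verticalPairs ∔ pairSum m (λ i k → verticalPair i k ∔ verticalPair k i)) ∔ false
        ≡⟨ cong (λ t → (verticalPairs ∔ t) ∔ false)
             (trans (pairSum-symmetrise m verticalPair) (cong₂ _∔_ ∑-verticalPair ∑-verticalPair-diagonal)) ⟩
      (verticalPairs ∔ (((risers · verticals ∔ leftTops · risers) ∔ (S ∔ wraps · risers ∔ verticalPairs))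
                       ∔ ((risers ∔ leftTops) ∔ D))) ∔ false
        -- The constant 1 of every upright pair cancels against the pairs produced by `∑-θ-second`.
        ≡⟨ tautology 7 (λ p r v l w s d → (p ∔ (((r · v ∔ l · r) ∔ (s ∔ w · r ∔ p)) ∔ ((r ∔ l) ∔ d))) ∔ false)
                       (λ p r v l w s d → (r · v ∔ (l ∔ w) · r ∔ s) ∔ ((r ∔ l) ∔ d))
             verticalPairs risers verticals leftTops wraps S D ⟩
      _ ∎
      where
      S = ∑[ k < m ] (isUpright k · odd (column (second k)))
      D = ∑[ i < m ] (isUpright i · θ (first i) (second i))

    -- The two sums added to `crossings` are those that the permutation sign and the edge signs
    -- bring in later: dominoes whose second cell does not come after the first, and upright
    -- dominoes whose first cell is black. The former absorbs the order within upright dominoes, the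
    -- latter the column parities.
    sign-formula :
      crossings ∔ ∑[ i < m ] not (θ (first i) (second i))
                ∔ ∑[ i < m ] (isUpright i · not (odd (column (first i)) ∔ odd (row (first i))))
      ≡ risers · (leftTops ∔ wraps) ∔ (leftTops ∔ wraps) ∔ risers · slope
    sign-formula = begin
      crossings ∔ ∑[ i < m ] not (θ (first i) (second i)) ∔ K
        ≡⟨ cong₂ (λ s t → s ∔ t ∔ K) crossings-value ascents ⟩
      (risers · verticals ∔ (leftTops ∔ wraps) · risers ∔ S) ∔ ((risers ∔ leftTops) ∔ D) ∔ ((D ∔ verticals) ∔ wraps) ∔ K
        ≡⟨ tautology 7 (λ r v l w s d k → (r · v ∔ (l ∔ w) · r ∔ s) ∔ ((r ∔ l) ∔ d) ∔ ((d ∔ v) ∔ w) ∔ k)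
                       (λ r v l w s d k → (r · v ∔ v) ∔ r · (l ∔ w) ∔ (l ∔ w) ∔ (r ∔ (s ∔ k)))
             risers verticals leftTops wraps S D K ⟩
      (risers · verticals ∔ verticals) ∔ risers · (leftTops ∔ wraps) ∔ (leftTops ∔ wraps) ∔ (risers ∔ (S ∔ K))
        ≡⟨ cong₂ (λ v t → (risers · v ∔ v) ∔ risers · (leftTops ∔ wraps) ∔ (leftTops ∔ wraps) ∔ (risers ∔ t))
             verticals-value columns ⟩
      -- As `verticals` is a multiple of `risers` and bits are idempotent, the two terms with
      -- `verticals` cancel.
      (risers · (risers · O) ∔ risers · O) ∔ risers · (leftTops ∔ wraps) ∔ (leftTops ∔ wraps) ∔ (risers ∔ (risers · Q ∔ risers · odd x))
        ≡⟨ tautology 5 (λ r o a q z → (r · (r · o) ∔ r · o) ∔ r · a ∔ a ∔ (r ∔ (r · q ∔ r · z)))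
                       (λ r o a q z → r · a ∔ a ∔ r · not (q ∔ z))
             risers O (leftTops ∔ wraps) Q (odd x) ⟩
      _ ∎
      where
      S = ∑[ k < m ] (isUpright k · odd (column (second k)))
      D = ∑[ i < m ] (isUpright i · θ (first i) (second i))
      K = ∑[ i < m ] (isUpright i · not (odd (column (first i)) ∔ odd (row (first i))))
      O = ∑[ r < R ] true
      Q = ∑[ r < R ] not (odd (toℕ r))
      ascents : ∑[ i < m ] not (θ (first i) (second i)) ≡ (D ∔ verticals) ∔ wraps
      ascents = begin
        _ ≡⟨ sum-cong-≗ pointwise ⟩
        ∑[ i < m ] ((isUpright i · θ (first i) (second i) ∔ isUpright i) ∔ isFlat i · isWrap (first i))
          ≡⟨ trans (∑-distrib-+ (λ i → isUpright i · θ (first i) (second i) ∔ isUpright i) (λ i → isFlat i · isWrap (first i)))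
                   (cong (_∔ wraps) (∑-distrib-+ (λ i → isUpright i · θ (first i) (second i)) isUpright)) ⟩
        _ ∎
        where
        pointwise : ∀ i → not (θ (first i) (second i)) ≡ (isUpright i · θ (first i) (second i) ∔ isUpright i) ∔ isFlat i · isWrap (first i)
        pointwise i with isUpright i | next i
        ... | true  | _  = tautology 1 (λ a → not a) (λ a → (a ∔ true) ∔ false) (θ (first i) (second i))
        ... | false | nx = next-θ-self nx
      verticals-value : verticals ≡ risers · O
      verticals-value = trans (sum-cong-≗ λ i → sym (∧-identityʳ (isUpright i))) (∑-vertical-row (λ _ → true))
      -- The ends of an upright domino have columns of equal parity, up to x at the top, so adding
      -- the colour bit trades the column parity for the row parity, which `∑-vertical-row` can sum.
      columns : S ∔ K ≡ risers · Q ∔ risers · odd x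
      columns = begin
        S ∔ K
          ≡⟨ ∑-distrib-+ (λ i → isUpright i · odd (column (second i)))
                         (λ i → isUpright i · not (odd (column (first i)) ∔ odd (row (first i)))) ⟨
        ∑[ i < m ] (isUpright i · odd (column (second i)) ∔ isUpright i · not (odd (column (first i)) ∔ odd (row (first i))))
          ≡⟨ sum-cong-≗ pointwise ⟩
        ∑[ i < m ] (isUpright i · not (odd (row (first i))) ∔ (isUpright i · isTop (first i)) · odd x)
          ≡⟨ ∑-distrib-+ (λ i → isUpright i · not (odd (row (first i)))) (λ i → (isUpright i · isTop (first i)) · odd x) ⟩
        _
          ≡⟨ cong₂ _∔_ (∑-vertical-row (λ r → not (odd r))) (sym (*-distribʳ-sum (odd x) (λ i → isUpright i · isTop (first i)))) ⟩
        _ ∎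
        where
        pointwise : ∀ i → isUpright i · odd (column (second i)) ∔ isUpright i · not (odd (column (first i)) ∔ odd (row (first i)))
                        ≡ isUpright i · not (odd (row (first i))) ∔ (isUpright i · isTop (first i)) · odd x
        pointwise i with isUpright i | next i
        ... | false | _  = refl
        ... | true  | nx rewrite next-column W-even nx =
          tautology 4 (λ c t z r → (c ∔ t · z) ∔ not (c ∔ r)) (λ c t z r → not r ∔ t · z)
            (odd (column (first i))) (isTop (first i)) (odd x) (odd (row (first i)))

-- From crossings to the sign of the permutation of a tiling.

∑-false : ∀ {n} {g : Fin n → Bool} → (∀ i → g i ≡ false) → ∑[ i < n ] g i ≡ false
∑-false {n} g≡false = trans (sum-cong-≗ g≡false) (sum-replicate-zero n)

∑-unique : ∀ {n} (g : Fin n → Bool) i → g i ≡ true → (∀ k → k ≢ i → g k ≡ false) → ∑[ k < n ] g k ≡ true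
∑-unique {suc n} g i gi≡true others = trans (sum-remove {i = i} g)
  (cong₂ _∔_ gi≡true (∑-false λ k → others (punchIn i k) (Fin.punchInᵢ≢i i k)))

∑-cell : ∀ {W R} (g : Cell → Bool) {p} → column p ℕ.< W → row p ℕ.< R →
  ∑[ c < W ] (∑[ r < R ] (((column p ≡ᵇ toℕ c) · (row p ≡ᵇ toℕ r)) · g (toℕ c , toℕ r))) ≡ g p
∑-cell {W} {R} g {a , b} a<W b<R = begin
  _ ≡⟨ sum-cong-≗ {W} (λ c → trans
         (sum-cong-≗ {R} λ r → tautology 3 (λ p q g → (p · q) · g) (λ p q g → p · (q · g)) (a ≡ᵇ toℕ c) (b ≡ᵇ toℕ r) (g (toℕ c , toℕ r)))
         (trans (∑-factorˡ {R} (a ≡ᵇ toℕ c) (λ r → (b ≡ᵇ toℕ r) · g (toℕ c , toℕ r)))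
                (cong ((a ≡ᵇ toℕ c) ·_) (∑-≡ᵇ {R} (λ r → g (toℕ c , r)) b<R)))) ⟩
  ∑[ c < W ] ((a ≡ᵇ toℕ c) · g (toℕ c , b))
    ≡⟨ ∑-≡ᵇ {W} (λ c → g (c , b)) a<W ⟩
  g (a , b) ∎
  where open ≡-Reasoning

isCell-false : ∀ {p c r} → p ≢ (c , r) → (column p ≡ᵇ c) · (row p ≡ᵇ r) ≡ false
isCell-false {a , b} {c} {r} p≢ with a ℕ.≟ c
... | no  a≢c = cong (_· (b ≡ᵇ r)) (≡ᵇ-false a≢c)
... | yes refl = trans (cong ((a ≡ᵇ a) ·_) (≡ᵇ-false λ b≡r → p≢ (cong (a ,_) b≡r))) (∧-zeroʳ _)

isCell-true : ∀ {p c r} → p ≡ (c , r) → (column p ≡ᵇ c) · (row p ≡ᵇ r) ≡ true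
isCell-true {a , b} refl = cong₂ _·_ (≡ᵇ-refl a) (≡ᵇ-refl b)

module Colouring (W R′ x : ℕ) (W-even : odd W ≡ false) (0<W : 0 ℕ.< W)
  {m} (blackCell whiteCell : Fin m → Cell)
  (black-rect : ∀ i → Torus.InRect W R′ x (blackCell i))
  (white-rect : ∀ i → Torus.InRect W R′ x (whiteCell i))
  (black-injective : ∀ {i k} → blackCell i ≡ blackCell k → i ≡ k)
  (white-injective : ∀ {i k} → whiteCell i ≡ whiteCell k → i ≡ k)
  (black≢white : ∀ i k → blackCell i ≢ whiteCell k)
  (exhaustive : ∀ p → Torus.InRect W R′ x p → (∃ λ i → blackCell i ≡ p) ⊎ (∃ λ i → whiteCell i ≡ p))
  where

  open Torus W R′ x
  open ≡-Reasoning

  ∑-cells : ∀ (g : Cell → Bool) → ∑[ i < m ] g (blackCell i) ∔ ∑[ i < m ] g (whiteCell i)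
                                ≡ ∑[ c < W ] (∑[ r < R ] g (toℕ c , toℕ r))
  ∑-cells g = begin
    ∑[ i < m ] g (blackCell i) ∔ ∑[ i < m ] g (whiteCell i)
      ≡⟨ cong₂ _∔_ (expand blackCell black-rect) (expand whiteCell white-rect) ⟩
    (∑[ c < W ] (∑[ r < R ] (count blackCell c r · g (toℕ c , toℕ r)))) ∔ (∑[ c < W ] (∑[ r < R ] (count whiteCell c r · g (toℕ c , toℕ r))))
      ≡⟨ ∑-distrib-+ {W} (λ c → ∑[ r < R ] (count blackCell c r · g (toℕ c , toℕ r)))
                          (λ c → ∑[ r < R ] (count whiteCell c r · g (toℕ c , toℕ r))) ⟨
    ∑[ c < W ] ((∑[ r < R ] (count blackCell c r · g (toℕ c , toℕ r))) ∔ (∑[ r < R ] (count whiteCell c r · g (toℕ c , toℕ r))))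
      ≡⟨ sum-cong-≗ {W} (λ c → trans
           (sym (∑-distrib-+ {R} (λ r → count blackCell c r · g (toℕ c , toℕ r)) (λ r → count whiteCell c r · g (toℕ c , toℕ r))))
           (sum-cong-≗ {R} λ r → trans
             (tautology 3 (λ a b g → a · g ∔ b · g) (λ a b g → (a ∔ b) · g) (count blackCell c r) (count whiteCell c r) (g (toℕ c , toℕ r)))
             (cong (_· g (toℕ c , toℕ r)) (once c r)))) ⟩
    _ ∎
    where
    is : Cell → Fin W → Fin R → Bool
    is p c r = (column p ≡ᵇ toℕ c) · (row p ≡ᵇ toℕ r)
    count : (Fin m → Cell) → Fin W → Fin R → Bool
    count cell c r = ∑[ i < m ] is (cell i) c r
    expand : ∀ cell → (∀ i → InRect (cell i)) →
      ∑[ i < m ] g (cell i) ≡ ∑[ c < W ] (∑[ r < R ] (count cell c r · g (toℕ c , toℕ r)))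
    expand cell rect = begin
      ∑[ i < m ] g (cell i)
        ≡⟨ sum-cong-≗ (λ i → sym (∑-cell {W} {R} g (proj₁ (rect i)) (proj₂ (rect i)))) ⟩
      ∑[ i < m ] (∑[ c < W ] (∑[ r < R ] (is (cell i) c r · g (toℕ c , toℕ r))))
        ≡⟨ ∑-comm {m} {W} (λ i c → ∑[ r < R ] (is (cell i) c r · g (toℕ c , toℕ r))) ⟩
      ∑[ c < W ] (∑[ i < m ] (∑[ r < R ] (is (cell i) c r · g (toℕ c , toℕ r))))
        ≡⟨ sum-cong-≗ {W} (λ c → ∑-comm {m} {R} (λ i r → is (cell i) c r · g (toℕ c , toℕ r))) ⟩
      ∑[ c < W ] (∑[ r < R ] (∑[ i < m ] (is (cell i) c r · g (toℕ c , toℕ r))))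
        ≡⟨ sum-cong-≗ {W} (λ c → sum-cong-≗ {R} λ r → sym (*-distribʳ-sum (g (toℕ c , toℕ r)) (λ i → is (cell i) c r))) ⟩
      ∑[ c < W ] (∑[ r < R ] (count cell c r · g (toℕ c , toℕ r))) ∎
    once : ∀ c r → count blackCell c r ∔ count whiteCell c r ≡ true
    once c r with exhaustive (toℕ c , toℕ r) (Fin.toℕ<n c , Fin.toℕ<n r)
    ... | inj₁ (i , eq) = cong₂ _∔_
      (∑-unique _ i (isCell-true eq) λ k k≢i → isCell-false λ eq′ → k≢i (black-injective (trans eq′ (sym eq))))
      (∑-false λ k → isCell-false λ eq′ → black≢white i k (trans eq (sym eq′)))
    ... | inj₂ (i , eq) = cong₂ _∔_
      (∑-false λ k → isCell-false λ eq′ → black≢white k i (trans eq′ (sym eq)))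
      (∑-unique _ i (isCell-true eq) λ k k≢i → isCell-false λ eq′ → k≢i (white-injective (trans eq′ (sym eq))))

  numbering : Fin m → Fin m → Bool
  numbering j l = (j <?₂ l) ∔ θ (whiteCell j) (whiteCell l)

  -- The discrepancy between the given enumerations of the squares and the
  -- row-major order; it is the same for all tilings.
  enumerationSign : Bool
  enumerationSign = pairSum m numbering ∔ pairSum m (λ i k → θ (blackCell i) (blackCell k))
                  ∔ ∑[ i < m ] (∑[ k < m ] θ (blackCell i) (whiteCell k))

  -- Exchanging j and l flips both bits. By symmetry the pair sum is insensitive to π, which is how
  -- the arbitrary enumeration of the white squares becomes a constant.
  numbering-sym : ∀ j l → numbering j l ≡ numbering l j
  numbering-sym j l with j Fin.≟ l
  ... | yes refl = refl
  ... | no  j≢l rewrite <ᵇ-flip {toℕ j} {toℕ l} (λ eq → j≢l (Fin.toℕ-injective eq))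
                      | θ-flip {whiteCell j} {whiteCell l} (λ eq → j≢l (white-injective eq)) =
    tautology 2 (λ a b → not a ∔ not b) (λ a b → a ∔ b) (l <?₂ j) (θ (whiteCell l) (whiteCell j))

  module Matching (π : Lehmer m) (isUpright : Fin m → Bool) (first second : Fin m → Cell)
    (next : ∀ i → Next (isUpright i) (first i) (second i))
    (isBlack : Fin m → Bool)
    (isBlack-first : ∀ i → isBlack i ≡ not (odd (column (first i)) ∔ odd (row (first i))))
    (ends : ∀ i → (isBlack i ≡ true  × first i ≡ blackCell i × second i ≡ whiteCell (act π i))
                ⊎ (isBlack i ≡ false × first i ≡ whiteCell (act π i) × second i ≡ blackCell i))
    where

    partner : Fin m → Cell
    partner i = whiteCell (act π i)

    first-rect : ∀ i → InRect (first i)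
    first-rect i with ends i
    ... | inj₁ (_ , f , _) rewrite f = black-rect i
    ... | inj₂ (_ , f , _) rewrite f = white-rect _

    second-rect : ∀ i → InRect (second i)
    second-rect i with ends i
    ... | inj₁ (_ , _ , s) rewrite s = white-rect _
    ... | inj₂ (_ , _ , s) rewrite s = black-rect i

    partner≢ : ∀ {i k} → i ≢ k → partner i ≢ partner k
    partner≢ i≢k eq = i≢k (act-injective π (white-injective eq))

    black≢ : ∀ {i k} → i ≢ k → blackCell i ≢ blackCell k
    black≢ i≢k eq = i≢k (black-injective eq)

    first≢first : ∀ {i k} → i ≢ k → first i ≢ first k
    first≢first {i} {k} i≢k with ends i | ends k
    ... | inj₁ (_ , f , _) | inj₁ (_ , f′ , _) rewrite f | f′ = black≢ i≢k
    ... | inj₁ (_ , f , _) | inj₂ (_ , f′ , _) rewrite f | f′ = black≢white _ _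
    ... | inj₂ (_ , f , _) | inj₁ (_ , f′ , _) rewrite f | f′ = ≢-sym (black≢white _ _)
    ... | inj₂ (_ , f , _) | inj₂ (_ , f′ , _) rewrite f | f′ = partner≢ i≢k

    second≢second : ∀ {i k} → i ≢ k → second i ≢ second k
    second≢second {i} {k} i≢k with ends i | ends k
    ... | inj₁ (_ , _ , f) | inj₁ (_ , _ , f′) rewrite f | f′ = partner≢ i≢k
    ... | inj₁ (_ , _ , f) | inj₂ (_ , _ , f′) rewrite f | f′ = ≢-sym (black≢white _ _)
    ... | inj₂ (_ , _ , f) | inj₁ (_ , _ , f′) rewrite f | f′ = black≢white _ _
    ... | inj₂ (_ , _ , f) | inj₂ (_ , _ , f′) rewrite f | f′ = black≢ i≢k

    first≢second : ∀ {i k} → i ≢ k → first i ≢ second k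
    first≢second {i} {k} i≢k with ends i | ends k
    ... | inj₁ (_ , f , _) | inj₁ (_ , _ , f′) rewrite f | f′ = black≢white _ _
    ... | inj₁ (_ , f , _) | inj₂ (_ , _ , f′) rewrite f | f′ = black≢ i≢k
    ... | inj₂ (_ , f , _) | inj₁ (_ , _ , f′) rewrite f | f′ = partner≢ i≢k
    ... | inj₂ (_ , f , _) | inj₂ (_ , _ , f′) rewrite f | f′ = ≢-sym (black≢white _ _)

    cover : ∀ (g : Cell → Bool) →
      ∑[ i < m ] (g (first i) ∔ g (second i)) ≡ ∑[ c < W ] (∑[ r < R ] g (toℕ c , toℕ r))
    cover g = begin
      ∑[ i < m ] (g (first i) ∔ g (second i))
        ≡⟨ sum-cong-≗ pointwise ⟩
      ∑[ i < m ] (g (blackCell i) ∔ g (partner i))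
        ≡⟨ ∑-distrib-+ (λ i → g (blackCell i)) (λ i → g (partner i)) ⟩
      ∑[ i < m ] g (blackCell i) ∔ ∑[ i < m ] g (partner i)
        ≡⟨ cong (∑[ i < m ] g (blackCell i) ∔_) (∑-act π (λ j → g (whiteCell j))) ⟩
      ∑[ i < m ] g (blackCell i) ∔ ∑[ i < m ] g (whiteCell i)
        ≡⟨ ∑-cells g ⟩
      _ ∎
      where
      pointwise : ∀ i → g (first i) ∔ g (second i) ≡ g (blackCell i) ∔ g (partner i)
      pointwise i with ends i
      ... | inj₁ (_ , f , s) rewrite f | s = refl
      ... | inj₂ (_ , f , s) rewrite f | s = tautology 2 (λ a b → a ∔ b) (λ a b → b ∔ a) (g (partner i)) (g (blackCell i))

    open Dominoes W-even 0<W isUpright first second next first-rect second-rect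
      first≢first second≢second first≢second cover public

    crossing-ends : ∀ i k → crossing i k
      ≡ (θ (blackCell i) (blackCell k) ∔ θ (partner i) (partner k))
      ∔ (θ (blackCell i) (partner k) ∔ θ (partner i) (blackCell k))
    crossing-ends i k with ends i | ends k
    ... | inj₁ (_ , f , s) | inj₁ (_ , f′ , s′) rewrite f | s | f′ | s′ = refl
    ... | inj₁ (_ , f , s) | inj₂ (_ , f′ , s′) rewrite f | s | f′ | s′ = tautology 4
      (λ a b c d → (a ∔ b) ∔ (c ∔ d)) (λ a b c d → (c ∔ d) ∔ (a ∔ b))
      (θ (blackCell i) (partner k)) (θ (partner i) (blackCell k)) (θ (blackCell i) (blackCell k)) (θ (partner i) (partner k))
    ... | inj₂ (_ , f , s) | inj₁ (_ , f′ , s′) rewrite f | s | f′ | s′ = tautology 4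
      (λ a b c d → (a ∔ b) ∔ (c ∔ d)) (λ a b c d → (d ∔ c) ∔ (b ∔ a))
      (θ (partner i) (blackCell k)) (θ (blackCell i) (partner k)) (θ (partner i) (partner k)) (θ (blackCell i) (blackCell k))
    ... | inj₂ (_ , f , s) | inj₂ (_ , f′ , s′) rewrite f | s | f′ | s′ = tautology 4
      (λ a b c d → (a ∔ b) ∔ (c ∔ d)) (λ a b c d → (b ∔ a) ∔ (d ∔ c))
      (θ (partner i) (partner k)) (θ (blackCell i) (blackCell k)) (θ (partner i) (blackCell k)) (θ (blackCell i) (partner k))

    θ-partner : ∀ i → θ (blackCell i) (partner i) ≡ not (θ (first i) (second i)) ∔ isBlack i
    θ-partner i with ends i
    ... | inj₁ (β , f , s) rewrite β | f | s = tautology 1 (λ a → a) (λ a → not a ∔ true) (θ (blackCell i) (partner i))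
    ... | inj₂ (β , f , s) rewrite β | f | s =
      trans (θ-flip (black≢white i (act π i))) (sym (xor-identityʳ _))

    -- Up to `numbering`, the index order of two white squares is their row-major order. That
    -- comparison and the one of the two black squares are contained in `crossing`; its black-white
    -- comparisons are put in symmetrised form for `pairSum-symmetrise`.
    inversion : ∀ i k → i ≢ k → (act π k <?₂ act π i)
      ≡ (true ∔ numbering (act π i) (act π k) ∔ θ (blackCell i) (blackCell k)) ∔ crossing i k
      ∔ (true ∔ (θ (blackCell i) (partner k) ∔ θ (blackCell k) (partner i)))
    inversion i k i≢k rewrite crossing-ends i k
      | θ-flip {partner i} {blackCell k} (≢-sym (black≢white k (act π i)))
      | <ᵇ-flip {toℕ (act π k)} {toℕ (act π i)} (λ eq → i≢k (sym (act-injective π (Fin.toℕ-injective eq)))) =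
      tautology 5 (λ o w b p q → not o)
        (λ o w b p q → (true ∔ (o ∔ w) ∔ b) ∔ ((b ∔ w) ∔ (p ∔ not q)) ∔ (true ∔ (p ∔ q)))
        (act π i <?₂ act π k) (θ (partner i) (partner k)) (θ (blackCell i) (blackCell k))
        (θ (blackCell i) (partner k)) (θ (blackCell k) (partner i))

    -- Among the sums over pairs only `crossings` depends on the tiling: π merely permutes the pairs
    -- of `numbering`, and it reorders the white squares in the double sum of black-white
    -- comparisons. The diagonal of the latter, the order within the dominoes, is the last summand.
    codeParity-crossings : codeParity π ≡ enumerationSign ∔ crossings ∔ ∑[ i < m ] θ (blackCell i) (partner i)
    codeParity-crossings = begin
      codeParity π
        ≡⟨ codeParity-inversions π ⟩
      pairSum m (λ i k → act π k <?₂ act π i)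
        ≡⟨ pairSum-cong m inversion ⟩
      pairSum m (λ i k → (t i k ∔ n i k ∔ b i k) ∔ crossing i k ∔ (t i k ∔ (p i k ∔ p k i)))
        ≡⟨ trans (pairSum-∔ m (λ i k → (t i k ∔ n i k ∔ b i k) ∔ crossing i k) (λ i k → t i k ∔ (p i k ∔ p k i)))
             (cong₂ _∔_ (trans (pairSum-∔ m (λ i k → t i k ∔ n i k ∔ b i k) crossing)
                (cong (_∔ crossings) (trans (pairSum-∔ m (λ i k → t i k ∔ n i k) b)
                   (cong (_∔ pairSum m b) (pairSum-∔ m t n)))))
              (pairSum-∔ m t (λ i k → p i k ∔ p k i))) ⟩
      ((pairSum m t ∔ pairSum m n ∔ pairSum m b) ∔ crossings) ∔ (pairSum m t ∔ pairSum m (λ i k → p i k ∔ p k i))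
        ≡⟨ cong₂ (λ u v → ((pairSum m t ∔ u ∔ pairSum m b) ∔ crossings) ∔ (pairSum m t ∔ v))
             (pairSum-act π numbering numbering-sym)
             (trans (pairSum-symmetrise m p) (cong (_∔ P)
               (sum-cong-≗ λ i → ∑-act π (λ j → θ (blackCell i) (whiteCell j))))) ⟩
      ((pairSum m t ∔ pairSum m numbering ∔ pairSum m b) ∔ crossings) ∔ (pairSum m t ∔ (Q ∔ P))
        ≡⟨ tautology 6 (λ t n b c q p → ((t ∔ n ∔ b) ∔ c) ∔ (t ∔ (q ∔ p))) (λ t n b c q p → n ∔ b ∔ q ∔ c ∔ p)
             (pairSum m t) (pairSum m numbering) (pairSum m b) crossings Q P ⟩
      _ ∎
      where
      t n b p : Fin m → Fin m → Bool
      t _ _ = true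
      n i k = numbering (act π i) (act π k)
      b i k = θ (blackCell i) (blackCell k)
      p i k = θ (blackCell i) (partner k)
      Q = ∑[ i < m ] (∑[ k < m ] θ (blackCell i) (whiteCell k))
      P = ∑[ i < m ] θ (blackCell i) (partner i)

    -- By `θ-partner` the order of black and white is that of first and second cell, corrected by
    -- the colour of the first. The edge signs cancel this correction on flat dominoes; on upright
    -- ones it is the colour sum of `sign-formula`.
    kasteleyn-sign : codeParity π ∔ ∑[ i < m ] (isFlat i · isBlack i)
      ≡ enumerationSign ∔ (risers · (leftTops ∔ wraps) ∔ (leftTops ∔ wraps) ∔ risers · slope)
    kasteleyn-sign = begin
      codeParity π ∔ ∑[ i < m ] (isFlat i · isBlack i)
        ≡⟨ cong (_∔ ∑[ i < m ] (isFlat i · isBlack i)) (trans codeParity-crossings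
             (cong ((enumerationSign ∔ crossings) ∔_) (trans (sum-cong-≗ θ-partner)
               (∑-distrib-+ (λ i → not (θ (first i) (second i))) isBlack)))) ⟩
      enumerationSign ∔ crossings ∔ (A ∔ sum isBlack) ∔ H
        ≡⟨ tautology 5 (λ e c a b h → e ∔ c ∔ (a ∔ b) ∔ h) (λ e c a b h → e ∔ (c ∔ a ∔ (b ∔ h)))
             enumerationSign crossings A (sum isBlack) H ⟩
      enumerationSign ∔ (crossings ∔ A ∔ (sum isBlack ∔ H))
        ≡⟨ cong (λ u → enumerationSign ∔ (crossings ∔ A ∔ u)) (trans
             (sym (∑-distrib-+ isBlack (λ i → isFlat i · isBlack i))) (sum-cong-≗ pointwise)) ⟩
      _ ≡⟨ cong (enumerationSign ∔_) sign-formula ⟩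
      _ ∎
      where
      A = ∑[ i < m ] not (θ (first i) (second i))
      H = ∑[ i < m ] (isFlat i · isBlack i)
      pointwise : ∀ i → isBlack i ∔ isFlat i · isBlack i ≡ isUpright i · not (odd (column (first i)) ∔ odd (row (first i)))
      pointwise i = trans (tautology 2 (λ b v → b ∔ not v · b) (λ b v → v · b) (isBlack i) (isUpright i))
        (cong (isUpright i ·_) (isBlack-first i))

-- Parities of integers and colours of squares.

oddℤ : ℤ → Bool
oddℤ i = odd ∣ i ∣

oddℤ-⊖ : ∀ m n → oddℤ (m ℤ.⊖ n) ≡ odd m ∔ odd n
oddℤ-⊖ zero    zero    = refl
oddℤ-⊖ zero    (suc n) = refl
oddℤ-⊖ (suc m) zero    = sym (xor-identityʳ _)
oddℤ-⊖ (suc m) (suc n) = trans (cong oddℤ (ℤ.[1+m]⊖[1+n]≡m⊖n m n))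
  (trans (oddℤ-⊖ m n) (tautology 2 (λ a b → a ∔ b) (λ a b → not a ∔ not b) (odd m) (odd n)))

oddℤ-+ : ∀ i j → oddℤ (i ℤ.+ j) ≡ oddℤ i ∔ oddℤ j
oddℤ-+ (+ m)    (+ n)    = odd-+ m n
oddℤ-+ (+ m)    -[1+ n ] = oddℤ-⊖ m (suc n)
oddℤ-+ -[1+ m ] (+ n)    = trans (oddℤ-⊖ n (suc m))
  (tautology 2 (λ a b → a ∔ not b) (λ a b → not b ∔ a) (odd n) (odd m))
oddℤ-+ -[1+ m ] -[1+ n ] = trans (cong (not ∘ not) (odd-+ m n))
  (tautology 2 (λ a b → not (not (a ∔ b))) (λ a b → not a ∔ not b) (odd m) (odd n))

odd-* : ∀ m n → odd (m ℕ.* n) ≡ odd m · odd n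
odd-* zero    n = refl
odd-* (suc m) n = trans (odd-+ n (m ℕ.* n)) (trans (cong (odd n ∔_) (odd-* m n))
  (tautology 2 (λ a b → b ∔ a · b) (λ a b → not a · b) (odd m) (odd n)))

oddℤ-* : ∀ i j → oddℤ (i ℤ.* j) ≡ oddℤ i · oddℤ j
oddℤ-* i j = trans (cong odd (ℤ.abs-* i j)) (odd-* ∣ i ∣ ∣ j ∣)

even⇒oddℤ : ∀ {i} → Even i → oddℤ i ≡ false
even⇒oddℤ (divides q refl) = trans (oddℤ-* q (+ 2)) (∧-zeroʳ _)

oddℤ⇒even : ∀ {i} → oddℤ i ≡ false → Even i
oddℤ⇒even {i} eq = ∣ᵤ⇒∣ (go ∣ i ∣ eq)
  where
  go : ∀ n → odd n ≡ false → 2 ℕ.∣ n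
  go zero          _  = 2 ℕ.∣0
  go (suc (suc n)) eq = ℕ.∣m∣n⇒∣m+n (ℕ.∣-refl {2}) (go n (trans (tautology 1 (λ a → a) (λ a → not (not a)) (odd n)) eq))

sameParity : ∀ v → SameParity v → oddℤ (proj₁ v) ≡ oddℤ (proj₂ v)
sameParity _ (inj₁ (ea , eb)) = trans (even⇒oddℤ ea) (sym (even⇒oddℤ eb))
sameParity _ (inj₂ (oa , ob)) = trans (odd-true oa) (sym (odd-true ob))
  where
  odd-true : ∀ {i} → ¬ Even i → oddℤ i ≡ true
  odd-true {i} ¬even = ¬-not λ eq → ¬even (oddℤ⇒even {i} eq)

isBlack : Square → Bool
isBlack (i , j) = not (oddℤ i ∔ oddℤ j)

black⇒ : ∀ s → Black s → isBlack s ≡ true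
black⇒ (i , j) bl = cong not (trans (sym (oddℤ-+ i j)) (even⇒oddℤ bl))

black⇐ : ∀ s → isBlack s ≡ true → Black s
black⇐ (i , j) eq = oddℤ⇒even {i ℤ.+ j} (trans (oddℤ-+ i j) (not-true eq))
  where
  not-true : ∀ {a} → not a ≡ true → a ≡ false
  not-true {false} _ = refl

white⇒ : ∀ s → White s → isBlack s ≡ false
white⇒ s wh = ¬-not λ eq → wh (black⇐ s eq)

does-black? : ∀ s → does (black? s) ≡ isBlack s
does-black? s = decide (black? s)
  where
  decide : (d : Dec (Black s)) → does d ≡ isBlack s
  decide (yes bl) = sym (black⇒ s bl)
  decide (no  wh) = sym (white⇒ s wh)

isBlack-unit : ∀ o s → isBlack (s ⊕ unit o) ≡ not (isBlack s)
isBlack-unit horizontal (i , j) rewrite oddℤ-+ i 1ℤ | oddℤ-+ j 0ℤ =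
  tautology 2 (λ a b → not ((a ∔ true) ∔ (b ∔ false))) (λ a b → not (not (a ∔ b))) (oddℤ i) (oddℤ j)
isBlack-unit vertical   (i , j) rewrite oddℤ-+ i 0ℤ | oddℤ-+ j 1ℤ =
  tautology 2 (λ a b → not ((a ∔ false) ∔ (b ∔ true))) (λ a b → not (not (a ∔ b))) (oddℤ i) (oddℤ j)

-- Translation by lattice vectors, and crossings modulo 2.

⊕-assoc : ∀ s t u → (s ⊕ t) ⊕ u ≡ s ⊕ (t ⊕ u)
⊕-assoc (a , b) (c , d) (e , f) = cong₂ _,_ (ℤ.+-assoc a c e) (ℤ.+-assoc b d f)

⊕-comm : ∀ s t → s ⊕ t ≡ t ⊕ s
⊕-comm (a , b) (c , d) = cong₂ _,_ (ℤ.+-comm a c) (ℤ.+-comm b d)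

⊕-identityʳ : ∀ s → s ⊕ 0⃗ ≡ s
⊕-identityʳ (a , b) = cong₂ _,_ (ℤ.+-identityʳ a) (ℤ.+-identityʳ b)

⊕-exchange : ∀ s t u → (s ⊕ t) ⊕ u ≡ (s ⊕ u) ⊕ t
⊕-exchange s t u = trans (⊕-assoc s t u) (trans (cong (s ⊕_) (⊕-comm t u)) (sym (⊕-assoc s u t)))

⊕-cancelˡ : ∀ s {t u} → s ⊕ t ≡ s ⊕ u → t ≡ u
⊕-cancelˡ (a , b) eq = cong₂ _,_ (∙-cancelˡ a _ _ (cong proj₁ eq)) (∙-cancelˡ b _ _ (cong proj₂ eq))

module Translation (L : ValidLattice) where

  open ValidLattice L

  ∈-0⃗ : 0⃗ ∈ L
  ∈-0⃗ = 0ℤ , 0ℤ , refl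

  ∈-⊕ : ∀ {v u} → v ∈ L → u ∈ L → v ⊕ u ∈ L
  ∈-⊕ (m , n , refl) (m′ , n′ , refl) = m ℤ.+ m′ , n ℤ.+ n′ , cong₂ _,_ (r m n m′ n′ _ _) (r m n m′ n′ _ _)
    where
    r : ∀ m n m′ n′ a c → (m ℤ.* a ℤ.+ n ℤ.* c) ℤ.+ (m′ ℤ.* a ℤ.+ n′ ℤ.* c) ≡ (m ℤ.+ m′) ℤ.* a ℤ.+ (n ℤ.+ n′) ℤ.* c
    r = solve-∀

  ∈-• : ∀ k {v} → v ∈ L → k • v ∈ L
  ∈-• k (m , n , refl) = k ℤ.* m , k ℤ.* n , cong₂ _,_ (r k m n _ _) (r k m n _ _)
    where
    r : ∀ k m n a c → k ℤ.* (m ℤ.* a ℤ.+ n ℤ.* c) ≡ (k ℤ.* m) ℤ.* a ℤ.+ (k ℤ.* n) ℤ.* c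
    r = solve-∀

  -- Both generators have coordinates of equal parity. Hence translations preserve colours, and W is
  -- even.
  ∈-even : ∀ {v} → v ∈ L → oddℤ (proj₁ v) ≡ oddℤ (proj₂ v)
  ∈-even (m , n , refl)
    rewrite oddℤ-+ (m ℤ.* proj₁ g) (n ℤ.* proj₁ h) | oddℤ-+ (m ℤ.* proj₂ g) (n ℤ.* proj₂ h)
          | oddℤ-* m (proj₁ g) | oddℤ-* n (proj₁ h) | oddℤ-* m (proj₂ g) | oddℤ-* n (proj₂ h)
          | sameParity g parity-g | sameParity h parity-h = refl

  infix 4 _≈_
  -- A record in place of the bare existential, so that s and t can be inferred from the type.
  record _≈_ (s t : Square) : Set where
    constructor translate
    field untranslate : _≈ₛ_ {L} s t

  open _≈_ public

  ≈-refl : ∀ {s} → s ≈ s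
  ≈-refl {s} = translate (0⃗ , ∈-0⃗ , sym (⊕-identityʳ s))

  ≈-reflexive : ∀ {s t} → s ≡ t → s ≈ t
  ≈-reflexive refl = ≈-refl

  ≈-sym : ∀ {s t} → s ≈ t → t ≈ s
  ≈-sym {a , b} (translate ((x , y) , v∈L , refl)) = translate (-1ℤ • (x , y) , ∈-• -1ℤ v∈L , cong₂ _,_ (r a x) (r b y))
    where
    r : ∀ a x → a ≡ (a ℤ.+ x) ℤ.+ -1ℤ ℤ.* x
    r = solve-∀

  ≈-trans : ∀ {s t u} → s ≈ t → t ≈ u → s ≈ u
  ≈-trans {s} (translate (v , v∈L , refl)) (translate (v′ , v′∈L , refl)) = translate (v ⊕ v′ , ∈-⊕ v∈L v′∈L , ⊕-assoc s v v′)

  ≈-⊕ : ∀ {s t} u → s ≈ t → s ⊕ u ≈ t ⊕ u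
  ≈-⊕ {s} u (translate (v , v∈L , refl)) = translate (v , v∈L , ⊕-exchange s v u)

  ≈-isBlack : ∀ {s t} → s ≈ t → isBlack s ≡ isBlack t
  ≈-isBlack {i , j} (translate ((x , y) , v∈L , refl))
    rewrite oddℤ-+ i x | oddℤ-+ j y | ∈-even v∈L =
    tautology 3 (λ a b c → not (a ∔ b)) (λ a b c → not ((a ∔ c) ∔ (b ∔ c))) (oddℤ i) (oddℤ j) (oddℤ y)

  ∼⇒ : ∀ e {o′ s′} → _∼_ {L} e (domino o′ s′) → orientation e ≡ o′ × first e ≈ s′
  ∼⇒ _ (v , v∈L , refl) = refl , translate (v , v∈L , refl)

  ∼⇐ : ∀ {o s s′} → s ≈ s′ → _∼_ {L} (domino o s) (domino o s′)
  ∼⇐ (translate (v , v∈L , refl)) = v , v∈L , refl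

  ∼-refl : ∀ e → _∼_ {L} e e
  ∼-refl _ = ∼⇐ ≈-refl

  ∼-sym : ∀ e f → _∼_ {L} e f → _∼_ {L} f e
  ∼-sym e (domino _ _) p with refl , s≈ ← ∼⇒ e p = ∼⇐ (≈-sym s≈)

  ∼-trans : ∀ e f g → _∼_ {L} e f → _∼_ {L} f g → _∼_ {L} e g
  ∼-trans e f@(domino _ _) (domino _ _) p q with refl , s≈ ← ∼⇒ e p | refl , s≈′ ← ∼⇒ f q = ∼⇐ (≈-trans s≈ s≈′)

  Crosses : List Step → Edge → Set
  Crosses u e = Any (λ σ → _∼_ {L} e (crossed σ)) u

  crosses-split : ∀ {u} e → Crosses u e → CrossesBlackLeft {L} u e ⊎ CrossesBlackRight {L} u e
  crosses-split {σ ∷ u} e (here p) with black? (leftSquare σ)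
  ... | yes bl = inj₁ (here (p , bl))
  ... | no  wh = inj₂ (here (p , wh))
  crosses-split e (there p) with crosses-split e p
  ... | inj₁ q = inj₁ (there q)
  ... | inj₂ q = inj₂ (there q)

  exponent-crosses : ∀ {u} e → Crosses u e → oddℤ (exponent {L} u e) ≡ true
  exponent-crosses {u} e p with crossesBlackLeft? {L} u e | crossesBlackRight? {L} u e
  ... | yes _ | _     = refl
  ... | no  _ | yes _ = refl
  ... | no ¬l | no ¬r with crosses-split e p
  ...   | inj₁ l = contradiction l ¬l
  ...   | inj₂ r = contradiction r ¬r

  exponent-¬crosses : ∀ {u} e → ¬ Crosses u e → oddℤ (exponent {L} u e) ≡ false
  exponent-¬crosses {u} e ¬p with crossesBlackLeft? {L} u e | crossesBlackRight? {L} u e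
  ... | yes l | _     = contradiction (Any.map proj₁ l) ¬p
  ... | no  _ | yes r = contradiction (Any.map proj₁ r) ¬p
  ... | no  _ | no  _ = refl

  -- The exponents 1 and -1 are both odd, so modulo 2 an exponent records just whether the orbit
  -- crosses the path.
  exponent-parity : ∀ {u} e b → (b ≡ true → Crosses u e) → (Crosses u e → b ≡ true) → oddℤ (exponent {L} u e) ≡ b
  exponent-parity e true  to _    = exponent-crosses e (to refl)
  exponent-parity e false _  from = exponent-¬crosses e λ cr → case from cr of λ ()

-- The determinant as a list of permutations with chosen summands.

T⇐true : ∀ {b} → b ≡ true → T b
T⇐true refl = _

cell : Cell → Square
cell (c , r) = + c , + r

isVertical : Orientation → Bool
isVertical horizontal = false
isVertical vertical   = true

lookup-injective : ∀ {A : Set} {xs : List A} → Unique xs → ∀ {i j} → lookup xs i ≡ lookup xs j → i ≡ j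
lookup-injective (px ∷ u) {zero}  {zero}  eq = refl
lookup-injective (px ∷ u) {zero}  {suc j} eq = contradiction eq (All.lookup px (∈-lookup j))
lookup-injective (px ∷ u) {suc i} {zero}  eq = contradiction (sym eq) (All.lookup px (∈-lookup i))
lookup-injective (px ∷ u) {suc i} {suc j} eq = cong suc (lookup-injective u eq)

signℤ : Bool → ℤ
signℤ b = if b then -1ℤ else 1ℤ

signℤ-∔ : ∀ a b → signℤ (a ∔ b) ≡ signℤ a ℤ.* signℤ b
signℤ-∔ true  true  = refl
signℤ-∔ true  false = refl
signℤ-∔ false true  = refl
signℤ-∔ false false = refl

concatFin : ∀ {A : Set} {n} → (Fin n → List A) → List A
concatFin = Vector.foldr _++_ []

module _ {A : Set} where

  map-concatFin : ∀ {B : Set} {n} (g : A → B) {f : Fin n → List A} {h : Fin n → List B} →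
                  (∀ j → h j ≡ map g (f j)) → concatFin h ≡ map g (concatFin f)
  map-concatFin {n = zero}  g h≗f = refl
  map-concatFin {n = suc n} g {f} {h} h≗f = trans (cong₂ _++_ (h≗f zero) (map-concatFin g (h≗f ∘ suc)))
    (sym (List.map-++ g (f zero) (concatFin (f ∘ suc))))

  ∈-concatFin⁺ : ∀ {n} (f : Fin n → List A) j {x} → x ∈ˡ f j → x ∈ˡ concatFin f
  ∈-concatFin⁺ f zero    x∈ = ∈-++⁺ˡ x∈
  ∈-concatFin⁺ f (suc j) x∈ = ∈-++⁺ʳ (f zero) (∈-concatFin⁺ (f ∘ suc) j x∈)

  ∈-concatFin⁻ : ∀ {n} (f : Fin n → List A) {x} → x ∈ˡ concatFin f → ∃ λ j → x ∈ˡ f j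
  ∈-concatFin⁻ {suc n} f x∈ with ∈-++⁻ (f zero) x∈
  ... | inj₁ x∈0 = zero , x∈0
  ... | inj₂ x∈s with j , x∈j ← ∈-concatFin⁻ (f ∘ suc) x∈s = suc j , x∈j

  concatFin-unique : ∀ {n} (f : Fin n → List A) → (∀ j → Unique (f j)) →
                     (∀ {j k x} → x ∈ˡ f j → x ∈ˡ f k → j ≡ k) → Unique (concatFin f)
  concatFin-unique {zero}  f uniq disj = []
  concatFin-unique {suc n} f uniq disj = Unique.++⁺ (uniq zero)
    (concatFin-unique (f ∘ suc) (uniq ∘ suc) (λ p q → Fin.suc-injective (disj p q)))
    λ (x∈0 , x∈s) → case disj x∈0 (proj₂ (∈-concatFin⁻ (f ∘ suc) x∈s)) of λ ()

  map-cartesianProductWith : ∀ {B C D E F : Set} (g : C → F) (h : D → E → F) (k : A → D) (l : B → E) (f : A → B → C) →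
    (∀ x y → g (f x y) ≡ h (k x) (l y)) → ∀ xs ys →
    map g (cartesianProductWith f xs ys) ≡ cartesianProductWith h (map k xs) (map l ys)
  map-cartesianProductWith g h k l f eq []       ys = refl
  map-cartesianProductWith g h k l f eq (x ∷ xs) ys = trans (List.map-++ g (map (f x) ys) _)
    (cong₂ _++_ (trans (sym (List.map-∘ ys)) (trans (List.map-cong (eq x) ys) (List.map-∘ ys)))
      (map-cartesianProductWith g h k l f eq xs ys))

module _ {A : Set} where

  -- A term of the expansion of a determinant whose entry (i , j) is a sum over
  -- the list E i j: a permutation and, for each row, a summand of the chosen entry.
  Choice : ℕ → Set
  Choice n = Lehmer n × Vec A n

  extend : ∀ {n} → Fin (suc n) → A → Choice n → Choice (suc n)
  extend j e (π , es) = j ∷ π , e ∷ es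

  minor : ∀ {n} → (Fin (suc n) → Fin (suc n) → List A) → Fin (suc n) → Fin n → Fin n → List A
  minor E j i k = E (suc i) (punchIn j k)

  choices : ∀ {n} → (Fin n → Fin n → List A) → List (Choice n)
  choices {zero}  E = ([] , []) ∷ []
  choices {suc n} E = concatFin λ j → cartesianProductWith (extend j) (E zero j) (choices (minor E j))

  IsChoice : ∀ {n} → (Fin n → Fin n → List A) → Choice n → Set
  IsChoice E (π , es) = ∀ i → Vec.lookup es i ∈ˡ E i (act π i)

  ∈-choices⁺ : ∀ {n} (E : Fin n → Fin n → List A) {z} → IsChoice E z → z ∈ˡ choices E
  ∈-choices⁺ {zero}  E {[] , []}         _  = here refl
  ∈-choices⁺ {suc n} E {j ∷ π , e ∷ es} ok =
    ∈-concatFin⁺ (λ j → cartesianProductWith (extend j) (E zero j) (choices (minor E j))) j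
      (∈-cartesianProductWith⁺ (extend j) (ok zero) (∈-choices⁺ (minor E j) (ok ∘ suc)))

  ∈-choices⁻ : ∀ {n} (E : Fin n → Fin n → List A) {z} → z ∈ˡ choices E → IsChoice E z
  ∈-choices⁻ {suc n} E z∈ i
    with j , z∈j ← ∈-concatFin⁻ (λ j → cartesianProductWith (extend j) (E zero j) (choices (minor E j))) z∈
    with e , (π , es) , e∈ , z′∈ , refl ← ∈-cartesianProductWith⁻ (extend j) (E zero j) (choices (minor E j)) z∈j
    with i
  ... | zero   = e∈
  ... | suc i′ = ∈-choices⁻ (minor E j) z′∈ i′

  choices-unique : ∀ {n} (E : Fin n → Fin n → List A) → (∀ i j → Unique (E i j)) → Unique (choices E)
  choices-unique {zero}  E uniq = [] ∷ []
  choices-unique {suc n} E uniq = concatFin-unique _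
    (λ j → Unique.cartesianProductWith⁺ (extend j) (λ { refl → refl , refl }) (uniq zero j)
             (choices-unique (minor E j) λ i k → uniq (suc i) (punchIn j k)))
    λ {j} {k} p q → heads (∈-cartesianProductWith⁻ (extend j) (E zero j) (choices (minor E j)) p)
                          (∈-cartesianProductWith⁻ (extend k) (E zero k) (choices (minor E k)) q)
    where
    heads : ∀ {j k z} →
      (∃ λ e → ∃ λ z′ → e ∈ˡ E zero j × z′ ∈ˡ choices (minor E j) × z ≡ extend j e z′) →
      (∃ λ e → ∃ λ z′ → e ∈ˡ E zero k × z′ ∈ˡ choices (minor E k) × z ≡ extend k e z′) → j ≡ k
    heads (_ , _ , _ , _ , refl) (_ , _ , _ , _ , refl) = refl

  module Expansion (m : A → Monomial) where

    open RawRing laurentRawRing using () renaming (-_ to -ᴸ_; 1# to 1ᴸ)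
    open RawSemiringDefinitions (RawRing.rawSemiring laurentRawRing) using () renaming (_^_ to _^ᴸ_)

    signPower : ℕ → Monomial
    signPower zero    = monomial 1ℤ 0ℤ 0ℤ
    signPower (suc k) = monomial -1ℤ 0ℤ 0ℤ *ᵐ signPower k

    signPower-^ : ∀ k → (-ᴸ 1ᴸ) ^ᴸ k ≡ signPower k ∷ []
    signPower-^ zero    = refl
    signPower-^ (suc k) rewrite signPower-^ k = refl

    term : ∀ {n} → Choice n → Monomial
    term ([]    , [])     = monomial 1ℤ 0ℤ 0ℤ
    term (j ∷ π , e ∷ es) = signPower (toℕ j) *ᵐ (m e *ᵐ term (π , es))

    -- An equality of lists and not only of coefficients: products of uncollected sums are cartesian
    -- products, taken in the order of `choices`. Thus the number of monomials is the number of
    -- choices.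
    det-choices : ∀ {n} (M : Fin n → Fin n → Laurent) (E : Fin n → Fin n → List A) →
      (∀ i j → M i j ≡ map m (E i j)) → det laurentRawRing M ≡ map term (choices E)
    det-choices {zero}  M E M≗E = refl
    det-choices {suc n} M E M≗E = map-concatFin term λ j → begin
      cartesianProductWith _*ᵐ_ ((-ᴸ 1ᴸ) ^ᴸ toℕ j) (cartesianProductWith _*ᵐ_ (M zero j) (det laurentRawRing λ i k → M (suc i) (punchIn j k)))
        ≡⟨ cong₂ (cartesianProductWith _*ᵐ_) (signPower-^ (toℕ j))
             (cong₂ (cartesianProductWith _*ᵐ_) (M≗E zero j)
               (det-choices (λ i k → M (suc i) (punchIn j k)) (minor E j) λ i k → M≗E (suc i) (punchIn j k))) ⟩
      map (signPower (toℕ j) *ᵐ_) (cartesianProductWith _*ᵐ_ (map m (E zero j)) (map term (choices (minor E j)))) ++ []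
        ≡⟨ List.++-identityʳ _ ⟩
      map (signPower (toℕ j) *ᵐ_) (cartesianProductWith _*ᵐ_ (map m (E zero j)) (map term (choices (minor E j))))
        ≡⟨ cong (map (signPower (toℕ j) *ᵐ_))
             (map-cartesianProductWith (λ z → z) _*ᵐ_ m term (λ e z → m e *ᵐ term z) (λ _ _ → refl) (E zero j) (choices (minor E j))) ⟨
      map (signPower (toℕ j) *ᵐ_) (map (λ z → z) (cartesianProductWith (λ e z → m e *ᵐ term z) (E zero j) (choices (minor E j))))
        ≡⟨ cong (map (signPower (toℕ j) *ᵐ_)) (List.map-id _) ⟩
      map (signPower (toℕ j) *ᵐ_) (cartesianProductWith (λ e z → m e *ᵐ term z) (E zero j) (choices (minor E j)))
        ≡⟨ product-term j (E zero j) (choices (minor E j)) ⟨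
      map term (cartesianProductWith (extend j) (E zero j) (choices (minor E j))) ∎
      where
      open ≡-Reasoning
      product-term : ∀ {n} (j : Fin (suc n)) xs ys → map term (cartesianProductWith (extend j) xs ys)
        ≡ map (signPower (toℕ j) *ᵐ_) (cartesianProductWith (λ e z → m e *ᵐ term z) xs ys)
      product-term j []       ys = refl
      product-term j (x ∷ xs) ys = trans (List.map-++ term (map (extend j x) ys) _)
        (trans (cong₂ _++_ (trans (sym (List.map-∘ ys)) (List.map-∘ ys)) (product-term j xs ys))
               (sym (List.map-++ (signPower (toℕ j) *ᵐ_) (map (λ z → m x *ᵐ term z) ys) _)))

    signPower-coeff : ∀ k → coeff (signPower k) ≡ signℤ (odd k)
    signPower-coeff zero    = refl
    signPower-coeff (suc k) = trans (cong (-1ℤ ℤ.*_) (signPower-coeff k)) (sym (signℤ-∔ true (odd k)))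

    signPower-deg : ∀ k → deg₀ (signPower k) ≡ 0ℤ × deg₁ (signPower k) ≡ 0ℤ
    signPower-deg zero    = refl , refl
    signPower-deg (suc k) rewrite proj₁ (signPower-deg k) | proj₂ (signPower-deg k) = refl , refl

    term-coeff : (ε : A → Bool) → (∀ e → coeff (m e) ≡ signℤ (ε e)) → ∀ {n} (π : Lehmer n) es →
      coeff (term (π , es)) ≡ signℤ (codeParity π ∔ ∑[ i < n ] ε (Vec.lookup es i))
    term-coeff ε m≗ε []      []       = refl
    term-coeff ε m≗ε {suc n} (j ∷ π) (e ∷ es) = begin
      coeff (signPower (toℕ j)) ℤ.* (coeff (m e) ℤ.* coeff (term (π , es)))
        ≡⟨ cong₂ ℤ._*_ (signPower-coeff (toℕ j)) (cong₂ ℤ._*_ (m≗ε e) (term-coeff ε m≗ε π es)) ⟩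
      signℤ (odd (toℕ j)) ℤ.* (signℤ (ε e) ℤ.* signℤ (codeParity π ∔ rest))
        ≡⟨ cong (signℤ (odd (toℕ j)) ℤ.*_) (signℤ-∔ (ε e) (codeParity π ∔ rest)) ⟨
      signℤ (odd (toℕ j)) ℤ.* signℤ (ε e ∔ (codeParity π ∔ rest))
        ≡⟨ signℤ-∔ (odd (toℕ j)) (ε e ∔ (codeParity π ∔ rest)) ⟨
      signℤ (odd (toℕ j) ∔ (ε e ∔ (codeParity π ∔ rest)))
        ≡⟨ cong signℤ (tautology 4 (λ o e c r → o ∔ (e ∔ (c ∔ r))) (λ o e c r → o ∔ c ∔ (e ∔ r))
             (odd (toℕ j)) (ε e) (codeParity π) rest) ⟩
      _ ∎
      where
      open ≡-Reasoning
      rest = ∑[ i < n ] ε (Vec.lookup es i)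

    term-deg₀ : ∀ {n} (π : Lehmer n) es → oddℤ (deg₀ (term (π , es))) ≡ ∑[ i < n ] oddℤ (deg₀ (m (Vec.lookup es i)))
    term-deg₀ []      []       = refl
    term-deg₀ (j ∷ π) (e ∷ es) rewrite proj₁ (signPower-deg (toℕ j))
      | ℤ.+-identityˡ (deg₀ (m e) ℤ.+ deg₀ (term (π , es))) =
      trans (oddℤ-+ (deg₀ (m e)) _) (cong (oddℤ (deg₀ (m e)) ∔_) (term-deg₀ π es))

    term-deg₁ : ∀ {n} (π : Lehmer n) es → oddℤ (deg₁ (term (π , es))) ≡ ∑[ i < n ] oddℤ (deg₁ (m (Vec.lookup es i)))
    term-deg₁ []      []       = refl
    term-deg₁ (j ∷ π) (e ∷ es) rewrite proj₂ (signPower-deg (toℕ j))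
      | ℤ.+-identityˡ (deg₁ (m e) ℤ.+ deg₁ (term (π , es))) =
      trans (oddℤ-+ (deg₁ (m e)) _) (cong (oddℤ (deg₁ (m e)) ∔_) (term-deg₁ π es))

-- Evaluation at 1 and -1.

open RawSemiringDefinitions ℚ.+-*-rawSemiring using (_^_)

signℚ : Bool → ℚ
signℚ b = if b then ℚ.- 1ℚ else 1ℚ

halfSign : Bool → ℚ
halfSign b = if b then ℚ.- ½ else ½

halfSign-½ : ∀ b → halfSign b ≡ ½ ⊎ halfSign b ≡ ℚ.- ½
halfSign-½ false = inj₁ refl
halfSign-½ true  = inj₂ refl

1^ : ∀ n → 1ℚ ^ n ≡ 1ℚ
1^ zero    = refl
1^ (suc n) = trans (ℚ.*-identityˡ _) (1^ n)

-1^ : ∀ n → (ℚ.- 1ℚ) ^ n ≡ signℚ (odd n)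
-1^ zero    = refl
-1^ (suc n) = trans (cong (ℚ.- 1ℚ ℚ.*_) (-1^ n)) (negate (odd n))
  where
  negate : ∀ b → ℚ.- 1ℚ ℚ.* signℚ b ≡ signℚ (not b)
  negate true  = refl
  negate false = refl

1^ᶻ : ∀ i → 1ℚ ^ᶻ i ≡ 1ℚ
1^ᶻ (+ n)    = 1^ n
1^ᶻ -[1+ n ] = 1^ (suc n)

-1^ᶻ : ∀ i → (ℚ.- 1ℚ) ^ᶻ i ≡ signℚ (oddℤ i)
-1^ᶻ (+ n)    = -1^ n
-1^ᶻ -[1+ n ] = -1^ (suc n)

-- ½ (-1)^(ε + c + xy + x + cy), where x and y tell whether q₀ and q₁ are -1.
spin₀₀ spin₀₁ spin₁₀ spin₁₁ : (ε c : Bool) → ℚ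
spin₀₀ ε c = halfSign (ε ∔ c)
spin₀₁ ε c = halfSign ε
spin₁₀ ε c = halfSign (not (ε ∔ c))
spin₁₁ ε c = halfSign ε

spinSum : (ε c : Bool) → Laurent → ℚ
spinSum ε c p = spin₀₀ ε c ℚ.* evaluate p 1ℚ 1ℚ ℚ.+ spin₀₁ ε c ℚ.* evaluate p 1ℚ (ℚ.- 1ℚ)
          ℚ.+ spin₁₀ ε c ℚ.* evaluate p (ℚ.- 1ℚ) 1ℚ ℚ.+ spin₁₁ ε c ℚ.* evaluate p (ℚ.- 1ℚ) (ℚ.- 1ℚ)

KasteleynSigned : (ε c : Bool) → Monomial → Set
KasteleynSigned ε c t = coeff t ≡ signℤ (ε ∔ (a₀ · a₁ ∔ a₁ ∔ a₀ · c))
  where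
  a₀ = oddℤ (deg₀ t)
  a₁ = oddℤ (deg₁ t)

-- Every monomial with the prescribed sign contributes exactly 1 to the signed sum of the four
-- evaluations, so the sum counts monomials.
spinSum-length : ∀ ε c p → All (KasteleynSigned ε c) p → (+ length p) ℚ./ 1 ≡ spinSum ε c p
spinSum-length ε c []      []       = sym (base ε c)
  where
  base : ∀ ε c → spinSum ε c [] ≡ 0ℚ
  base true  true  = refl
  base true  false = refl
  base false true  = refl
  base false false = refl
spinSum-length ε c (t ∷ p) (ok ∷ oks) = begin
  (+ suc (length p)) ℚ./ 1
    ≡⟨ suc-/1 (length p) ⟩
  1ℚ ℚ.+ (+ length p) ℚ./ 1
    ≡⟨ cong₂ ℚ._+_ (sym summand) (spinSum-length ε c p oks) ⟩
  (spin₀₀ ε c ℚ.* v₀₀ ℚ.+ spin₀₁ ε c ℚ.* v₀₁ ℚ.+ spin₁₀ ε c ℚ.* v₁₀ ℚ.+ spin₁₁ ε c ℚ.* v₁₁) ℚ.+ spinSum ε c p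
    ≡⟨ solve 12 (λ s t u v a b c d e f g h →
         (s :* a :+ t :* b :+ u :* c :+ v :* d) :+ (s :* e :+ t :* f :+ u :* g :+ v :* h)
         := s :* (a :+ e) :+ t :* (b :+ f) :+ u :* (c :+ g) :+ v :* (d :+ h)) refl
         (spin₀₀ ε c) (spin₀₁ ε c) (spin₁₀ ε c) (spin₁₁ ε c) v₀₀ v₀₁ v₁₀ v₁₁
         (evaluate p 1ℚ 1ℚ) (evaluate p 1ℚ (ℚ.- 1ℚ)) (evaluate p (ℚ.- 1ℚ) 1ℚ) (evaluate p (ℚ.- 1ℚ) (ℚ.- 1ℚ)) ⟩
  spinSum ε c (t ∷ p) ∎
  where
  open ≡-Reasoning
  open +-*-Solver
  k = coeff t ℚ./ 1
  v₀₀ = k ℚ.* (1ℚ ^ᶻ deg₀ t) ℚ.* (1ℚ ^ᶻ deg₁ t)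
  v₀₁ = k ℚ.* (1ℚ ^ᶻ deg₀ t) ℚ.* ((ℚ.- 1ℚ) ^ᶻ deg₁ t)
  v₁₀ = k ℚ.* ((ℚ.- 1ℚ) ^ᶻ deg₀ t) ℚ.* (1ℚ ^ᶻ deg₁ t)
  v₁₁ = k ℚ.* ((ℚ.- 1ℚ) ^ᶻ deg₀ t) ℚ.* ((ℚ.- 1ℚ) ^ᶻ deg₁ t)
  suc-/1 : ∀ n → (+ suc n) ℚ./ 1 ≡ 1ℚ ℚ.+ (+ n) ℚ./ 1
  suc-/1 n = sym (trans (cong (λ t → 1ℚ ℚ.+ t) (ℚ.↥p/↧p≡p integer))
    (cong (ℚ._/ 1) (cong (λ t → 1ℤ ℤ.+ t) (ℤ.*-identityʳ (+ n)))))
    where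
    integer : ℚ
    -- The normal form of n / 1, on which rational addition computes even for a variable n.
    integer = mkℚ (+ n) 0 (Coprime.sym (Coprime.1-coprimeTo n))
  -- ½ Σ (-1)^(xy + xα + yβ) = (-1)^(αβ) with α = a₀ + 1 and β = a₁ + c.
  gauss : ∀ ε c a₀ a₁ → let k = signℤ (ε ∔ (a₀ · a₁ ∔ a₁ ∔ a₀ · c)) ℚ./ 1 in
    spin₀₀ ε c ℚ.* (k ℚ.* 1ℚ ℚ.* 1ℚ) ℚ.+ spin₀₁ ε c ℚ.* (k ℚ.* 1ℚ ℚ.* signℚ a₁)
    ℚ.+ spin₁₀ ε c ℚ.* (k ℚ.* signℚ a₀ ℚ.* 1ℚ) ℚ.+ spin₁₁ ε c ℚ.* (k ℚ.* signℚ a₀ ℚ.* signℚ a₁) ≡ 1ℚ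
  gauss true  true  true  true  = refl
  gauss true  true  true  false = refl
  gauss true  true  false true  = refl
  gauss true  true  false false = refl
  gauss true  false true  true  = refl
  gauss true  false true  false = refl
  gauss true  false false true  = refl
  gauss true  false false false = refl
  gauss false true  true  true  = refl
  gauss false true  true  false = refl
  gauss false true  false true  = refl
  gauss false true  false false = refl
  gauss false false true  true  = refl
  gauss false false true  false = refl
  gauss false false false true  = refl
  gauss false false false false = refl
  summand : spin₀₀ ε c ℚ.* v₀₀ ℚ.+ spin₀₁ ε c ℚ.* v₀₁ ℚ.+ spin₁₀ ε c ℚ.* v₁₀ ℚ.+ spin₁₁ ε c ℚ.* v₁₁ ≡ 1ℚ
  summand rewrite ok | 1^ᶻ (deg₀ t) | 1^ᶻ (deg₁ t) | -1^ᶻ (deg₀ t) | -1^ᶻ (deg₁ t) =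
    gauss ε c (oddℤ (deg₀ t)) (oddℤ (deg₁ t))

-- Dominoes through their black and white ends, and periodic tilings.

T-ext : ∀ {a b} → (T a → T b) → (T b → T a) → a ≡ b
T-ext {true}  {true}  _ _ = refl
T-ext {true}  {false} f _ with () ← f _
T-ext {false} {true}  _ g with () ← g _
T-ext {false} {false} _ _ = refl

_≟ᵈ_ : DecidableEquality Domino
domino o s ≟ᵈ domino o′ s′ = map′ (λ { (refl , refl) → refl }) (λ { refl → refl , refl })
  ((o ≟ᵒ o′) ×-dec Product.≡-dec ℤ._≟_ ℤ._≟_ s s′)

blackEnd whiteEnd : Domino → Square
blackEnd d = if isBlack (first d) then first d else second d
whiteEnd d = if isBlack (first d) then second d else first d

second-colour : ∀ d → isBlack (second d) ≡ not (isBlack (first d))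
second-colour (domino o s) = isBlack-unit o s

blackEnd-black : ∀ d → isBlack (blackEnd d) ≡ true
blackEnd-black d with isBlack (first d) in eq
... | true  = eq
... | false = trans (second-colour d) (cong not eq)

whiteEnd-white : ∀ d → isBlack (whiteEnd d) ≡ false
whiteEnd-white d with isBlack (first d) in eq
... | true  = trans (second-colour d) (cong not eq)
... | false = eq

blackEnd-∈ : ∀ d → blackEnd d ∈ᵈ d
blackEnd-∈ d with isBlack (first d)
... | true  = inj₁ refl
... | false = inj₂ refl

whiteEnd-∈ : ∀ d → whiteEnd d ∈ᵈ d
whiteEnd-∈ d with isBlack (first d)
... | true  = inj₂ refl
... | false = inj₁ refl

black-∈ : ∀ {s} d → isBlack s ≡ true → s ∈ᵈ d → s ≡ blackEnd d
black-∈ d black (inj₁ refl) rewrite black = refl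
black-∈ d black (inj₂ refl) with isBlack (first d) | second-colour d
... | true  | eq = case trans (sym black) eq of λ ()
... | false | _  = refl

white-∈ : ∀ {s} d → isBlack s ≡ false → s ∈ᵈ d → s ≡ whiteEnd d
white-∈ d white (inj₁ refl) rewrite white = refl
white-∈ d white (inj₂ refl) with isBlack (first d) | second-colour d
... | true  | _  = refl
... | false | eq = case trans (sym white) eq of λ ()

∈-shift : ∀ {s} v d → s ∈ᵈ d → s ⊕ v ∈ᵈ shift v d
∈-shift v d                (inj₁ refl) = inj₁ refl
∈-shift v d@(domino o s)   (inj₂ refl) = inj₂ (⊕-exchange s (unit o) v)

tiling-unique : ∀ (t : Tiling) {d d′ s} → T (contains t d) → T (contains t d′) → s ∈ᵈ d → s ∈ᵈ d′ → d ≡ d′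
tiling-unique t {d} {d′} {s} p p′ q q′ =
  decidable-stable (d ≟ᵈ d′) λ d≢d′ → Tiling.disjoint t d d′ p p′ d≢d′ (s , q , q′)

module Ends (L : ValidLattice) where

  open Translation L

  blackEnd-shift : ∀ {v} → v ∈ L → ∀ d → blackEnd d ⊕ v ≡ blackEnd (shift v d)
  blackEnd-shift {v} v∈L d = black-∈ (shift v d)
    (trans (sym (≈-isBlack {blackEnd d} (translate (v , v∈L , refl)))) (blackEnd-black d)) (∈-shift v d (blackEnd-∈ d))

  whiteEnd-shift : ∀ {v} → v ∈ L → ∀ d → whiteEnd d ⊕ v ≡ whiteEnd (shift v d)
  whiteEnd-shift {v} v∈L d = white-∈ (shift v d)
    (trans (sym (≈-isBlack {whiteEnd d} (translate (v , v∈L , refl)))) (whiteEnd-white d)) (∈-shift v d (whiteEnd-∈ d))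

  ∼-blackEnd : ∀ d d′ → _∼_ {L} d d′ → blackEnd d ≈ blackEnd d′
  ∼-blackEnd d d′ (v , v∈L , refl) = translate (v , v∈L , sym (blackEnd-shift v∈L d))

  ∼-whiteEnd : ∀ d d′ → _∼_ {L} d d′ → whiteEnd d ≈ whiteEnd d′
  ∼-whiteEnd d d′ (v , v∈L , refl) = translate (v , v∈L , sym (whiteEnd-shift v∈L d))

  -- The translation vector can be read off from the black end, so two translates of one edge that
  -- share it coincide.
  blackEnd-determines : ∀ e {d d′} → _∼_ {L} e d → _∼_ {L} e d′ → blackEnd d ≡ blackEnd d′ → d ≡ d′
  blackEnd-determines e (v , v∈L , refl) (v′ , v′∈L , refl) eq = cong (λ u → shift u e)
    (⊕-cancelˡ (blackEnd e) (trans (blackEnd-shift v∈L e) (trans eq (sym (blackEnd-shift v′∈L e)))))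

  whiteEnd-determines : ∀ e {d d′} → _∼_ {L} e d → _∼_ {L} e d′ → whiteEnd d ≡ whiteEnd d′ → d ≡ d′
  whiteEnd-determines e (v , v∈L , refl) (v′ , v′∈L , refl) eq = cong (λ u → shift u e)
    (⊕-cancelˡ (whiteEnd e) (trans (whiteEnd-shift v∈L e) (trans eq (sym (whiteEnd-shift v′∈L e)))))

  ∼-contains : ∀ {t} → Periodic L t → ∀ d d′ → _∼_ {L} d d′ → T (contains t d) → T (contains t d′)
  ∼-contains per d d′ (v , v∈L , refl) p = subst T (sym (per v v∈L d)) p

  -- Periodicity puts the translate of d by v into t. It covers s′, as d′ does, so disjointness
  -- identifies the two.
  tiling-orbit : ∀ {t} → Periodic L t → ∀ {s s′} d d′ → T (contains t d) → T (contains t d′) →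
                 s ∈ᵈ d → s′ ∈ᵈ d′ → s ≈ s′ → _∼_ {L} d d′
  tiling-orbit {t} per d d′ p p′ q q′ (translate (v , v∈L , refl)) =
    v , v∈L , tiling-unique t p′ (∼-contains {t} per d (shift v d) (v , v∈L , refl) p) q′ (∈-shift v d q)

  joins⇒ : ∀ {s s′} d → isBlack s ≡ true → JoinsTranslates {L} s s′ d → s ≈ blackEnd d × s′ ≈ whiteEnd d
  joins⇒ {s} d black (inj₁ (p , p′)) rewrite trans (sym (≈-isBlack {s} (translate p))) black = translate p , translate p′
  joins⇒ {s} d black (inj₂ (p , p′))
    with isBlack (first d) | trans (sym (second-colour d)) (trans (sym (≈-isBlack {s} (translate p))) black)
  ... | false | _ = translate p , translate p′

  joins⇐ : ∀ {s s′} d → s ≈ blackEnd d → s′ ≈ whiteEnd d → JoinsTranslates {L} s s′ d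
  joins⇐ d p p′ with isBlack (first d)
  ... | true  = inj₁ (untranslate p , untranslate p′)
  ... | false = inj₂ (untranslate p , untranslate p′)

-- Reduction of squares and edges to the fundamental rectangle.

module Reduction (L : ValidLattice) (W R′ x : ℕ)
  (0<W : 0 ℕ.< W) (v₀-∈ : (+ W , 0ℤ) ∈ L) (x₀-least : ∀ z → 0 ℕ.< z → (+ z , 0ℤ) ∈ L → W ℕ.≤ z)
  (v₁-∈ : (+ x , + suc R′) ∈ L) (y₁-least : ∀ y → 0 ℕ.< y → (∃ λ z → (z , + y) ∈ L) → suc R′ ℕ.≤ y)
  (x<W : x ℕ.< W)
  where

  open Translation L
  open Torus W R′ x

  basis : LatticeBasis L
  basis = record
    { x₀ = W ; y₁ = suc R′ ; x₁ = x
    ; x₀-positive = 0<W ; v₀-∈ = v₀-∈ ; x₀-least = x₀-least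
    ; y₁-positive = ℕ.z<s ; v₁-∈ = v₁-∈ ; y₁-least = y₁-least
    ; x₁<x₀ = x<W }

  W-even : odd W ≡ false
  W-even = ∈-even v₀-∈

  instance
    W-nonZero : ℕ.NonZero W
    W-nonZero = ℕ.>-nonZero 0<W

  abstract
    reduce-column : ∀ z y → ∃ λ c → c ℕ.< W × (z , y) ≈ (+ c , y)
    reduce-column z y = z ℤ.%ℕ W , ℤ.n%ℕd<d z W , ≈-sym
      (translate ((z ℤ./ℕ W) • (+ W , 0ℤ) , ∈-• (z ℤ./ℕ W) v₀-∈ , cong₂ _,_ (ℤ.a≡a%ℕn+[a/ℕn]*n z W) (r y (z ℤ./ℕ W))))
      where
      r : ∀ y k → y ≡ y ℤ.+ k ℤ.* 0ℤ
      r = solve-∀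

    -- A multiple of v₁ brings the row into range, then a multiple of v₀ the column. The row has to
    -- come first, since v₁ also moves columns.
    reduce : ∀ s → ∃ λ p → InRect p × s ≈ cell p
    reduce (z , y) = (proj₁ col , q) , (proj₁ (proj₂ col) , ℤ.n%ℕd<d y R) ,
      ≈-trans (≈-sym (translate ((y ℤ./ℕ R) • (+ x , + R) , ∈-• (y ℤ./ℕ R) v₁-∈ ,
        cong₂ _,_ (r z ((y ℤ./ℕ R) ℤ.* + x)) (ℤ.a≡a%ℕn+[a/ℕn]*n y R)))) (proj₂ (proj₂ col))
      where
      q : ℕ
      q = y ℤ.%ℕ R
      col : ∃ λ c → c ℕ.< W × (z ℤ.- (y ℤ./ℕ R) ℤ.* + x , + q) ≈ (+ c , + q)
      col = reduce-column (z ℤ.- (y ℤ./ℕ R) ℤ.* + x) (+ q)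
      r : ∀ a b → a ≡ (a ℤ.- b) ℤ.+ b
      r = solve-∀

  -- Otherwise L would contain a vector of height r′ - r, which is positive and less than R, against
  -- the minimality of y₁.
  row-≮ : ∀ {c c′ r r′} → r ℕ.< r′ → r′ ℕ.< R → ¬ cell (c , r) ≈ cell (c′ , r′)
  row-≮ {c} {c′} {r} {r′} r<r′ r′<R (translate ((a , b) , v∈L , eq)) = ℕ.<⇒≱ r′<R
    (ℕ.≤-trans (y₁-least (r′ ℕ.∸ r) (ℕ.m<n⇒0<n∸m r<r′) (a , subst (λ t → (a , t) ∈ L) b≡ v∈L)) (ℕ.m∸n≤m r′ r))
    where
    b≡ : b ≡ + (r′ ℕ.∸ r)
    b≡ = ∙-cancelˡ (+ r) b _ (trans (sym (cong proj₂ eq)) (cong +_ (sym (ℕ.m+[n∸m]≡n (ℕ.<⇒≤ r<r′)))))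

  column-≮ : ∀ {c c′ r} → c ℕ.< c′ → c′ ℕ.< W → ¬ cell (c , r) ≈ cell (c′ , r)
  column-≮ {c} {c′} {r} c<c′ c′<W (translate ((a , b) , v∈L , eq)) = ℕ.<⇒≱ c′<W
    (ℕ.≤-trans (x₀-least (c′ ℕ.∸ c) (ℕ.m<n⇒0<n∸m c<c′) (subst (_∈ L) v≡ v∈L)) (ℕ.m∸n≤m c′ c))
    where
    v≡ : (a , b) ≡ (+ (c′ ℕ.∸ c) , 0ℤ)
    v≡ = cong₂ _,_
      (∙-cancelˡ (+ c) a _ (trans (sym (cong proj₁ eq)) (cong +_ (sym (ℕ.m+[n∸m]≡n (ℕ.<⇒≤ c<c′))))))
      (∙-cancelˡ (+ r) b _ (trans (sym (cong proj₂ eq)) (sym (ℤ.+-identityʳ (+ r)))))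

  cell-unique : ∀ {p q} → InRect p → InRect q → cell p ≈ cell q → p ≡ q
  cell-unique {c , r} {c′ , r′} (c<W , r<R) (c′<W , r′<R) p≈q with ℕ.<-cmp r r′
  ... | tri< r<r′ _ _ = contradiction p≈q (row-≮ r<r′ r′<R)
  ... | tri> _ _ r>r′ = contradiction (≈-sym p≈q) (row-≮ r>r′ r<R)
  ... | tri≈ _ refl _ with ℕ.<-cmp c c′
  ...   | tri< c<c′ _ _ = contradiction p≈q (column-≮ c<c′ c′<W)
  ...   | tri> _ _ c>c′ = contradiction (≈-sym p≈q) (column-≮ c>c′ c<W)
  ...   | tri≈ _ refl _ = refl

  up-shift : ∀ z → (z , + R) ≈ (z ℤ.- + x , 0ℤ)
  up-shift z = ≈-sym (translate ((+ x , + R) , v₁-∈ , cong₂ _,_ (r z (+ x)) refl))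
    where
    r : ∀ a b → a ≡ (a ℤ.- b) ℤ.+ b
    r = solve-∀

  abstract
    -- Above the top row v₁ is subtracted. If c is less than x, one addition of v₀ suffices to
    -- return to the range of columns, because x is less than W.
    successor : ∀ o {p} → InRect p → ∃ λ q → InRect q × Next (isVertical o) p q × cell p ⊕ unit o ≈ cell q
    successor horizontal {c , r} (c<W , r<R) with ℕ.m≤n⇒m<n∨m≡n c<W
    ... | inj₁ 1+c<W = (suc c , r) , (1+c<W , r<R) , right 1+c<W ,
      ≈-reflexive (cong₂ _,_ (cong +_ (ℕ.+-comm c 1)) (ℤ.+-identityʳ (+ r)))
    ... | inj₂ 1+c≡W = (0 , r) , (0<W , r<R) , wrap 1+c≡W , ≈-sym (translate ((+ W , 0ℤ) , v₀-∈ ,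
      cong (_, + r ℤ.+ 0ℤ) (cong +_ (trans (ℕ.+-comm c 1) 1+c≡W))))
    successor vertical {c , r} (c<W , r<R) with ℕ.m≤n⇒m<n∨m≡n r<R
    ... | inj₁ 1+r<R = (c , suc r) , (c<W , 1+r<R) , up 1+r<R ,
      ≈-reflexive (cong₂ _,_ (ℤ.+-identityʳ (+ c)) (cong +_ (ℕ.+-comm r 1)))
    ... | inj₂ 1+r≡R with c ℕ.<? x
    ...   | yes c<x = (c′ , 0) , (c′<W , ℕ.z<s) , top-left 1+r≡R c<x (ℕ.m∸n+n≡m x≤) ,
      ≈-trans (≈-reflexive (cong₂ _,_ (ℤ.+-identityʳ (+ c)) (cong +_ (trans (ℕ.+-comm r 1) 1+r≡R))))
        (≈-trans (up-shift (+ c)) (translate ((+ W , 0ℤ) , v₀-∈ , cong (_, 0ℤ) eq)))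
      where
      x≤ : x ℕ.≤ c ℕ.+ W
      x≤ = ℕ.≤-trans (ℕ.<⇒≤ x<W) (ℕ.m≤n+m W c)
      c′ : ℕ
      c′ = c ℕ.+ W ℕ.∸ x
      c′<W : c′ ℕ.< W
      c′<W = ℕ.+-cancelʳ-< x c′ W (subst₂ ℕ._<_ (sym (ℕ.m∸n+n≡m x≤)) (ℕ.+-comm x W) (ℕ.+-monoˡ-< W c<x))
      r′ : ∀ a b w → (a ℤ.- b) ℤ.+ w ≡ (a ℤ.+ w) ℤ.- b
      r′ = solve-∀
      eq : + c′ ≡ (+ c ℤ.- + x) ℤ.+ + W
      eq = trans (sym (ℤ.⊖-≥ x≤)) (trans (sym (ℤ.m-n≡m⊖n (c ℕ.+ W) x)) (sym (r′ (+ c) (+ x) (+ W))))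
    ...   | no  c≮x = (c ℕ.∸ x , 0) , (ℕ.≤-<-trans (ℕ.m∸n≤m c x) c<W , ℕ.z<s) , top-right 1+r≡R x≤c (ℕ.m∸n+n≡m x≤c) ,
      ≈-trans (≈-reflexive (cong₂ _,_ (ℤ.+-identityʳ (+ c)) (cong +_ (trans (ℕ.+-comm r 1) 1+r≡R))))
        (≈-trans (up-shift (+ c)) (≈-reflexive (cong (_, 0ℤ) (trans (ℤ.m-n≡m⊖n c x) (ℤ.⊖-≥ x≤c)))))
      where
      x≤c : x ℕ.≤ c
      x≤c = ℕ.≮⇒≥ c≮x

  -- The path u(0) has height 0, so the edges it crosses start in row -1; this identifies that row
  -- with the top row.
  top-≈-below : ∀ z → (z , + R′) ≈ (z ℤ.- + x , -1ℤ)
  top-≈-below z = ≈-sym (translate ((+ x , + R) , v₁-∈ , cong₂ _,_ (r z (+ x)) refl))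
    where
    r : ∀ a b → a ≡ (a ℤ.- b) ℤ.+ b
    r = solve-∀

  u₀-crosses : ∀ {o s p} → InRect p → s ≈ cell p → isVertical o · isTop p ≡ true → Crosses (u₀ basis) (domino o s)
  u₀-crosses {vertical} {s} {c , r} _ s≈p top with refl ← ℕ.suc-injective (ℕ.≡ᵇ⇒≡ (suc r) R (T⇐true top)) =
    let z , z<W , eq = reduce-column (+ c ℤ.- + x) -1ℤ in
    Any.map⁺ (Any.applyUpTo⁺ id (∼⇐ (≈-trans s≈p (≈-trans (top-≈-below (+ c)) eq))) z<W)

  u₀-crosses⁻ : ∀ {o s p} → InRect p → s ≈ cell p → Crosses (u₀ basis) (domino o s) → isVertical o · isTop p ≡ true
  u₀-crosses⁻ {o} {s} {c , r} rect s≈p crosses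
    with i , i<W , e∼ ← Any.applyUpTo⁻ id (Any.map⁻ crosses)
    with refl , s≈ ← ∼⇒ (domino o s) e∼
    with z , z<W , eq ← reduce-column (+ i ℤ.+ + x) (+ R′)
    with refl ← cell-unique {q = z , R′} rect (z<W , ℕ.n<1+n R′)
           (≈-trans (≈-sym s≈p) (≈-trans s≈ (≈-trans (translate ((+ x , + R) , v₁-∈ , refl)) eq))) = ≡ᵇ-refl R′

  -- The vertical part of u(1) meets flat dominoes starting in column -1, which v₀ glues to column W
  -- - 1. Its horizontal part, at height R over the columns below x, meets the upright dominoes that
  -- leave the left end of the top row.
  u₁-crosses : ∀ {o s p} → InRect p → s ≈ cell p →
    isVertical o · leftTop p ∔ not (isVertical o) · isWrap p ≡ true → Crosses (u₁ basis) (domino o s)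
  u₁-crosses {horizontal} {s} {c , r} (_ , r<R) s≈p w with refl ← ℕ.≡ᵇ⇒≡ (suc c) W (T⇐true w) =
    Any.++⁺ˡ (Any.map⁺ (Any.applyUpTo⁺ id (∼⇐ (≈-trans s≈p (≈-sym (translate ((+ W , 0ℤ) , v₀-∈ , cong (+ c ,_) (sym (ℤ.+-identityʳ (+ r)))))))) r<R))
  u₁-crosses {vertical} {s} {c , r} _ s≈p lt
    with refl ← ℕ.suc-injective (ℕ.≡ᵇ⇒≡ (suc r) R (T-·ˡ _ (T⇐true (trans (sym (xor-identityʳ _)) lt)))) =
    Any.++⁺ʳ _ (Any.map⁺ (Any.applyUpTo⁺ id (∼⇐ s≈p)
      (ℕ.<ᵇ⇒< c x (T-·ʳ (isTop (c , r)) (T⇐true (trans (sym (xor-identityʳ _)) lt))))))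

  last-column : + ℕ.pred W ≡ -1ℤ ℤ.+ + W
  last-column = cong (λ t → -1ℤ ℤ.+ + t) (ℕ.suc-pred W)

  u₁-crosses⁻ : ∀ {o s p} → InRect p → s ≈ cell p → Crosses (u₁ basis) (domino o s) →
    isVertical o · leftTop p ∔ not (isVertical o) · isWrap p ≡ true
  u₁-crosses⁻ {o} {s} {c , r} rect s≈p crosses with Any.++⁻ (map (λ j → north (0ℤ , + j)) (upTo R)) crosses
  ... | inj₁ side
    with j , j<R , e∼ ← Any.applyUpTo⁻ id (Any.map⁻ side)
    with refl , s≈ ← ∼⇒ (domino o s) e∼
    with refl ← cell-unique {q = ℕ.pred W , j} rect (ℕ.≤-reflexive (ℕ.suc-pred W) , j<R)
           (≈-trans (≈-sym s≈p) (≈-trans s≈ (translate ((+ W , 0ℤ) , v₀-∈ , cong₂ _,_ last-column (sym (ℤ.+-identityʳ (+ j))))))) =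
    ≡ᵇ-true (ℕ.suc-pred W)
  ... | inj₂ top
    with i , i<x , e∼ ← Any.applyUpTo⁻ id (Any.map⁻ top)
    with refl , s≈ ← ∼⇒ (domino o s) e∼
    with refl ← cell-unique {q = i , R′} rect (ℕ.<-trans i<x x<W , ℕ.n<1+n R′) (≈-trans (≈-sym s≈p) s≈)
    rewrite ≡ᵇ-refl R′ | <ᵇ-true i<x = refl

  u₀-exponent : ∀ e {p} → InRect p → first e ≈ cell p →
    oddℤ (exponent {L} (u₀ basis) e) ≡ isVertical (orientation e) · isTop p
  u₀-exponent e@(domino o _) rect s≈p = exponent-parity e _ (u₀-crosses {o} rect s≈p) (u₀-crosses⁻ {o} rect s≈p)

  u₁-exponent : ∀ e {p} → InRect p → first e ≈ cell p →
    oddℤ (exponent {L} (u₁ basis) e) ≡ isVertical (orientation e) · leftTop p ∔ not (isVertical (orientation e)) · isWrap p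
  u₁-exponent e@(domino o _) rect s≈p = exponent-parity e _ (u₁-crosses {o} rect s≈p) (u₁-crosses⁻ {o} rect s≈p)

  abstract
    toCell : ∀ s → InRectangle basis s → ∃ λ p → InRect p × s ≡ cell p
    toCell (i , j) ((0≤i , i<W) , (0≤j , j<R)) = (∣ i ∣ , ∣ j ∣) ,
      (ℤ.drop‿+<+ (subst (ℤ._< + W) (sym i≡) i<W) , ℤ.drop‿+<+ (subst (ℤ._< + R) (sym j≡) j<R)) ,
      cong₂ _,_ (sym i≡) (sym j≡)
      where
      i≡ : + ∣ i ∣ ≡ i
      i≡ = ℤ.0≤i⇒+∣i∣≡i 0≤i
      j≡ : + ∣ j ∣ ≡ j
      j≡ = ℤ.0≤i⇒+∣i∣≡i 0≤j

  cell-inRectangle : ∀ {p} → InRect p → InRectangle basis (cell p)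
  cell-inRectangle (c<W , r<R) = (ℤ.+≤+ ℕ.z≤n , ℤ.+<+ c<W) , (ℤ.+≤+ ℕ.z≤n , ℤ.+<+ r<R)

  -- Tilings of the torus as terms of the determinant.

  module Counting {m}
    (blacks : Enumeration (λ s → InRectangle basis s × Black s) m)
    (whites : Enumeration (λ s → InRectangle basis s × White s) m)
    (orbits : ∀ i j → OrbitRepresentatives {L} (JoinsTranslates {L} (Enumeration.at blacks i) (Enumeration.at whites j)))
    where

    open Ends L

    b w : Fin m → Square
    b = Enumeration.at blacks
    w = Enumeration.at whites

    b-black : ∀ i → isBlack (b i) ≡ true
    b-black i = black⇒ (b i) (proj₂ (Enumeration.sound blacks i))

    w-white : ∀ j → isBlack (w j) ≡ false
    w-white j = white⇒ (w j) (proj₂ (Enumeration.sound whites j))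

    blackCell whiteCell : Fin m → Cell
    blackCell i = proj₁ (toCell (b i) (proj₁ (Enumeration.sound blacks i)))
    whiteCell j = proj₁ (toCell (w j) (proj₁ (Enumeration.sound whites j)))

    black-rect : ∀ i → InRect (blackCell i)
    black-rect i = proj₁ (proj₂ (toCell (b i) (proj₁ (Enumeration.sound blacks i))))

    white-rect : ∀ j → InRect (whiteCell j)
    white-rect j = proj₁ (proj₂ (toCell (w j) (proj₁ (Enumeration.sound whites j))))

    b≡ : ∀ i → b i ≡ cell (blackCell i)
    b≡ i = proj₂ (proj₂ (toCell (b i) (proj₁ (Enumeration.sound blacks i))))

    w≡ : ∀ j → w j ≡ cell (whiteCell j)
    w≡ j = proj₂ (proj₂ (toCell (w j) (proj₁ (Enumeration.sound whites j))))

    blackCell-injective : ∀ {i k} → blackCell i ≡ blackCell k → i ≡ k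
    blackCell-injective {i} {k} eq = Enumeration.injective blacks (trans (b≡ i) (trans (cong cell eq) (sym (b≡ k))))

    whiteCell-injective : ∀ {j l} → whiteCell j ≡ whiteCell l → j ≡ l
    whiteCell-injective {j} {l} eq = Enumeration.injective whites (trans (w≡ j) (trans (cong cell eq) (sym (w≡ l))))

    black≢white : ∀ i j → blackCell i ≢ whiteCell j
    black≢white i j eq = case trans (sym (b-black i))
      (trans (cong isBlack (trans (b≡ i) (trans (cong cell eq) (sym (w≡ j))))) (w-white j)) of λ ()

    b-unique : ∀ {i k} → b i ≈ b k → i ≡ k
    b-unique {i} {k} p = blackCell-injective (cell-unique (black-rect i) (black-rect k) (subst₂ _≈_ (b≡ i) (b≡ k) p))

    w-unique : ∀ {j l} → w j ≈ w l → j ≡ l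
    w-unique {j} {l} p = whiteCell-injective (cell-unique (white-rect j) (white-rect l) (subst₂ _≈_ (w≡ j) (w≡ l) p))

    black-cell : ∀ {p} → InRect p → isBlack (cell p) ≡ true → ∃ λ i → b i ≡ cell p
    black-cell {p} rect black = Enumeration.complete blacks (cell p) (cell-inRectangle rect , black⇐ (cell p) black)

    white-cell : ∀ {p} → InRect p → isBlack (cell p) ≡ false → ∃ λ j → w j ≡ cell p
    white-cell {p} rect white = Enumeration.complete whites (cell p)
      (cell-inRectangle rect , λ black → case trans (sym white) (black⇒ (cell p) black) of λ ())

    cell-injective : ∀ {p q} → cell p ≡ cell q → p ≡ q
    cell-injective eq = cong₂ _,_ (ℤ.+-injective (cong proj₁ eq)) (ℤ.+-injective (cong proj₂ eq))

    exhaustive : ∀ p → InRect p → (∃ λ i → blackCell i ≡ p) ⊎ (∃ λ j → whiteCell j ≡ p)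
    exhaustive p rect with isBlack (cell p) in eq
    ... | true  = let i , bi≡ = black-cell rect eq in inj₁ (i , cell-injective (trans (sym (b≡ i)) bi≡))
    ... | false = let j , wj≡ = white-cell rect eq in inj₂ (j , cell-injective (trans (sym (w≡ j)) wj≡))

    abstract
      locate-black : ∀ s → isBlack s ≡ true → ∃ λ i → b i ≈ s
      locate-black s black with p , rect , s≈ ← reduce s
        with i , bi≡ ← black-cell rect (trans (sym (≈-isBlack s≈)) black) =
        i , ≈-trans (≈-reflexive bi≡) (≈-sym s≈)

      locate-white : ∀ s → isBlack s ≡ false → ∃ λ j → w j ≈ s
      locate-white s white with p , rect , s≈ ← reduce s
        with j , wj≡ ← white-cell rect (trans (sym (≈-isBlack s≈)) white) =
        j , ≈-trans (≈-reflexive wj≡) (≈-sym s≈)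

    edges : Fin m → Fin m → List Edge
    edges i j = OrbitRepresentatives.edges (orbits i j)

    edges-ends : ∀ {i j e} → e ∈ˡ edges i j → b i ≈ blackEnd e × w j ≈ whiteEnd e
    edges-ends {i} {j} {e} e∈ = joins⇒ e (b-black i) (All.lookup (OrbitRepresentatives.sound (orbits i j)) e∈)

    edges-unique : ∀ i j → Unique (edges i j)
    edges-unique i j = AllPairs.map (λ { {e} ¬∼ refl → ¬∼ (∼-refl e) }) (OrbitRepresentatives.distinct (orbits i j))

    orbit-unique : ∀ {es : List Edge} → AllPairs (λ e e′ → ¬ (_∼_ {L} e e′)) es → ∀ {e e′} → e ∈ˡ es → e′ ∈ˡ es → _∼_ {L} e e′ → e ≡ e′
    orbit-unique (_  ∷ _)  (here refl) (here refl) _ = refl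
    orbit-unique (px ∷ _)  (here refl) (there q)   r = contradiction r (All.lookup px q)
    orbit-unique (px ∷ _)  (there p)   (here refl) r = contradiction (∼-sym _ _ r) (All.lookup px p)
    orbit-unique (_  ∷ ps) (there p)   (there q)   r = orbit-unique ps p q r

    ContainsAll : Tiling → Choice {Edge} m → Set
    ContainsAll t (π , es) = ∀ i → T (contains t (Vec.lookup es i))

    module TilingOfChoice (z : Choice {Edge} m) (ok : IsChoice edges z) where

      π = proj₁ z

      edge : Fin m → Edge
      edge i = Vec.lookup (proj₂ z) i

      black-end : ∀ i → b i ≈ blackEnd (edge i)
      black-end i = proj₁ (edges-ends (ok i))

      white-end : ∀ i → w (act π i) ≈ whiteEnd (edge i)
      white-end i = proj₂ (edges-ends (ok i))

      InOrbit : Domino → Set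
      InOrbit d = ∃ λ i → _∼_ {L} (edge i) d

      inOrbit? : ∀ d → Dec (InOrbit d)
      inOrbit? d = Fin.any? λ i → _∼?_ {L} (edge i) d

      -- A common black square identifies the two indices through `b-unique`, a common white one
      -- through the injectivity of π. Both dominoes are then translates of one edge with a common
      -- end.
      same-square : ∀ {d d′ s} → InOrbit d → InOrbit d′ → s ∈ᵈ d → s ∈ᵈ d′ → d ≡ d′
      same-square {d} {d′} {s} (i , p) (k , p′) q q′ with isBlack s in eq
      ... | true
        with same ← trans (sym (black-∈ d eq q)) (black-∈ d′ eq q′)
        with refl ← b-unique (≈-trans (≈-trans (black-end i) (∼-blackEnd _ d p))
               (≈-trans (≈-reflexive same) (≈-sym (≈-trans (black-end k) (∼-blackEnd _ d′ p′))))) =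
        blackEnd-determines (edge i) p p′ same
      ... | false
        with same ← trans (sym (white-∈ d eq q)) (white-∈ d′ eq q′)
        with refl ← act-injective π (w-unique (≈-trans (≈-trans (white-end i) (∼-whiteEnd _ d p))
               (≈-trans (≈-reflexive same) (≈-sym (≈-trans (white-end k) (∼-whiteEnd _ d′ p′)))))) =
        whiteEnd-determines (edge i) p p′ same

      covered : ∀ s → ∃ λ d → InOrbit d × s ∈ᵈ d
      covered s with isBlack s in eq
      ... | true
        with i , bi≈s ← locate-black s eq
        with translate (v , v∈L , refl) ← ≈-trans (≈-sym (black-end i)) bi≈s =
        shift v (edge i) , (i , v , v∈L , refl) , ∈-shift v (edge i) (blackEnd-∈ (edge i))
      ... | false
        with j , wj≈s ← locate-white s eq
        with i , refl ← act-surjective π j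
        with translate (v , v∈L , refl) ← ≈-trans (≈-sym (white-end i)) wj≈s =
        shift v (edge i) , (i , v , v∈L , refl) , ∈-shift v (edge i) (whiteEnd-∈ (edge i))

      tiling : Tiling
      tiling = record
        { contains = λ d → ⌊ inOrbit? d ⌋
        ; covering = λ s → let d , p , q = covered s in d , fromWitness p , q
        ; disjoint = λ d d′ p p′ d≢d′ (s , q , q′) → d≢d′ (same-square (toWitness p) (toWitness p′) q q′)
        }

      periodic : Periodic L tiling
      periodic v v∈L d = T-ext
        (λ p → let i , r = toWitness p in fromWitness (i , ∼-trans (edge i) (shift v d) d r (∼-sym d (shift v d) (v , v∈L , refl))))
        (λ p → let i , r = toWitness p in fromWitness (i , ∼-trans (edge i) d (shift v d) r (v , v∈L , refl)))

      containsAll : ContainsAll tiling z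
      containsAll i = fromWitness (i , ∼-refl (edge i))

    module ChoiceOfTiling (t : Tiling) (per : Periodic L t) where

      cover : Fin m → Domino
      cover i = proj₁ (Tiling.covering t (b i))

      cover-contained : ∀ i → T (contains t (cover i))
      cover-contained i = proj₁ (proj₂ (Tiling.covering t (b i)))

      cover-black : ∀ i → b i ≡ blackEnd (cover i)
      cover-black i = black-∈ (cover i) (b-black i) (proj₂ (proj₂ (Tiling.covering t (b i))))

      partner : Fin m → Fin m
      partner i = proj₁ (locate-white (whiteEnd (cover i)) (whiteEnd-white (cover i)))

      cover-white : ∀ i → w (partner i) ≈ whiteEnd (cover i)
      cover-white i = proj₂ (locate-white (whiteEnd (cover i)) (whiteEnd-white (cover i)))

      -- With equal partners the two covering dominoes have white ends that are translates of each
      -- other. They are then translates themselves, and so are their black ends.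
      partner-injective : ∀ {i k} → partner i ≡ partner k → i ≡ k
      partner-injective {i} {k} eq = b-unique (subst₂ _≈_ (sym (cover-black i)) (sym (cover-black k))
        (∼-blackEnd (cover i) (cover k) (tiling-orbit {t} per (cover i) (cover k) (cover-contained i) (cover-contained k)
          (whiteEnd-∈ (cover i)) (whiteEnd-∈ (cover k))
          (≈-trans (≈-sym (cover-white i)) (≈-trans (≈-reflexive (cong w eq)) (cover-white k))))))

      representative : ∀ i → ∃ λ e → e ∈ˡ edges i (partner i) × _∼_ {L} e (cover i)
      representative i = find (OrbitRepresentatives.complete (orbits i (partner i)) (cover i)
        (joins⇐ (cover i) (≈-reflexive (cover-black i)) (cover-white i)))

      permutation : ∃ λ π → ∀ i → act π i ≡ partner i
      permutation = encode partner partner-injective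

      choice : Choice {Edge} m
      choice = proj₁ permutation , Vec.tabulate (λ i → proj₁ (representative i))

      isChoice : IsChoice edges choice
      isChoice i = subst₂ (λ e j → e ∈ˡ edges i j) (sym (Vec.lookup∘tabulate (λ i → proj₁ (representative i)) i))
        (sym (proj₂ permutation i)) (proj₁ (proj₂ (representative i)))

      containsAll : ContainsAll t choice
      containsAll i = subst (λ e → T (contains t e)) (sym (Vec.lookup∘tabulate (λ i → proj₁ (representative i)) i))
        (∼-contains {t} per (cover i) e (∼-sym e (cover i) (proj₂ (proj₂ (representative i)))) (cover-contained i))
        where e = proj₁ (representative i)

    -- For each i both choices take a domino of t over a translate of b i, hence edges of one orbit.
    -- The orbit fixes the white square, and each entry lists an orbit only once.
    choice-unique : ∀ {t} → Periodic L t → ∀ z z′ → IsChoice edges z → IsChoice edges z′ →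
                    ContainsAll t z → ContainsAll t z′ → z ≡ z′
    choice-unique {t} per (π , es) (π′ , es′) ok ok′ all all′ = cong₂ _,_ π≡π′
      (trans (sym (Vec.tabulate∘lookup es)) (trans (Vec.tabulate-cong edge≡) (Vec.tabulate∘lookup es′)))
      where
      orbit : ∀ i → _∼_ {L} (Vec.lookup es i) (Vec.lookup es′ i)
      orbit i = tiling-orbit {t} per _ _ (all i) (all′ i) (blackEnd-∈ (Vec.lookup es i)) (blackEnd-∈ (Vec.lookup es′ i))
        (≈-trans (≈-sym (proj₁ (edges-ends (ok i)))) (proj₁ (edges-ends (ok′ i))))
      act≡ : ∀ i → act π i ≡ act π′ i
      act≡ i = w-unique (≈-trans (proj₂ (edges-ends (ok i)))
        (≈-trans (∼-whiteEnd (Vec.lookup es i) (Vec.lookup es′ i) (orbit i)) (≈-sym (proj₂ (edges-ends (ok′ i))))))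
      π≡π′ = act-faithful π π′ act≡
      edge≡ : ∀ i → Vec.lookup es i ≡ Vec.lookup es′ i
      edge≡ i = orbit-unique (OrbitRepresentatives.distinct (orbits i (act π i))) (ok i)
        (subst (λ j → Vec.lookup es′ i ∈ˡ edges i j) (sym (act≡ i)) (ok′ i)) (orbit i)

    -- The black end of a domino of t is a translate of some b i, so the domino is a translate of
    -- the i-th chosen edge, which t′ contains as well.
    tiling-determined : ∀ {t t′} → Periodic L t → Periodic L t′ → ∀ z → IsChoice edges z →
                        ContainsAll t z → ContainsAll t′ z → ∀ d → T (contains t d) → T (contains t′ d)
    tiling-determined {t} {t′} per per′ (π , es) ok all all′ d p
      with i , bi≈ ← locate-black (blackEnd d) (blackEnd-black d) =
      ∼-contains {t′} per′ (Vec.lookup es i) d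
        (tiling-orbit {t} per (Vec.lookup es i) d (all i) p (blackEnd-∈ (Vec.lookup es i)) (blackEnd-∈ d)
          (≈-trans (≈-sym (proj₁ (edges-ends (ok i)))) bi≈))
        (all′ i)

    tilings : List (Choice {Edge} m)
    tilings = choices edges

    tilings-unique : Unique tilings
    tilings-unique = choices-unique edges edges-unique

    abstract
      choiceOfTiling : ∀ t → Periodic L t → ∃ λ z → IsChoice edges z × ContainsAll t z
      choiceOfTiling t per = choice , isChoice , containsAll
        where open ChoiceOfTiling t per

      tilingOfChoice : ∀ z → IsChoice edges z → ∃ λ t → Periodic L t × ContainsAll t z
      tilingOfChoice z ok = tiling , periodic , containsAll
        where open TilingOfChoice z ok

    numberOfTilings : NumberOfTilings L (length tilings)
    numberOfTilings = record
      { to        = to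
      ; from      = from
      ; to-cong   = λ { refl _ → refl }
      ; from-cong = λ {t} {t′} t≈t′ → lookup-injective tilings-unique
          (choice-unique {proj₁ t′} (proj₂ t′) (at (from t)) (at (from t′)) (at-ok (from t)) (at-ok (from t′))
            (λ i → subst T (t≈t′ _) (from-contained t i)) (from-contained t′))
      ; inverse   =
          (λ { {t} {k} refl d → T-ext
               (tiling-determined {proj₁ (to k)} {proj₁ t} (proj₂ (to k)) (proj₂ t) (at k) (at-ok k) (to-contains k) (from-contained t) d)
               (tiling-determined {proj₁ t} {proj₁ (to k)} (proj₂ t) (proj₂ (to k)) (at k) (at-ok k) (from-contained t) (to-contains k) d) })
        , (λ {k} {t} t≈ → lookup-injective tilings-unique
             (choice-unique {proj₁ t} (proj₂ t) (at (from t)) (at k) (at-ok (from t)) (at-ok k) (from-contained t)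
               (λ i → subst T (sym (t≈ _)) (to-contains k i))))
      }
      where
      at : Fin (length tilings) → Choice {Edge} m
      at = lookup tilings
      at-ok : ∀ k → IsChoice edges (at k)
      at-ok k = ∈-choices⁻ edges (∈-lookup k)
      to : Fin (length tilings) → Σ Tiling (Periodic L)
      to k = let t , per , _ = tilingOfChoice (at k) (at-ok k) in t , per
      to-contains : ∀ k → ContainsAll (proj₁ (to k)) (at k)
      to-contains k = proj₂ (proj₂ (tilingOfChoice (at k) (at-ok k)))
      position : ∀ t → proj₁ (choiceOfTiling (proj₁ t) (proj₂ t)) ∈ˡ tilings
      position t = ∈-choices⁺ edges (proj₁ (proj₂ (choiceOfTiling (proj₁ t) (proj₂ t))))
      from : Σ Tiling (Periodic L) → Fin (length tilings)
      from t = index (position t)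
      from-contained : ∀ t → ContainsAll (proj₁ t) (at (from t))
      from-contained t = subst (ContainsAll (proj₁ t)) (Any.lookup-index (position t))
        (proj₂ (proj₂ (choiceOfTiling (proj₁ t) (proj₂ t))))

    -- Signs and exponents of the terms.

    orbitWeight : Edge → Monomial
    orbitWeight e = monomial (edgeSign {L} e) (exponent {L} (u₀ basis) e) (exponent {L} (u₁ basis) e)

    open Expansion orbitWeight
    open Colouring W R′ x W-even 0<W blackCell whiteCell black-rect white-rect
      blackCell-injective whiteCell-injective black≢white exhaustive

    blackLeft : Edge → Bool
    blackLeft e = not (isVertical (orientation e)) · isBlack (first e)

    edgeSign-blackLeft : ∀ e → edgeSign {L} e ≡ signℤ (blackLeft e)
    edgeSign-blackLeft (domino horizontal s) = cong (λ β → if β then -1ℤ else 1ℤ) (does-black? s)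
    edgeSign-blackLeft (domino vertical   s) = refl

    module _ (z : Choice {Edge} m) (ok : IsChoice edges z) where

      open TilingOfChoice z ok using (π; edge; black-end; white-end)

      firstCell : Fin m → Cell
      firstCell i = proj₁ (reduce (first (edge i)))

      firstCell-rect : ∀ i → InRect (firstCell i)
      firstCell-rect i = proj₁ (proj₂ (reduce (first (edge i))))

      first≈ : ∀ i → first (edge i) ≈ cell (firstCell i)
      first≈ i = proj₂ (proj₂ (reduce (first (edge i))))

      vertical? : Fin m → Bool
      vertical? i = isVertical (orientation (edge i))

      secondCell : Fin m → Cell
      secondCell i = proj₁ (successor (orientation (edge i)) (firstCell-rect i))

      secondCell-rect : ∀ i → InRect (secondCell i)
      secondCell-rect i = proj₁ (proj₂ (successor (orientation (edge i)) (firstCell-rect i)))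

      next : ∀ i → Next (vertical? i) (firstCell i) (secondCell i)
      next i = proj₁ (proj₂ (proj₂ (successor (orientation (edge i)) (firstCell-rect i))))

      second≈ : ∀ i → second (edge i) ≈ cell (secondCell i)
      second≈ i = ≈-trans (≈-⊕ (unit (orientation (edge i))) (first≈ i))
        (proj₂ (proj₂ (proj₂ (successor (orientation (edge i)) (firstCell-rect i)))))

      black-at : ∀ {i p s} → InRect p → s ≈ cell p → b i ≈ s → p ≡ blackCell i
      black-at {i} rect s≈ b≈ = sym (cell-unique (black-rect i) rect (≈-trans (≈-reflexive (sym (b≡ i))) (≈-trans b≈ s≈)))

      white-at : ∀ {j p s} → InRect p → s ≈ cell p → w j ≈ s → p ≡ whiteCell j
      white-at {j} rect s≈ w≈ = sym (cell-unique (white-rect j) rect (≈-trans (≈-reflexive (sym (w≡ j))) (≈-trans w≈ s≈)))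

      ends : ∀ i → (isBlack (first (edge i)) ≡ true  × firstCell i ≡ blackCell i × secondCell i ≡ whiteCell (act π i))
                 ⊎ (isBlack (first (edge i)) ≡ false × firstCell i ≡ whiteCell (act π i) × secondCell i ≡ blackCell i)
      ends i with isBlack (first (edge i)) | black-end i | white-end i
      ... | true  | b≈ | w≈ = inj₁ (refl , black-at (firstCell-rect i) (first≈ i) b≈ , white-at (secondCell-rect i) (second≈ i) w≈)
      ... | false | b≈ | w≈ = inj₂ (refl , white-at (firstCell-rect i) (first≈ i) w≈ , black-at (secondCell-rect i) (second≈ i) b≈)

      open Matching π vertical? firstCell secondCell next (λ i → isBlack (first (edge i)))
        (λ i → ≈-isBlack (first≈ i)) ends using (risers; leftTops; wraps; kasteleyn-sign)

      term-risers : oddℤ (deg₀ (term z)) ≡ risers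
      term-risers = trans (term-deg₀ π (proj₂ z)) (sum-cong-≗ pointwise)
        where
        pointwise : ∀ i → oddℤ (deg₀ (orbitWeight (edge i))) ≡ vertical? i · isTop (firstCell i)
        pointwise i = u₀-exponent (edge i) {firstCell i} (firstCell-rect i) (first≈ i)

      term-sides : oddℤ (deg₁ (term z)) ≡ leftTops ∔ wraps
      term-sides = trans (term-deg₁ π (proj₂ z)) (trans (sum-cong-≗ pointwise)
        (∑-distrib-+ (λ i → vertical? i · leftTop (firstCell i)) (λ i → not (vertical? i) · isWrap (firstCell i))))
        where
        pointwise : ∀ i → oddℤ (deg₁ (orbitWeight (edge i)))
                        ≡ vertical? i · leftTop (firstCell i) ∔ not (vertical? i) · isWrap (firstCell i)
        pointwise i = u₁-exponent (edge i) {firstCell i} (firstCell-rect i) (first≈ i)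

      -- Permutation sign and edge signs together form the left side of `kasteleyn-sign`; the two
      -- counts on its right side are the parities of the exponents of the term.
      term-signed : KasteleynSigned enumerationSign slope (term z)
      term-signed = begin
        coeff (term z)
          ≡⟨ term-coeff blackLeft edgeSign-blackLeft π (proj₂ z) ⟩
        signℤ (codeParity π ∔ ∑[ i < m ] blackLeft (edge i))
          ≡⟨ cong signℤ kasteleyn-sign ⟩
        signℤ (enumerationSign ∔ (risers · (leftTops ∔ wraps) ∔ (leftTops ∔ wraps) ∔ risers · slope))
          ≡⟨ cong₂ (λ a₀ a₁ → signℤ (enumerationSign ∔ (a₀ · a₁ ∔ a₁ ∔ a₀ · slope))) term-risers term-sides ⟨
        signℤ (enumerationSign ∔ (oddℤ (deg₀ (term z)) · oddℤ (deg₁ (term z)) ∔ oddℤ (deg₁ (term z)) ∔ oddℤ (deg₀ (term z)) · slope)) ∎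
        where open ≡-Reasoning

    entries : Fin m → Fin m → Laurent
    entries i j = foldr _++_ [] (map (weight basis) (edges i j))

    entries-monomials : ∀ i j → entries i j ≡ map orbitWeight (edges i j)
    entries-monomials i j = concat-singletons (edges i j)
      where
      concat-singletons : ∀ es → foldr _++_ [] (map (weight basis) es) ≡ map orbitWeight es
      concat-singletons []       = refl
      concat-singletons (e ∷ es) = cong (orbitWeight e ∷_) (concat-singletons es)

    countSign : Bool
    countSign = enumerationSign

    count-formula : (+ length tilings) ℚ./ 1 ≡ spinSum countSign slope (det laurentRawRing entries)
    count-formula = begin
      (+ length tilings) ℚ./ 1
        ≡⟨ cong (λ n → (+ n) ℚ./ 1) (List.length-map term tilings) ⟨
      (+ length (map term tilings)) ℚ./ 1
        ≡⟨ spinSum-length countSign slope (map term tilings)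
             (All.map⁺ (All.tabulate λ {z} z∈ → term-signed z (∈-choices⁻ edges z∈))) ⟩
      spinSum countSign slope (map term tilings)
        ≡⟨ cong (spinSum countSign slope) (det-choices entries edges entries-monomials) ⟨
      spinSum countSign slope (det laurentRawRing entries) ∎
      where open ≡-Reasoning

proposition8p3p5 : (L : ValidLattice) (K : KasteleynMatrix L) →
    let p = KasteleynMatrix.polynomial K in
    Σ[ s₀₀ ∈ ℚ ] Σ[ s₀₁ ∈ ℚ ] Σ[ s₁₀ ∈ ℚ ] Σ[ s₁₁ ∈ ℚ ]
    (s₀₀ ≡ ½ ⊎ s₀₀ ≡ - ½) × (s₀₁ ≡ ½ ⊎ s₀₁ ≡ - ½) ×
    (s₁₀ ≡ ½ ⊎ s₁₀ ≡ - ½) × (s₁₁ ≡ ½ ⊎ s₁₁ ≡ - ½) ×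
    (Σ[ N ∈ ℕ ] NumberOfTilings L N ×
    (+ N) / 1 ≡ s₀₀ * evaluate p 1ℚ 1ℚ + s₀₁ * evaluate p 1ℚ (- 1ℚ)
    + s₁₀ * evaluate p (- 1ℚ) 1ℚ + s₁₁ * evaluate p (- 1ℚ) (- 1ℚ))
-- Positivity makes y₁ a successor, so that R′ is available as the index of the top row.
proposition8p3p5 L record { basis = record { y₁ = zero ; y₁-positive = () } }
proposition8p3p5 L record
  { basis = record
    { x₀ = W ; y₁ = suc R′ ; x₁ = x ; x₀-positive = 0<W ; v₀-∈ = v₀-∈ ; x₀-least = x₀-least
    ; v₁-∈ = v₁-∈ ; y₁-least = y₁-least ; x₁<x₀ = x<W }
  ; blacks = blacks ; whites = whites ; orbits = orbits } =
  spin₀₀ ε slope , spin₀₁ ε slope , spin₁₀ ε slope , spin₁₁ ε slope ,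
  halfSign-½ _ , halfSign-½ _ , halfSign-½ _ , halfSign-½ _ ,
  length tilings , numberOfTilings , count-formula
  where
  open Torus W R′ x using (slope)
  open Reduction L W R′ x 0<W v₀-∈ x₀-least v₁-∈ y₁-least x<W
  open Counting blacks whites orbits using (tilings; numberOfTilings; count-formula; countSign)
  ε = countSign
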